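{- Let $G$ be a graph of order $n$ and size $m$. Assume that $G$ is neither complete nor co-complete and let $c$ be an integer number such that $4\leq c\leq n-4$. If $\ell_\star$ and $u^\star$ are integers such that $0\leq \ell_\star\leq \ell(c)\leq u(c)\leq u^\star$, then $G$ has a subgraph of order $c$ whose size is at least $$\left\lceil\min\left\{\frac{2S_2(c)}{S_1(c)}+1,\;S_1(c)+\frac{\sigma^2(c)}{S_1(c)-\ell_\star}\right\}\right\rceil$$ and a subgraph of order $c$ whose size is at most $$\left\lfloor S_1(c)-\frac{\sigma^2(c)}{u^\star-S_1(c)}\right\rfloor,$$ where $\sigma^2(c)=2S_2(c)-S_1(c)(S_1(c)-1)$ and $\ell(c)$ and $u(c)$ are the minimum and the maximum of the values attained with positive probability by $M_c(G)$. The lower and upper bounds are attained precisely by the following graphs, when $\ell_\star=\ell(c)$ and $u^\star=u(c)$, respectively: a star, the disjoint union of an edge and $n-2$ vertices, or the complement of such graphs. We can always choose $\gamma_c$ for $u^\star$ and $c-\alpha^\star$ for $\ell_\star$, where $\alpha^\star$ is any upper bound on the independence number of $G$. Moreover, given $u^\star$ and $\ell_\star$, the bounds can be computed in time linear in the size of $G$.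
   Context: Graphs are simple; the order of a graph is its number of vertices and its size is its number of edges. A graph is co-complete if it is the complement of a complete graph. Subgraphs of order $c$ here are the subgraphs induced by sets of $c$ vertices. $M_c(G)$ is the random variable defined as the size of the subgraph of $G$ induced by a uniformly random set of $c$ vertices of $G$. Its first two binomial moments are $S_1(c)=\mathbb{E}(M_c(G))$ and $S_2(c)=\frac12\mathbb{E}\big(M_c(G)(M_c(G)-1)\big)$, and $\sigma^2(c)$ is its variance. The number $\gamma_c$ is $\lfloor c/2\rfloor\lceil c/2\rceil$ (the size of the balanced complete bipartite graph on $c$ vertices) if $G$ is bipartite, and $\frac{c(c-1)}{2}$ (the size of the complete graph on $c$ vertices) otherwise.
   Formalization: The minimum always equals 2S₂/S₁+1, so it is attained only by a star or one edge plus n−2 vertices; the four listed graphs are those attaining S₁+σ²/(S₁−ℓ(c)). Attained means before rounding; c−α⋆ may be negative, and the bound still holds. -}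

module Defs where

open import Data.Bool using (if_then_else_)
open import Data.Fin as Fin using (Fin; toℕ)
open import Data.Fin.Properties as Fin using (all?)
open import Data.Fin.Subset using (Subset; inside; outside; _∈_; _∉_; ∣_∣)
open import Data.Fin.Subset.Properties using (_∈?_; anySubset?)
open import Data.Integer as ℤ using (ℤ; +_; -[1+_])
open import Data.Integer.DivMod as ℤ using ()
open import Data.List using (List; []; _∷_; _++_; map; filter; foldr; length; allFin; cartesianProduct; concatMap)
open import Data.List.Extrema.Nat using (min; max)
open import Data.Nat as ℕ using (ℕ; zero; suc; ⌊_/2⌋; ⌈_/2⌉)
open import Data.Nat.DivMod as ℕ using ()
open import Data.Product using (∃; _×_; _,_)
open import Data.Rational as ℚ using (ℚ; 0ℚ; 1ℚ; ½; _+_; _-_; _*_; _÷_; _⊓_)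
open import Data.Rational.Properties as ℚ using ()
open import Data.Sum using (_⊎_)
open import Data.Vec using ([]; _∷_)
open import Function using (_⇔_; _∘_)
open import Level using (0ℓ)
open import Relation.Binary using (Rel; Decidable; Symmetric; Irreflexive)
open import Relation.Binary.PropositionalEquality using (_≡_; _≢_; sym)
open import Relation.Nullary using (¬_; Dec; yes; no; does)
open import Relation.Nullary.Decidable using (_×-dec_; _⊎-dec_; _→-dec_; ¬?)

record Graph (n : ℕ) : Set₁ where
  infix 4 _~_ _~?_
  field
    _~_      : Rel (Fin n) 0ℓ
    _~?_     : Decidable _~_
    ~-sym    : Symmetric _~_
    ~-irrefl : Irreflexive _≡_ _~_

open Graph public using () renaming (_~_ to Adj; _~?_ to adj?)

complement : ∀ {n} → Graph n → Graph n
complement G = record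
  { _~_      = λ i j → i ≢ j × ¬ Adj G i j
  ; _~?_     = λ i j → ¬? (i Fin.≟ j) ×-dec ¬? (adj? G i j)
  ; ~-sym    = λ (i≢j , i≁j) → i≢j ∘ sym , i≁j ∘ Graph.~-sym G
  ; ~-irrefl = λ i≡j (i≢j , _) → i≢j i≡j
  }

Complete : ∀ {n} → Graph n → Set
Complete G = ∀ i j → i ≢ j → Adj G i j

CoComplete : ∀ {n} → Graph n → Set
CoComplete G = Complete (complement G)

IsStar : ∀ {n} → Graph n → Set
IsStar G = ∃ λ v → ∀ i j → Adj G i j ⇔ (i ≢ j × (i ≡ v ⊎ j ≡ v))

-- The disjoint union of an edge and n - 2 isolated vertices.
IsSingleEdge : ∀ {n} → Graph n → Set
IsSingleEdge G = ∃ λ x → ∃ λ y → x ≢ y ×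
  (∀ i j → Adj G i j ⇔ ((i ≡ x × j ≡ y) ⊎ (i ≡ y × j ≡ x)))

Bipartite : ∀ {n} → Graph n → Set
Bipartite {n} G = ∃ λ (X : Subset n) → ∀ i j → Adj G i j → (i ∈ X × j ∉ X) ⊎ (i ∉ X × j ∈ X)

bipartite? : ∀ {n} (G : Graph n) → Dec (Bipartite G)
bipartite? G = anySubset? λ X → all? λ i → all? λ j →
  adj? G i j →-dec ((i ∈? X ×-dec ¬? (j ∈? X)) ⊎-dec (¬? (i ∈? X) ×-dec j ∈? X))

Independent : ∀ {n} → Graph n → Subset n → Set
Independent G S = ∀ i j → i ∈ S → j ∈ S → ¬ Adj G i j

independent? : ∀ {n} (G : Graph n) (S : Subset n) → Dec (Independent G S)
independent? G S = all? λ i → all? λ j →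
  (i ∈? S) →-dec ((j ∈? S) →-dec ¬? (adj? G i j))

subsets : ∀ n → List (Subset n)
subsets zero    = [] ∷ []
subsets (suc n) = map (inside ∷_) (subsets n) ++ map (outside ∷_) (subsets n)

subsetsOfSize : ∀ n → ℕ → List (Subset n)
subsetsOfSize n c = filter (λ S → ∣ S ∣ ℕ.≟ c) (subsets n)

independenceNumber : ∀ {n} → Graph n → ℕ
independenceNumber {n} G = max 0 (map ∣_∣ (filter (independent? G) (subsets n)))

-- Each edge {i , j} is listed once, as the pair (i , j) with i < j.
edges : ∀ {n} → Graph n → List (Fin n × Fin n)
edges {n} G = filter (λ (i , j) → (i Fin.<? j) ×-dec adj? G i j) (cartesianProduct (allFin n) (allFin n))

size : ∀ {n} → Graph n → ℕ
size G = length (edges G)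

inducedSize : ∀ {n} → Graph n → Subset n → ℕ
inducedSize G S = length (filter (λ (i , j) → (i ∈? S) ×-dec (j ∈? S)) (edges G))

fromℤ : ℤ → ℚ
fromℤ k = k ℚ./ 1

fromℕ : ℕ → ℚ
fromℕ k = fromℤ (+ k)

-- Division made total by p ⟋ 0 = 0.
infixl 7 _⟋_
_⟋_ : ℚ → ℚ → ℚ
p ⟋ q with q ℚ.≟ 0ℚ
... | yes _   = 0ℚ
... | no  q≢0 = _÷_ p q {{ℚ.≢-nonZero q≢0}}

sum : List ℚ → ℚ
sum = foldr _+_ 0ℚ

minimum : List ℕ → ℕ
minimum []       = 0
minimum (k ∷ ks) = min k ks

-- Expectation over a uniformly random set of c vertices.
𝔼 : (n c : ℕ) → (Subset n → ℚ) → ℚ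
𝔼 n c X = sum (map X (subsetsOfSize n c)) ⟋ fromℕ (length (subsetsOfSize n c))

-- The random variable M_c(G), as a function of the random set of c vertices.
M : ∀ {n} → Graph n → Subset n → ℚ
M G S = fromℕ (inducedSize G S)

module _ {n : ℕ} (G : Graph n) (c : ℕ) where

  S₁ : ℚ
  S₁ = 𝔼 n c (M G)

  S₂ : ℚ
  S₂ = ½ * 𝔼 n c (λ S → M G S * (M G S - 1ℚ))

  σ² : ℚ
  σ² = 𝔼 n c (λ S → (M G S - S₁) * (M G S - S₁))

  -- Every set of c vertices has positive probability, so these are exactly
  -- the values that M_c(G) takes with positive probability.
  values : List ℕ
  values = map (inducedSize G) (subsetsOfSize n c)

  ℓ : ℕ
  ℓ = minimum values

  u : ℕ
  u = max 0 values

  γ : ℕ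
  γ = if does (bipartite? G) then ⌊ c /2⌋ ℕ.* ⌈ c /2⌉ else (c ℕ.* (c ℕ.∸ 1)) ℕ./ 2

  -- Since 2 S₂ / S₁ + 1 = S₁ + σ² / S₁, lowerTerm ℓ⋆ exceeds the other term of
  -- the minimum in lowerBound when 0 < ℓ⋆ < S₁ and σ² > 0.
  lowerTerm : ℤ → ℚ
  lowerTerm ℓ⋆ = S₁ + σ² ⟋ (S₁ - fromℤ ℓ⋆)

  lowerBound : ℤ → ℚ
  lowerBound ℓ⋆ = (fromℕ 2 * S₂ ⟋ S₁ + 1ℚ) ⊓ lowerTerm ℓ⋆

  upperBound : ℤ → ℚ
  upperBound u⋆ = S₁ - σ² ⟋ (fromℤ u⋆ - S₁)

  HasSubgraphOfSizeAtLeast : ℤ → Set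
  HasSubgraphOfSizeAtLeast k = ∃ λ S → ∣ S ∣ ≡ c × k ℤ.≤ + inducedSize G S

  HasSubgraphOfSizeAtMost : ℤ → Set
  HasSubgraphOfSizeAtMost k = ∃ λ S → ∣ S ∣ ≡ c × + inducedSize G S ℤ.≤ k

-- Programs of a word RAM: while programs over integer variables, a read-only
-- input array and a work array.

infixl 6 _⊕_ _⊖_
infixl 7 _⊗_ _⊘_

data Expr : Set where
  lit                 : ℤ → Expr
  var                 : ℕ → Expr
  input work          : Expr → Expr
  _⊕_ _⊖_ _⊗_ _⊘_     : Expr → Expr → Expr

infix  5 _≔_ work[_]≔_
infixr 4 _⨟_

data Program : Set where
  skip        : Program
  _≔_         : ℕ → Expr → Program
  work[_]≔_   : Expr → Expr → Program
  _⨟_         : Program → Program → Program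
  if>0        : Expr → Program → Program → Program
  while>0     : Expr → Program → Program

record State : Set where
  constructor ⟨_,_⟩
  field
    variables : ℕ → ℤ
    workArray : ℤ → ℤ

open State public

-- Out-of-range reads return 0.
_at_ : List ℤ → ℤ → ℤ
[]       at _           = + 0
(x ∷ xs) at (+ zero)    = x
(x ∷ xs) at (+ (suc k)) = xs at (+ k)
(x ∷ xs) at -[1+ _ ]    = + 0

-- Floor division for positive divisors; division by 0 gives 0.
quotient : ℤ → ℤ → ℤ
quotient a (+ zero)      = + 0
quotient a b@(+ (suc _)) = a ℤ./ b
quotient a b@(-[1+ _ ])  = a ℤ./ b

eval : List ℤ → State → Expr → ℤ
eval I s (lit k)   = k
eval I s (var x)   = variables s x
eval I s (input e) = I at eval I s e
eval I s (work e)  = workArray s (eval I s e)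
eval I s (e ⊕ f)   = eval I s e ℤ.+ eval I s f
eval I s (e ⊖ f)   = eval I s e ℤ.- eval I s f
eval I s (e ⊗ f)   = eval I s e ℤ.* eval I s f
eval I s (e ⊘ f)   = quotient (eval I s e) (eval I s f)

cost : Expr → ℕ
cost (lit _)   = 1
cost (var _)   = 1
cost (input e) = 1 ℕ.+ cost e
cost (work e)  = 1 ℕ.+ cost e
cost (e ⊕ f)   = 1 ℕ.+ cost e ℕ.+ cost f
cost (e ⊖ f)   = 1 ℕ.+ cost e ℕ.+ cost f
cost (e ⊗ f)   = 1 ℕ.+ cost e ℕ.+ cost f
cost (e ⊘ f)   = 1 ℕ.+ cost e ℕ.+ cost f

setVar : State → ℕ → ℤ → State
setVar s x k = record s { variables = λ y → if does (y ℕ.≟ x) then k else variables s y }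

setWork : State → ℤ → ℤ → State
setWork s a k = record s { workArray = λ b → if does (b ℤ.≟ a) then k else workArray s b }

-- Exec I W P s t s′: on input array I, program P takes s to s′ in t steps, each
-- operation costing one step, and never stores a value or an address above W
-- in absolute value. The value of an expression is polynomial in the stored
-- values, so restricting stores alone keeps all words of length O(log W).
data Exec (I : List ℤ) (W : ℕ) : Program → State → ℕ → State → Set where
  skip : ∀ {s} → Exec I W skip s 1 s
  assign : ∀ {s x e} → ℤ.∣ eval I s e ∣ ℕ.≤ W →
    Exec I W (x ≔ e) s (1 ℕ.+ cost e) (setVar s x (eval I s e))
  store : ∀ {s a e} → ℤ.∣ eval I s a ∣ ℕ.≤ W → ℤ.∣ eval I s e ∣ ℕ.≤ W →
    Exec I W (work[ a ]≔ e) s (1 ℕ.+ cost a ℕ.+ cost e) (setWork s (eval I s a) (eval I s e))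
  seq : ∀ {P Q s s′ s″ t t′} → Exec I W P s t s′ → Exec I W Q s′ t′ s″ →
    Exec I W (P ⨟ Q) s (t ℕ.+ t′) s″
  if-true : ∀ {P Q e s s′ t} → + 0 ℤ.< eval I s e → Exec I W P s t s′ →
    Exec I W (if>0 e P Q) s (1 ℕ.+ cost e ℕ.+ t) s′
  if-false : ∀ {P Q e s s′ t} → ¬ (+ 0 ℤ.< eval I s e) → Exec I W Q s t s′ →
    Exec I W (if>0 e P Q) s (1 ℕ.+ cost e ℕ.+ t) s′
  while-true : ∀ {P e s s′ s″ t t′} → + 0 ℤ.< eval I s e → Exec I W P s t s′ →
    Exec I W (while>0 e P) s′ t′ s″ →
    Exec I W (while>0 e P) s (1 ℕ.+ cost e ℕ.+ t ℕ.+ t′) s″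
  while-false : ∀ {P e s} → ¬ (+ 0 ℤ.< eval I s e) →
    Exec I W (while>0 e P) s (1 ℕ.+ cost e) s

encodeEdges : ∀ {n} → List (Fin n × Fin n) → List ℤ
encodeEdges = concatMap λ (i , j) → + toℕ i ∷ + toℕ j ∷ []

-- Everything not set here, including the whole work array, starts at 0.
initial : (n m c : ℕ) (ℓ⋆ u⋆ : ℤ) → State
initial n m c ℓ⋆ u⋆ = ⟨ vars , (λ _ → + 0) ⟩
  where
  vars : ℕ → ℤ
  vars 0 = + n
  vars 1 = + m
  vars 2 = + c
  vars 3 = ℓ⋆
  vars 4 = u⋆
  vars _ = + 0

{-# OPTIONS --safe #-}
-- The bounds are the two ways of solving E[(M - ℓ⋆)(u⋆ - M)] ≥ 0 (the
-- Bhatia–Davis inequality), and each is attained exactly when M takes only the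
-- values ℓ and u.  So the extremal graphs are those whose induced subgraphs of
-- order c have only two sizes p and p + D.  Exchanging u for v in a set of c
-- vertices shows that, for every set R of c - 1 other vertices, the number of
-- neighbours of u in R minus that of v is 0 or ±D.  If D is not 1 or 2, exchanging
-- one vertex of R shows that all vertices tell u and v apart in the same way,
-- which leaves stars and their complements.  If D is 1 or 2, exchanging D + 1
-- vertices at once shows that at most D vertices are adjacent to u but not to
-- v.  This excludes D = 2 and, for D = 1, leaves matchings and their
-- complements, in which a second edge would change M by 2.
-- A set of k vertices lies in the random set with a probability P k depending
-- only on k, so the two moments depend only on n, c, the number m of edges and
-- the number of pairs of adjacent edges.  The latter is found in one pass over
-- the edges, by adding up the numbers of earlier edges at both ends.
module Submission where

open import Data.Bool using (true; false; if_then_else_)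
open import Data.Fin as Fin using (Fin; toℕ)
import Data.Fin.Properties as Fin
open import Data.Fin.Subset using (Subset; inside; outside; _∈_; _∉_; _⊆_; ∁; ⊤)
open import Data.Fin.Subset.Properties using (_∈?_; ∉⊥; ∣⊥∣≡0; ∣⊤∣≡n; ∣∁p∣≡n∸∣p∣; x∉p⇒x∈∁p; x∈∁p⇒x∉p; p⊆q⇒∣p∣≤∣q∣; drop-∷-⊆; out⊆; s⊆s; _⊆?_; ∣p∣≤n)
open import Data.Integer as ℤ using (ℤ; +_; 0ℤ; 1ℤ; -1ℤ; +≤+; -<+; +<+)
import Data.Integer.DivMod as ℤ
import Data.Integer.Properties as ℤ
open import Data.Integer.Tactic.RingSolver using () renaming (solve-∀ to solveℤ-∀)
open import Data.List as List using (List; filter; length; cartesianProduct; tabulate; allFin; foldr; take; _ʳ++_; reverse)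
open import Data.List.Extrema.Nat using (min≤xs; min≤⊤; xs≤max; argmin-sel; argmax-sel)
open import Data.List.Membership.Propositional using () renaming (_∈_ to _∈ₗ_)
import Data.List.Membership.Propositional.Properties as ∈ₗ
import Data.List.Properties as List
open import Data.List.Relation.Binary.Permutation.Propositional as ↭ using (_↭_; ↭-sym; ↭-trans)
import Data.List.Relation.Binary.Permutation.Propositional.Properties as ↭
import Data.List.Relation.Binary.Permutation.Setoid.Properties as ↭ₛ
open import Data.List.Relation.Unary.All as All using (All)
import Data.List.Relation.Unary.All.Properties as All
open import Data.List.Relation.Unary.Unique.Propositional using (Unique)
import Data.List.Relation.Unary.Unique.Propositional.Properties as Unique
open import Data.Nat as ℕ using (ℕ; z≤n; s≤s; ⌊_/2⌋; ⌈_/2⌉)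
open import Data.Nat.Combinatorics using (_C_; nCk+nC[k+1]≡[n+1]C[k+1]; nC1≡n)
import Data.Nat.DivMod as ℕ
import Data.Nat.Divisibility as ℕ
import Data.Nat.Properties as ℕ
open import Data.Nat.Tactic.RingSolver using () renaming (solve-∀ to solveℕ-∀)
open import Data.Product using (_×_; _,_; ∃; ∃₂; ∃-syntax; proj₁; proj₂)
open import Data.Rational as ℚ using (ℚ; mkℚ; 0ℚ; 1ℚ; ½; floor; ceiling; toℚᵘ)
import Data.Rational.Properties as ℚ
open import Data.Rational.Unnormalised as ℚᵘ using (mkℚᵘ)
import Data.Rational.Unnormalised.Properties as ℚᵘ
open import Data.Sum as Sum using (_⊎_; inj₁; inj₂)
import Data.Vec as Vec
open import Function using (_∘_; id; mk⇔; Equivalence; _⇔_)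
open import Level using (0ℓ)
open import Relation.Binary using (tri<; tri≈; tri>)
open import Relation.Binary.PropositionalEquality
open import Relation.Nullary using (Dec; yes; no; does; ¬_; contradiction)
open import Relation.Nullary.Decidable using (_×-dec_; dec-true; dec-false; ¬?; decidable-stable; dec⇒maybe)
open import Tactic.RingSolver.Core.AlmostCommutativeRing using (AlmostCommutativeRing; fromCommutativeRing)

open import Defs

-- The numerical hypotheses come from divisibility. Inserting x or y into the same set of c - 2
-- vertices gives two balances that are multiples of D. If x is adjacent to u but not to v, they
-- differ by 0, 1 or 2, so only D = 1 and D = 2 allow a y that treats u and v differently. For these
-- D, inserting D + 1 vertices at once needs D < c - 1 and (c - 1) + 3 + D ≤ n; for D = 2 this is 4
-- ≤ c and c + 4 ≤ n. Hence c is written as 4 + r and the second condition as r + 8 ≤ n. The lower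
-- bound hides a subtlety. Its first term 2 S₂ / S₁ + 1 equals S₁ + σ² / S₁, which is `lowerTerm` at
-- 0, so for 0 ≤ ℓ⋆ ≤ ℓ the minimum is this term. If it equals u, the sizes are 0 and u, and some c
-- vertices are independent. The complements of a star and of a single edge contain no such set;
-- they attain only `lowerTerm` itself. This is why two different equality cases are proved for the
-- lower bound.

-- Indicators and finite sums of integers.

module Indicators where
  open import Data.Fin using (zero; suc)
  open import Data.Fin.Subset using (∣_∣)
  open import Data.Integer using (_+_; _*_; _≤_)
  open import Data.List using ([]; _∷_; _++_)
  open import Data.Vec using ([]; _∷_; there)
  open ≡-Reasoning

  open import Algebra.Properties.Semiring.Sum ℤ.+-*-semiring public
    using (sum-syntax; sum-cong-≗; ∑-distrib-+; ∑-comm; *-distribˡ-sum; *-distribʳ-sum)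

  -- Integer-valued, because differences of indicators and of degrees occur throughout.
  χ : ∀ {p} {P : Set p} → Dec P → ℤ
  χ P? = if does P? then 1ℤ else 0ℤ

  module _ {p} {P : Set p} where

    χ-yes : (P? : Dec P) → P → χ P? ≡ 1ℤ
    χ-yes P? p = cong (λ b → if b then 1ℤ else 0ℤ) (dec-true P? p)

    χ-no : (P? : Dec P) → ¬ P → χ P? ≡ 0ℤ
    χ-no P? ¬p = cong (λ b → if b then 1ℤ else 0ℤ) (dec-false P? ¬p)

    χ-idem : (P? : Dec P) → χ P? * χ P? ≡ χ P?
    χ-idem (yes _) = refl
    χ-idem (no _)  = refl

  χ-cong : ∀ {p q} {P : Set p} {Q : Set q} (P? : Dec P) (Q? : Dec Q) →
    (P → Q) → (Q → P) → χ P? ≡ χ Q?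
  χ-cong P? (yes q) _   Q⇒P = χ-yes P? (Q⇒P q)
  χ-cong P? (no ¬q) P⇒Q _   = χ-no P? (¬q ∘ P⇒Q)

  χ-× : ∀ {p q} {P : Set p} {Q : Set q} (P? : Dec P) (Q? : Dec Q) →
    χ (P? ×-dec Q?) ≡ χ P? * χ Q?
  χ-× (yes _) (yes _) = refl
  χ-× (yes _) (no _)  = refl
  χ-× (no _)  (yes _) = refl
  χ-× (no _)  (no _)  = refl

  ∑ₗ : ∀ {a} {A : Set a} → (A → ℤ) → List A → ℤ
  ∑ₗ f []       = 0ℤ
  ∑ₗ f (x ∷ xs) = f x + ∑ₗ f xs

  module _ {a} {A : Set a} where

    ∑ₗ-cong : {f g : A → ℤ} → f ≗ g → ∀ xs → ∑ₗ f xs ≡ ∑ₗ g xs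
    ∑ₗ-cong f≗g []       = refl
    ∑ₗ-cong f≗g (x ∷ xs) = cong₂ _+_ (f≗g x) (∑ₗ-cong f≗g xs)

    ∑ₗ-++ : (f : A → ℤ) → ∀ xs ys → ∑ₗ f (xs ++ ys) ≡ ∑ₗ f xs + ∑ₗ f ys
    ∑ₗ-++ f []       ys = sym (ℤ.+-identityˡ _)
    ∑ₗ-++ f (x ∷ xs) ys = begin
      f x + ∑ₗ f (xs ++ ys)       ≡⟨ cong (λ k → f x + k) (∑ₗ-++ f xs ys) ⟩
      f x + (∑ₗ f xs + ∑ₗ f ys)   ≡⟨ ℤ.+-assoc (f x) _ _ ⟨
      f x + ∑ₗ f xs + ∑ₗ f ys     ∎

    ∑ₗ-tabulate : (f : A → ℤ) → ∀ {n} (g : Fin n → A) → ∑ₗ f (tabulate g) ≡ ∑[ i < n ] f (g i)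
    ∑ₗ-tabulate f {ℕ.zero}  g = refl
    ∑ₗ-tabulate f {ℕ.suc n} g = cong (λ k → f (g zero) + k) (∑ₗ-tabulate f (g ∘ suc))

    ∑ₗ-filter : ∀ {p} {P : A → Set p} (P? : ∀ x → Dec (P x)) (f : A → ℤ) →
      ∀ xs → ∑ₗ f (filter P? xs) ≡ ∑ₗ (λ x → χ (P? x) * f x) xs
    ∑ₗ-filter P? f []       = refl
    ∑ₗ-filter P? f (x ∷ xs) with does (P? x)
    ... | true  = cong₂ _+_ (sym (ℤ.*-identityˡ (f x))) (∑ₗ-filter P? f xs)
    ... | false = trans (∑ₗ-filter P? f xs) (sym (ℤ.+-identityˡ _))

    length≡∑ₗ : (xs : List A) → + length xs ≡ ∑ₗ (λ _ → 1ℤ) xs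
    length≡∑ₗ []       = refl
    length≡∑ₗ (x ∷ xs) = cong (λ k → 1ℤ + k) (length≡∑ₗ xs)

    length-filter≡∑ₗ : ∀ {p} {P : A → Set p} (P? : ∀ x → Dec (P x)) →
      ∀ xs → + length (filter P? xs) ≡ ∑ₗ (λ x → χ (P? x)) xs
    length-filter≡∑ₗ P? xs = begin
      + length (filter P? xs)            ≡⟨ length≡∑ₗ (filter P? xs) ⟩
      ∑ₗ (λ _ → 1ℤ) (filter P? xs)       ≡⟨ ∑ₗ-filter P? (λ _ → 1ℤ) xs ⟩
      ∑ₗ (λ x → χ (P? x) * 1ℤ) xs        ≡⟨ ∑ₗ-cong (λ x → ℤ.*-identityʳ _) xs ⟩
      ∑ₗ (λ x → χ (P? x)) xs             ∎

  ∑ₗ-map : ∀ {a b} {A : Set a} {B : Set b} (f : B → ℤ) (g : A → B) →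
    ∀ xs → ∑ₗ f (List.map g xs) ≡ ∑ₗ (f ∘ g) xs
  ∑ₗ-map f g []       = refl
  ∑ₗ-map f g (x ∷ xs) = cong (λ k → f (g x) + k) (∑ₗ-map f g xs)

  ∑ₗ-cartesianProduct : ∀ {a b} {A : Set a} {B : Set b} (f : A × B → ℤ) →
    ∀ xs ys → ∑ₗ f (cartesianProduct xs ys) ≡ ∑ₗ (λ x → ∑ₗ (λ y → f (x , y)) ys) xs
  ∑ₗ-cartesianProduct f []       ys = refl
  ∑ₗ-cartesianProduct f (x ∷ xs) ys = begin
    ∑ₗ f (List.map (x ,_) ys ++ cartesianProduct xs ys)
      ≡⟨ ∑ₗ-++ f (List.map (x ,_) ys) _ ⟩
    ∑ₗ f (List.map (x ,_) ys) + ∑ₗ f (cartesianProduct xs ys)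
      ≡⟨ cong₂ _+_ (∑ₗ-map f (x ,_) ys) (∑ₗ-cartesianProduct f xs ys) ⟩
    ∑ₗ (λ y → f (x , y)) ys + ∑ₗ (λ x → ∑ₗ (λ y → f (x , y)) ys) xs
      ∎

  ∑-0 : ∀ n → ∑[ i < n ] 0ℤ ≡ 0ℤ
  ∑-0 ℕ.zero    = refl
  ∑-0 (ℕ.suc n) = trans (ℤ.+-identityˡ _) (∑-0 n)

  ∑-χ≟ : ∀ {n} (f : Fin n → ℤ) v → ∑[ i < n ] (χ (i Fin.≟ v) * f i) ≡ f v
  ∑-χ≟ {ℕ.suc n} f zero = begin
    1ℤ * f zero + ∑[ i < n ] (0ℤ * f (suc i))
      ≡⟨ cong₂ _+_ (ℤ.*-identityˡ (f zero)) (sum-cong-≗ (λ i → ℤ.*-zeroˡ (f (suc i)))) ⟩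
    f zero + ∑[ i < n ] 0ℤ
      ≡⟨ cong (λ k → f zero + k) (∑-0 n) ⟩
    f zero + 0ℤ
      ≡⟨ ℤ.+-identityʳ (f zero) ⟩
    f zero
      ∎
  ∑-χ≟ {ℕ.suc n} f (suc v) = begin
    0ℤ * f zero + ∑[ i < n ] (χ (suc i Fin.≟ suc v) * f (suc i))
      ≡⟨ cong₂ _+_ (ℤ.*-zeroˡ (f zero)) (sum-cong-≗ λ i → cong (_* f (suc i)) (χ-cong (suc i Fin.≟ suc v) (i Fin.≟ v) Fin.suc-injective (cong suc))) ⟩
    0ℤ + ∑[ i < n ] (χ (i Fin.≟ v) * f (suc i))
      ≡⟨ ℤ.+-identityˡ _ ⟩
    ∑[ i < n ] (χ (i Fin.≟ v) * f (suc i))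
      ≡⟨ ∑-χ≟ (f ∘ suc) v ⟩
    f (suc v)
      ∎

  ∑-mono : ∀ {n} {f g : Fin n → ℤ} → (∀ i → f i ≤ g i) → ∑[ i < n ] f i ≤ ∑[ i < n ] g i
  ∑-mono {ℕ.zero}  f≤g = ℤ.≤-refl
  ∑-mono {ℕ.suc n} f≤g = ℤ.+-mono-≤ (f≤g zero) (∑-mono (f≤g ∘ suc))

  ⟦_⟧ : ∀ {n} → Subset n → Fin n → ℤ
  ⟦ S ⟧ i = χ (i ∈? S)

  ∣S∣≡∑ : ∀ {n} (S : Subset n) → + ∣ S ∣ ≡ ∑[ i < n ] ⟦ S ⟧ i
  ∣S∣≡∑ []            = refl
  ∣S∣≡∑ (inside ∷ S)  = cong (λ k → 1ℤ + k) (trans (∣S∣≡∑ S) (sum-cong-≗ λ i → χ-cong (i ∈? S) (suc i ∈? (inside ∷ S)) there λ { (there i∈S) → i∈S }))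
  ∣S∣≡∑ (outside ∷ S) = trans (trans (∣S∣≡∑ S) (sum-cong-≗ λ i → χ-cong (i ∈? S) (suc i ∈? (outside ∷ S)) there λ { (there i∈S) → i∈S })) (sym (ℤ.+-identityˡ _))

-- Degrees into a vertex set and sizes of induced subgraphs.

module InducedSizes where
  open Indicators
  open import Data.Fin using (zero; suc)
  open import Data.Fin.Subset using (∣_∣)
  open import Data.Integer using (_+_; _*_; _-_; -_)
  open import Data.Integer.Tactic.RingSolver using (solve-∀)
  open import Data.Vec using (_∷_; _[_]≔_; here; there)
  open ≡-Reasoning

  module _ {n} (G : Graph n) where

    adj : Fin n → Fin n → ℤ
    adj i j = χ (adj? G i j)

    adj-sym : ∀ i j → adj i j ≡ adj j i
    adj-sym i j = χ-cong (adj? G i j) (adj? G j i) (Graph.~-sym G) (Graph.~-sym G)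

    adj-irrefl : ∀ i → adj i i ≡ 0ℤ
    adj-irrefl i = χ-no (adj? G i i) (Graph.~-irrefl G refl)

    opaque
      degreeIn : Subset n → Fin n → ℤ
      degreeIn S v = ∑[ j < n ] (adj v j * ⟦ S ⟧ j)

      degreeIn≡∑ : ∀ S v → degreeIn S v ≡ ∑[ j < n ] (adj v j * ⟦ S ⟧ j)
      degreeIn≡∑ S v = refl

    private
      below : Fin n → Fin n → ℤ
      below i j = χ (i Fin.<? j)

      -- Two distinct vertices are ordered in exactly one way, and the diagonal contributes nothing
      -- by irreflexivity.
      below+above : ∀ i j → below i j * adj i j + below j i * adj i j ≡ adj i j
      below+above i j with Fin.<-cmp i j
      ... | tri< i<j _ j≮i = begin
        below i j * adj i j + below j i * adj i j
          ≡⟨ cong₂ (λ x y → x * adj i j + y * adj i j) (χ-yes (i Fin.<? j) i<j) (χ-no (j Fin.<? i) j≮i) ⟩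
        1ℤ * adj i j + 0ℤ * adj i j
          ≡⟨ keep (adj i j) ⟩
        adj i j ∎
        where
        keep : ∀ x → 1ℤ * x + 0ℤ * x ≡ x
        keep = solve-∀
      ... | tri≈ _ refl _ = begin
        below i i * adj i i + below i i * adj i i
          ≡⟨ cong (λ x → below i i * x + below i i * x) (adj-irrefl i) ⟩
        below i i * 0ℤ + below i i * 0ℤ
          ≡⟨ cong₂ _+_ (ℤ.*-zeroʳ (below i i)) (ℤ.*-zeroʳ (below i i)) ⟩
        0ℤ
          ≡⟨ adj-irrefl i ⟨
        adj i i ∎
      ... | tri> i≮j _ j<i = begin
        below i j * adj i j + below j i * adj i j
          ≡⟨ cong₂ (λ x y → x * adj i j + y * adj i j) (χ-no (i Fin.<? j) i≮j) (χ-yes (j Fin.<? i) j<i) ⟩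
        0ℤ * adj i j + 1ℤ * adj i j
          ≡⟨ keep (adj i j) ⟩
        adj i j ∎
        where
        keep : ∀ x → 0ℤ * x + 1ℤ * x ≡ x
        keep = solve-∀

    inducedSize≡∑ : ∀ S → + inducedSize G S ≡
      ∑[ i < n ] (∑[ j < n ] (χ (i Fin.<? j) * adj i j * (⟦ S ⟧ i * ⟦ S ⟧ j)))
    inducedSize≡∑ S = begin
      + inducedSize G S
        ≡⟨ length-filter≡∑ₗ inS? (edges G) ⟩
      ∑ₗ (λ e → χ (inS? e)) (edges G)
        ≡⟨ ∑ₗ-filter edge? (λ e → χ (inS? e)) (cartesianProduct (allFin n) (allFin n)) ⟩
      ∑ₗ (λ e → χ (edge? e) * χ (inS? e)) (cartesianProduct (allFin n) (allFin n))
        ≡⟨ ∑ₗ-cartesianProduct (λ e → χ (edge? e) * χ (inS? e)) (allFin n) (allFin n) ⟩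
      ∑ₗ (λ i → ∑ₗ (λ j → χ (edge? (i , j)) * χ (inS? (i , j))) (allFin n)) (allFin n)
        ≡⟨ ∑ₗ-tabulate (λ i → ∑ₗ (λ j → χ (edge? (i , j)) * χ (inS? (i , j))) (allFin n)) id ⟩
      ∑[ i < n ] ∑ₗ (λ j → χ (edge? (i , j)) * χ (inS? (i , j))) (allFin n)
        ≡⟨ sum-cong-≗ (λ i → trans (∑ₗ-tabulate (λ j → χ (edge? (i , j)) * χ (inS? (i , j))) id)
             (sum-cong-≗ λ j → cong₂ _*_ (χ-× (i Fin.<? j) (adj? G i j)) (χ-× (i ∈? S) (j ∈? S)))) ⟩
      ∑[ i < n ] (∑[ j < n ] (χ (i Fin.<? j) * adj i j * (⟦ S ⟧ i * ⟦ S ⟧ j)))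
        ∎
      where
      inS? : ∀ ((i , j) : Fin n × Fin n) → Dec (i ∈ S × j ∈ S)
      inS? (i , j) = (i ∈? S) ×-dec (j ∈? S)
      edge? : ∀ ((i , j) : Fin n × Fin n) → Dec (i Fin.< j × Adj G i j)
      edge? (i , j) = (i Fin.<? j) ×-dec adj? G i j

    -- Exchanging the summation variables turns the sum over pairs i < j into the one over j < i;
    -- the two copies together run over all ordered pairs.
    handshake : ∀ S → + 2 * + inducedSize G S ≡ ∑[ i < n ] (∑[ j < n ] (adj i j * (⟦ S ⟧ i * ⟦ S ⟧ j)))
    handshake S = begin
      + 2 * + inducedSize G S
        ≡⟨ double (+ inducedSize G S) ⟩
      + inducedSize G S + + inducedSize G S
        ≡⟨ cong₂ _+_ (inducedSize≡∑ S) (trans (inducedSize≡∑ S) (∑-comm (λ i j → term i j))) ⟩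
      ∑[ i < n ] (∑[ j < n ] term i j) + ∑[ i < n ] (∑[ j < n ] term j i)
        ≡⟨ ∑-distrib-+ (λ i → ∑[ j < n ] term i j) (λ i → ∑[ j < n ] term j i) ⟨
      ∑[ i < n ] (∑[ j < n ] term i j + ∑[ j < n ] term j i)
        ≡⟨ sum-cong-≗ (λ i → trans (sym (∑-distrib-+ (λ j → term i j) (λ j → term j i))) (sum-cong-≗ (combine i))) ⟩
      ∑[ i < n ] (∑[ j < n ] (adj i j * (⟦ S ⟧ i * ⟦ S ⟧ j)))
        ∎
      where
      term : Fin n → Fin n → ℤ
      term i j = below i j * adj i j * (⟦ S ⟧ i * ⟦ S ⟧ j)
      double : ∀ x → + 2 * x ≡ x + x
      double = solve-∀
      factor : ∀ b b′ a s t → b * a * (s * t) + b′ * a * (t * s) ≡ (b * a + b′ * a) * (s * t)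
      factor = solve-∀
      combine : ∀ i j → term i j + term j i ≡ adj i j * (⟦ S ⟧ i * ⟦ S ⟧ j)
      combine i j = begin
        term i j + term j i
          ≡⟨ cong (λ a → term i j + below j i * a * (⟦ S ⟧ j * ⟦ S ⟧ i)) (adj-sym j i) ⟩
        below i j * adj i j * (⟦ S ⟧ i * ⟦ S ⟧ j) + below j i * adj i j * (⟦ S ⟧ j * ⟦ S ⟧ i)
          ≡⟨ factor (below i j) (below j i) (adj i j) (⟦ S ⟧ i) (⟦ S ⟧ j) ⟩
        (below i j * adj i j + below j i * adj i j) * (⟦ S ⟧ i * ⟦ S ⟧ j)
          ≡⟨ cong (_* (⟦ S ⟧ i * ⟦ S ⟧ j)) (below+above i j) ⟩
        adj i j * (⟦ S ⟧ i * ⟦ S ⟧ j)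
          ∎

  insert : ∀ {n} → Fin n → Subset n → Subset n
  insert v S = S [ v ]≔ inside

  v∈insert : ∀ {n} (v : Fin n) S → v ∈ insert v S
  v∈insert zero    (_ ∷ S) = here
  v∈insert (suc v) (_ ∷ S) = there (v∈insert v S)

  ⊆insert : ∀ {n} {v i : Fin n} {S} → i ∈ S → i ∈ insert v S
  ⊆insert {v = zero}  here        = here
  ⊆insert {v = zero}  (there i∈S) = there i∈S
  ⊆insert {v = suc v} here        = here
  ⊆insert {v = suc v} (there i∈S) = there (⊆insert i∈S)

  ∈insert⁻ : ∀ {n} {v i : Fin n} {S} → i ∈ insert v S → i ≡ v ⊎ i ∈ S
  ∈insert⁻ {v = zero}  {zero}  {_ ∷ S} _           = inj₁ refl
  ∈insert⁻ {v = zero}  {suc i} {_ ∷ S} (there i∈S) = inj₂ (there i∈S)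
  ∈insert⁻ {v = suc v} {zero}  {_ ∷ S} here        = inj₂ here
  ∈insert⁻ {v = suc v} {suc i} {_ ∷ S} (there i∈) with ∈insert⁻ i∈
  ... | inj₁ refl = inj₁ refl
  ... | inj₂ i∈S  = inj₂ (there i∈S)

  ∉insert : ∀ {n} {v i : Fin n} {S} → i ≢ v → i ∉ S → i ∉ insert v S
  ∉insert i≢v i∉S i∈ with ∈insert⁻ i∈
  ... | inj₁ i≡v = i≢v i≡v
  ... | inj₂ i∈S = i∉S i∈S

  module _ {n} {v : Fin n} {S : Subset n} (v∉S : v ∉ S) where

    ⟦insert⟧ : ∀ i → ⟦ insert v S ⟧ i ≡ ⟦ S ⟧ i + χ (i Fin.≟ v)
    ⟦insert⟧ i with i Fin.≟ v
    ... | yes refl = trans (χ-yes (v ∈? insert v S) (v∈insert v S)) (cong (λ k → k + 1ℤ) (sym (χ-no (v ∈? S) v∉S)))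
    ... | no i≢v   = trans (χ-cong (i ∈? insert v S) (i ∈? S) shrink ⊆insert) (sym (ℤ.+-identityʳ _))
      where
      shrink : i ∈ insert v S → i ∈ S
      shrink i∈ with ∈insert⁻ i∈
      ... | inj₁ i≡v = contradiction i≡v i≢v
      ... | inj₂ i∈S = i∈S

    ∑-insert : ∀ (f : Fin n → ℤ) → ∑[ i < n ] (f i * ⟦ insert v S ⟧ i) ≡ ∑[ i < n ] (f i * ⟦ S ⟧ i) + f v
    ∑-insert f = begin
      ∑[ i < n ] (f i * ⟦ insert v S ⟧ i)
        ≡⟨ sum-cong-≗ (λ i → trans (cong (f i *_) (⟦insert⟧ i)) (expand (f i) (⟦ S ⟧ i) (χ (i Fin.≟ v)))) ⟩
      ∑[ i < n ] (f i * ⟦ S ⟧ i + χ (i Fin.≟ v) * f i)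
        ≡⟨ ∑-distrib-+ (λ i → f i * ⟦ S ⟧ i) (λ i → χ (i Fin.≟ v) * f i) ⟩
      ∑[ i < n ] (f i * ⟦ S ⟧ i) + ∑[ i < n ] (χ (i Fin.≟ v) * f i)
        ≡⟨ cong (λ k → ∑[ i < n ] (f i * ⟦ S ⟧ i) + k) (∑-χ≟ f v) ⟩
      ∑[ i < n ] (f i * ⟦ S ⟧ i) + f v
        ∎
      where
      expand : ∀ x s t → x * (s + t) ≡ x * s + t * x
      expand = solve-∀

    ∣insert∣ : ∣ insert v S ∣ ≡ ℕ.suc ∣ S ∣
    ∣insert∣ = ℤ.+-injective (begin
      + ∣ insert v S ∣                  ≡⟨ ∣S∣≡∑ (insert v S) ⟩
      ∑[ i < n ] ⟦ insert v S ⟧ i       ≡⟨ sum-cong-≗ (λ i → ℤ.*-identityˡ (⟦ insert v S ⟧ i)) ⟨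
      ∑[ i < n ] (1ℤ * ⟦ insert v S ⟧ i) ≡⟨ ∑-insert (λ _ → 1ℤ) ⟩
      ∑[ i < n ] (1ℤ * ⟦ S ⟧ i) + 1ℤ    ≡⟨ cong (λ k → k + 1ℤ) (sum-cong-≗ (λ i → ℤ.*-identityˡ (⟦ S ⟧ i))) ⟩
      ∑[ i < n ] ⟦ S ⟧ i + 1ℤ           ≡⟨ cong (λ k → k + 1ℤ) (∣S∣≡∑ S) ⟨
      (+ ∣ S ∣) + 1ℤ                    ≡⟨ ℤ.+-comm (+ ∣ S ∣) 1ℤ ⟩
      + ℕ.suc (∣ S ∣)                   ∎)

    degreeIn-insert : ∀ (G : Graph n) w → degreeIn G (insert v S) w ≡ degreeIn G S w + adj G w v
    degreeIn-insert G w = begin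
      degreeIn G (insert v S) w                    ≡⟨ degreeIn≡∑ G (insert v S) w ⟩
      ∑[ j < n ] (adj G w j * ⟦ insert v S ⟧ j)    ≡⟨ ∑-insert (adj G w) ⟩
      ∑[ j < n ] (adj G w j * ⟦ S ⟧ j) + adj G w v ≡⟨ cong (λ d → d + adj G w v) (degreeIn≡∑ G S w) ⟨
      degreeIn G S w + adj G w v                   ∎

  private
    ∑∑≡∑degree : ∀ {n} (G : Graph n) S → ∑[ i < n ] (∑[ j < n ] (adj G i j * (⟦ S ⟧ i * ⟦ S ⟧ j))) ≡
      ∑[ i < n ] (degreeIn G S i * ⟦ S ⟧ i)
    ∑∑≡∑degree {n} G S = sum-cong-≗ λ i → trans (sum-cong-≗ λ j → assoc (adj G i j) (⟦ S ⟧ i) (⟦ S ⟧ j))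
      (trans (sym (*-distribʳ-sum (⟦ S ⟧ i) (λ j → adj G i j * ⟦ S ⟧ j))) (cong (_* ⟦ S ⟧ i) (sym (degreeIn≡∑ G S i))))
      where
      assoc : ∀ a s t → a * (s * t) ≡ a * t * s
      assoc = solve-∀

  ∑degree : ∀ {n} (G : Graph n) S → ∑[ i < n ] (degreeIn G S i * ⟦ S ⟧ i) ≡ + 2 * + inducedSize G S
  ∑degree G S = sym (trans (handshake G S) (∑∑≡∑degree G S))

  -- In the doubled count the new vertex contributes its degree twice: once as its own degree, once
  -- spread over the degrees of its neighbours.
  inducedSize-insert : ∀ {n} (G : Graph n) {v S} → v ∉ S →
    + inducedSize G (insert v S) ≡ + inducedSize G S + degreeIn G S v
  inducedSize-insert {n} G {v} {S} v∉S = ℤ.*-cancelˡ-≡ (+ 2) _ _ (begin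
    + 2 * + inducedSize G (insert v S)
      ≡⟨ ∑degree G (insert v S) ⟨
    ∑[ i < n ] (degreeIn G (insert v S) i * ⟦ insert v S ⟧ i)
      ≡⟨ ∑-insert v∉S (degreeIn G (insert v S)) ⟩
    ∑[ i < n ] (degreeIn G (insert v S) i * ⟦ S ⟧ i) + degreeIn G (insert v S) v
      ≡⟨ cong₂ _+_ inner outer ⟩
    + 2 * + inducedSize G S + degreeIn G S v + degreeIn G S v
      ≡⟨ regroup (+ inducedSize G S) (degreeIn G S v) ⟩
    + 2 * (+ inducedSize G S + degreeIn G S v)
      ∎)
    where
    regroup : ∀ x d → + 2 * x + d + d ≡ + 2 * (x + d)
    regroup = solve-∀
    expand : ∀ d a s → (d + a) * s ≡ d * s + a * s
    expand = solve-∀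
    outer : degreeIn G (insert v S) v ≡ degreeIn G S v
    outer = trans (degreeIn-insert v∉S G v) (trans (cong (λ k → degreeIn G S v + k) (adj-irrefl G v)) (ℤ.+-identityʳ _))
    inner : ∑[ i < n ] (degreeIn G (insert v S) i * ⟦ S ⟧ i) ≡ + 2 * + inducedSize G S + degreeIn G S v
    inner = begin
      ∑[ i < n ] (degreeIn G (insert v S) i * ⟦ S ⟧ i)
        ≡⟨ sum-cong-≗ (λ i → trans (cong (_* ⟦ S ⟧ i) (degreeIn-insert v∉S G i)) (expand (degreeIn G S i) (adj G i v) (⟦ S ⟧ i))) ⟩
      ∑[ i < n ] (degreeIn G S i * ⟦ S ⟧ i + adj G i v * ⟦ S ⟧ i)
        ≡⟨ ∑-distrib-+ (λ i → degreeIn G S i * ⟦ S ⟧ i) (λ i → adj G i v * ⟦ S ⟧ i) ⟩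
      ∑[ i < n ] (degreeIn G S i * ⟦ S ⟧ i) + ∑[ i < n ] (adj G i v * ⟦ S ⟧ i)
        ≡⟨ cong₂ _+_ (∑degree G S) (trans (sum-cong-≗ λ i → cong (_* ⟦ S ⟧ i) (adj-sym G i v)) (sym (degreeIn≡∑ G S v))) ⟩
      + 2 * + inducedSize G S + degreeIn G S v
        ∎

  adj-complement : ∀ {n} (G : Graph n) i j → adj (complement G) i j ≡ 1ℤ - χ (i Fin.≟ j) - adj G i j
  adj-complement G i j with i Fin.≟ j | adj? G i j
  ... | yes refl | yes i~i = contradiction i~i (Graph.~-irrefl G refl)
  ... | yes refl | no _    = refl
  ... | no _     | yes _   = refl
  ... | no _     | no _    = refl

  -- Within `S`, every vertex of `S` is a neighbour or a non-neighbour of each of the other ∣S∣ - 1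
  -- vertices, so its degrees in `G` and in the complement add up to a constant.
  inducedSize+complement : ∀ {n} (G : Graph n) S →
    + 2 * (+ inducedSize G S + + inducedSize (complement G) S) ≡ + ∣ S ∣ * (+ ∣ S ∣ - 1ℤ)
  inducedSize+complement {n} G S = begin
    + 2 * (+ inducedSize G S + + inducedSize (complement G) S)
      ≡⟨ ℤ.*-distribˡ-+ (+ 2) (+ inducedSize G S) (+ inducedSize (complement G) S) ⟩
    + 2 * + inducedSize G S + + 2 * + inducedSize (complement G) S
      ≡⟨ cong₂ _+_ (∑degree G S) (∑degree (complement G) S) ⟨
    ∑[ i < n ] (degreeIn G S i * ⟦ S ⟧ i) + ∑[ i < n ] (degreeIn (complement G) S i * ⟦ S ⟧ i)
      ≡⟨ ∑-distrib-+ (λ i → degreeIn G S i * ⟦ S ⟧ i) (λ i → degreeIn (complement G) S i * ⟦ S ⟧ i) ⟨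
    ∑[ i < n ] (degreeIn G S i * ⟦ S ⟧ i + degreeIn (complement G) S i * ⟦ S ⟧ i)
      ≡⟨ sum-cong-≗ (λ i → trans (sym (ℤ.*-distribʳ-+ (⟦ S ⟧ i) (degreeIn G S i) (degreeIn (complement G) S i))) (degrees i)) ⟩
    ∑[ i < n ] ((+ ∣ S ∣ - 1ℤ) * ⟦ S ⟧ i)
      ≡⟨ *-distribˡ-sum (+ ∣ S ∣ - 1ℤ) ⟦ S ⟧ ⟨
    (+ ∣ S ∣ - 1ℤ) * ∑[ i < n ] ⟦ S ⟧ i
      ≡⟨ cong ((+ ∣ S ∣ - 1ℤ) *_) (∣S∣≡∑ S) ⟨
    (+ ∣ S ∣ - 1ℤ) * + ∣ S ∣
      ≡⟨ ℤ.*-comm (+ ∣ S ∣ - 1ℤ) (+ ∣ S ∣) ⟩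
    + ∣ S ∣ * (+ ∣ S ∣ - 1ℤ)
      ∎
    where
    pointwise : ∀ a x s → a * s + (1ℤ - x - a) * s + x * s ≡ s
    pointwise = solve-∀
    total : ∀ i → degreeIn G S i + degreeIn (complement G) S i + ⟦ S ⟧ i ≡ + ∣ S ∣
    total i = begin
      degreeIn G S i + degreeIn (complement G) S i + ⟦ S ⟧ i
        ≡⟨ cong (λ d → d + ⟦ S ⟧ i) (cong₂ _+_ (degreeIn≡∑ G S i) (degreeIn≡∑ (complement G) S i)) ⟩
      ∑[ j < n ] (adj G i j * ⟦ S ⟧ j) + ∑[ j < n ] (adj (complement G) i j * ⟦ S ⟧ j) + ⟦ S ⟧ i
        ≡⟨ cong₂ _+_ (∑-distrib-+ (λ j → adj G i j * ⟦ S ⟧ j) (λ j → adj (complement G) i j * ⟦ S ⟧ j)) (∑-χ≟ ⟦ S ⟧ i) ⟨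
      ∑[ j < n ] (adj G i j * ⟦ S ⟧ j + adj (complement G) i j * ⟦ S ⟧ j) + ∑[ j < n ] (χ (j Fin.≟ i) * ⟦ S ⟧ j)
        ≡⟨ ∑-distrib-+ (λ j → adj G i j * ⟦ S ⟧ j + adj (complement G) i j * ⟦ S ⟧ j) (λ j → χ (j Fin.≟ i) * ⟦ S ⟧ j) ⟨
      ∑[ j < n ] (adj G i j * ⟦ S ⟧ j + adj (complement G) i j * ⟦ S ⟧ j + χ (j Fin.≟ i) * ⟦ S ⟧ j)
        ≡⟨ sum-cong-≗ (λ j → trans (cong₂ (λ a x → adj G i j * ⟦ S ⟧ j + a * ⟦ S ⟧ j + x * ⟦ S ⟧ j)
             (adj-complement G i j) (χ-cong (j Fin.≟ i) (i Fin.≟ j) sym sym))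
             (pointwise (adj G i j) (χ (i Fin.≟ j)) (⟦ S ⟧ j))) ⟩
      ∑[ j < n ] ⟦ S ⟧ j
        ≡⟨ ∣S∣≡∑ S ⟨
      + ∣ S ∣
        ∎
    isolate : ∀ d s → d * s ≡ (d + s) * s - s * s
    isolate = solve-∀
    merge : ∀ k s → k * s - s ≡ (k - 1ℤ) * s
    merge = solve-∀
    degrees : ∀ i → (degreeIn G S i + degreeIn (complement G) S i) * ⟦ S ⟧ i ≡ (+ ∣ S ∣ - 1ℤ) * ⟦ S ⟧ i
    degrees i = begin
      (degreeIn G S i + degreeIn (complement G) S i) * ⟦ S ⟧ i
        ≡⟨ isolate (degreeIn G S i + degreeIn (complement G) S i) (⟦ S ⟧ i) ⟩
      (degreeIn G S i + degreeIn (complement G) S i + ⟦ S ⟧ i) * ⟦ S ⟧ i - ⟦ S ⟧ i * ⟦ S ⟧ i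
        ≡⟨ cong₂ (λ k s → k * ⟦ S ⟧ i - s) (total i) (χ-idem (i ∈? S)) ⟩
      + ∣ S ∣ * ⟦ S ⟧ i - ⟦ S ⟧ i
        ≡⟨ merge (+ ∣ S ∣) (⟦ S ⟧ i) ⟩
      (+ ∣ S ∣ - 1ℤ) * ⟦ S ⟧ i
        ∎

-- Choosing vertex sets of prescribed size.

module Selections where
  open Indicators
  open InducedSizes
  open import Data.Fin using (zero; suc)
  open import Data.Fin.Subset using (∣_∣; ⊥)
  open import Data.List using ([]; _∷_)
  open import Data.List.Relation.Unary.All using ([]; _∷_)
  open import Data.List.Relation.Unary.Any using (here; there)
  open import Data.Nat using (zero; suc; _+_; _≤_; _<_)
  open import Data.Nat.Properties
  open import Data.Vec using ([]; _∷_)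

  interpolate : ∀ {n} (A B : Subset n) k → A ⊆ B → ∣ A ∣ ≤ k → k ≤ ∣ B ∣ →
    ∃ λ R → ∣ R ∣ ≡ k × A ⊆ R × R ⊆ B
  interpolate [] [] k A⊆B _ k≤0 = [] , sym (n≤0⇒n≡0 k≤0) , (λ ()) , (λ ())
  interpolate (inside ∷ A) (outside ∷ B) k A⊆B _ _ with () ← A⊆B Vec.here
  interpolate (inside ∷ A) (inside ∷ B) (suc k) A⊆B (s≤s A≤k) (s≤s k≤B)
    with R , R≡k , A⊆R , R⊆B ← interpolate A B k (drop-∷-⊆ A⊆B) A≤k k≤B
    = inside ∷ R , cong suc R≡k , s⊆s A⊆R , s⊆s R⊆B
  interpolate (outside ∷ A) (outside ∷ B) k A⊆B A≤k k≤B
    with R , R≡k , A⊆R , R⊆B ← interpolate A B k (drop-∷-⊆ A⊆B) A≤k k≤B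
    = outside ∷ R , R≡k , s⊆s A⊆R , s⊆s R⊆B
  interpolate (outside ∷ A) (inside ∷ B) k A⊆B A≤k k≤1+B with k ≤? ∣ B ∣
  ... | yes k≤B
    with R , R≡k , A⊆R , R⊆B ← interpolate A B k (drop-∷-⊆ A⊆B) A≤k k≤B
    = outside ∷ R , R≡k , s⊆s A⊆R , out⊆ R⊆B
  -- An optional vertex is skipped as long as the rest of `B` suffices. Here `k` is exactly one more
  -- than that rest, so the vertex and all of the rest have to be taken.
  ... | no k≰B with refl ← ≤-antisym k≤1+B (≰⇒> k≰B)
    with R , R≡k , A⊆R , R⊆B ← interpolate A B (∣ B ∣) (drop-∷-⊆ A⊆B) (p⊆q⇒∣p∣≤∣q∣ (drop-∷-⊆ A⊆B)) ≤-refl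
    = inside ∷ R , cong suc R≡k , out⊆ A⊆R , s⊆s R⊆B

  insertAll : ∀ {n} → List (Fin n) → Subset n → Subset n
  insertAll xs S = foldr insert S xs

  ∣insert∣≤ : ∀ {n} (v : Fin n) S → ∣ insert v S ∣ ≤ suc (∣ S ∣)
  ∣insert∣≤ zero    (inside ∷ S)  = n≤1+n _
  ∣insert∣≤ zero    (outside ∷ S) = ≤-refl
  ∣insert∣≤ (suc v) (inside ∷ S)  = s≤s (∣insert∣≤ v S)
  ∣insert∣≤ (suc v) (outside ∷ S) = ∣insert∣≤ v S

  private
    fromList : ∀ {n} → List (Fin n) → Subset n
    fromList xs = insertAll xs ⊥

    ∣fromList∣≤ : ∀ {n} (xs : List (Fin n)) → ∣ fromList xs ∣ ≤ length xs
    ∣fromList∣≤ {n} []   = ≤-reflexive (∣⊥∣≡0 n)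
    ∣fromList∣≤ (x ∷ xs) = ≤-trans (∣insert∣≤ x (fromList xs)) (s≤s (∣fromList∣≤ xs))

    ∈fromList⁺ : ∀ {n} {x : Fin n} {xs} → x ∈ₗ xs → x ∈ fromList xs
    ∈fromList⁺ {xs = x ∷ xs} (here refl) = v∈insert x (fromList xs)
    ∈fromList⁺ {xs = x ∷ xs} (there x∈)  = ⊆insert (∈fromList⁺ x∈)

    ∈fromList⁻ : ∀ {n} {x : Fin n} xs → x ∈ fromList xs → x ∈ₗ xs
    ∈fromList⁻ []       x∈ = contradiction x∈ ∉⊥
    ∈fromList⁻ (y ∷ xs) x∈ with ∈insert⁻ {v = y} x∈
    ... | inj₁ refl = here refl
    ... | inj₂ x∈′  = there (∈fromList⁻ xs x∈′)

  -- Interpolates between the set of `xs` and the complement of the set of `ys`. The lengths enter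
  -- only as upper bounds for sizes, so both lists may contain repetitions.
  select : ∀ {n} k (xs ys : List (Fin n)) → All (λ x → All (x ≢_) ys) xs →
    length xs ≤ k → k + length ys ≤ n →
    ∃ λ R → ∣ R ∣ ≡ k × All (_∈ R) xs × All (_∉ R) ys
  select {n} k xs ys disjoint xs≤k k+ys≤n
    with R , R≡k , xs⊆R , R⊆∁ys ← interpolate (fromList xs) (∁ (fromList ys)) k
           (λ x∈xs → x∉p⇒x∈∁p (λ x∈ys → All.lookup (All.lookup disjoint (∈fromList⁻ xs x∈xs)) (∈fromList⁻ ys x∈ys) refl))
           (≤-trans (∣fromList∣≤ xs) xs≤k)
           (subst (k ≤_) (sym (∣∁p∣≡n∸∣p∣ (fromList ys)))
             (≤-trans (m+n≤o⇒m≤o∸n k k+ys≤n) (∸-monoʳ-≤ n (∣fromList∣≤ ys))))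
    = R , R≡k
    , All.tabulate (λ x∈ → xs⊆R (∈fromList⁺ x∈))
    , All.tabulate (λ y∈ y∈R → x∈∁p⇒x∉p (R⊆∁ys y∈R) (∈fromList⁺ y∈))

  -- Pigeonhole: otherwise the full vertex set would lie in the set of `ys`.
  fresh : ∀ {n} (ys : List (Fin n)) → length ys < n → ∃ λ z → All (z ≢_) ys
  fresh {n} ys ys<n with Fin.any? (λ z → All.all? (λ y → ¬? (z Fin.≟ y)) ys)
  ... | yes z  = z
  ... | no ∄z  = contradiction ys<n (≤⇒≯ n≤ys)
    where
    open import Data.List.Membership.DecPropositional (Fin._≟_ {n}) using () renaming (_∈?_ to _∈ₗ?_)
    all∈ : ∀ z → z ∈ₗ ys
    all∈ z with z ∈ₗ? ys
    ... | yes z∈ = z∈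
    ... | no z∉  = contradiction (z , All.tabulate (λ { y∈ refl → z∉ y∈ })) ∄z
    n≤ys : n ≤ length ys
    n≤ys = subst (_≤ length ys) (∣⊤∣≡n n)
      (≤-trans (p⊆q⇒∣p∣≤∣q∣ {p = ⊤} (λ {z} _ → ∈fromList⁺ (all∈ z))) (∣fromList∣≤ ys))

-- Balances of two vertices when only two sizes occur.

module Balances where
  open Indicators
  open InducedSizes
  open Selections
  open import Data.Empty using (⊥)
  open import Data.Fin using (suc)
  open import Data.Fin.Subset using (∣_∣)
  open import Data.Integer using (_+_; _*_; _-_; -_; _≤_)
  open import Data.Integer.Tactic.RingSolver using (solve-∀)
  open import Data.List using ([]; _∷_; _++_)
  open import Data.List.Relation.Unary.All using ([]; _∷_)
  open import Data.List.Relation.Unary.Any using (here; there)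
  open import Data.List.Relation.Unary.AllPairs using ([]; _∷_)
  open import Data.Nat using (suc)

  -- The case D = 0, a constant size, is included so that it can be refuted together with the
  -- others. The value `p` is an integer because passing to the complement replaces it by a
  -- difference.
  record TwoValued {n} (G : Graph n) (c : ℕ) (p : ℤ) (D : ℕ) : Set where
    constructor twoValued
    field
      size-values : ∀ S → ∣ S ∣ ≡ c → + inducedSize G S ≡ p ⊎ + inducedSize G S ≡ p + + D

  open TwoValued public using (size-values)

  balance : ∀ {n} → Graph n → Fin n → Fin n → Subset n → ℤ
  balance G u v S = degreeIn G S u - degreeIn G S v

  balance-insert : ∀ {n} (G : Graph n) u v {w S} → w ∉ S →
    balance G u v (insert w S) ≡ balance G u v S + (adj G u w - adj G v w)
  balance-insert G u v {w} {S} w∉S =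
    trans (cong₂ _-_ (degreeIn-insert w∉S G u) (degreeIn-insert w∉S G v))
          (regroup (degreeIn G S u) (degreeIn G S v) (adj G u w) (adj G v w))
    where
    regroup : ∀ d e a b → (d + a) - (e + b) ≡ (d - e) + (a - b)
    regroup = solve-∀

  insertAll-∉ : ∀ {n} {v : Fin n} {xs S} → All (v ≢_) xs → v ∉ S → v ∉ insertAll xs S
  insertAll-∉ []           v∉S = v∉S
  insertAll-∉ (v≢x ∷ v≢xs) v∉S = ∉insert v≢x (insertAll-∉ v≢xs v∉S)

  ∣insertAll∣ : ∀ {n} {xs : List (Fin n)} {S} → Unique xs → All (_∉ S) xs →
    ∣ insertAll xs S ∣ ≡ length xs ℕ.+ ∣ S ∣
  ∣insertAll∣ []             []           = refl
  ∣insertAll∣ (x≢xs ∷ unique) (x∉S ∷ xs∉S) =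
    trans (∣insert∣ (insertAll-∉ x≢xs x∉S)) (cong suc (∣insertAll∣ unique xs∉S))

  balance-insertAll : ∀ {n} (G : Graph n) u v t {xs S} → All (λ x → adj G u x - adj G v x ≡ t) xs →
    Unique xs → All (_∉ S) xs → balance G u v (insertAll xs S) ≡ balance G u v S + + length xs * t
  balance-insertAll G u v t [] [] [] = sym (ℤ.+-identityʳ _)
  balance-insertAll G u v t {x ∷ xs} {S} (tx ∷ txs) (x≢xs ∷ unique) (x∉S ∷ xs∉S) = begin
    balance G u v (insert x (insertAll xs S))
      ≡⟨ balance-insert G u v (insertAll-∉ x≢xs x∉S) ⟩
    balance G u v (insertAll xs S) + (adj G u x - adj G v x)
      ≡⟨ cong₂ _+_ (balance-insertAll G u v t txs unique xs∉S) tx ⟩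
    balance G u v S + + length xs * t + t
      ≡⟨ step (balance G u v S) (+ length xs) t ⟩
    balance G u v S + (1ℤ + + length xs) * t
      ∎
    where
    open ≡-Reasoning
    step : ∀ b l t → b + l * t + t ≡ b + (1ℤ + l) * t
    step = solve-∀

  -- These are the vertices other than `v` that contribute 1 to the balance of `u` against `v`; that
  -- `x` differs from `u` follows from irreflexivity.
  IsPrivate : ∀ {n} → Graph n → Fin n → Fin n → Fin n → Set
  IsPrivate G u v x = x ≢ v × Adj G u x × ¬ Adj G v x

  isPrivate? : ∀ {n} (G : Graph n) u v x → Dec (IsPrivate G u v x)
  isPrivate? G u v x = ¬? (x Fin.≟ v) ×-dec adj? G u x ×-dec ¬? (adj? G v x)

  privates : ∀ {n} → Graph n → Fin n → Fin n → List (Fin n)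
  privates G u v = filter (isPrivate? G u v) (allFin _)

  ∈privates : ∀ {n} (G : Graph n) {u v x} → IsPrivate G u v x → x ∈ₗ privates G u v
  ∈privates G {u} {v} {x} Px = ∈ₗ.∈-filter⁺ (isPrivate? G u v) (∈ₗ.∈-allFin x) Px

  adj-private : ∀ {n} (G : Graph n) {u v x} → IsPrivate G u v x → adj G u x - adj G v x ≡ 1ℤ
  adj-private G {u} {v} {x} (_ , u~x , v≁x) = cong₂ _-_ (χ-yes (adj? G u x) u~x) (χ-no (adj? G v x) v≁x)

  adj-private′ : ∀ {n} (G : Graph n) {u v x} → IsPrivate G v u x → adj G u x - adj G v x ≡ -1ℤ
  adj-private′ G {u} {v} {x} (_ , v~x , u≁x) = cong₂ _-_ (χ-no (adj? G u x) u≁x) (χ-yes (adj? G v x) v~x)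

  module _ {n} (G : Graph n) where

    private-≢ : ∀ {u v x} → IsPrivate G u v x → x ≢ u × x ≢ v
    private-≢ (x≢v , u~x , _) = (λ { refl → Graph.~-irrefl G refl u~x }) , x≢v

    -- A neighbour of `v` in `S` that is not a neighbour of `u` would be private to `v` or equal to
    -- `u`, and `S` contains neither kind.
    balance-nonneg : ∀ u v {S} → u ∉ S → All (_∉ S) (privates G v u) → 0ℤ ≤ balance G u v S
    balance-nonneg u v {S} u∉S privates∉S = ℤ.i≤j⇒0≤j-i
      (subst₂ _≤_ (sym (degreeIn≡∑ G S v)) (sym (degreeIn≡∑ G S u)) (∑-mono pointwise))
      where
      pointwise : ∀ i → adj G v i * ⟦ S ⟧ i ≤ adj G u i * ⟦ S ⟧ i
      pointwise i with i ∈? S | adj? G v i | adj? G u i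
      ... | no _    | v~i | u~i = ℤ.≤-reflexive (trans (ℤ.*-zeroʳ (χ v~i)) (sym (ℤ.*-zeroʳ (χ u~i))))
      ... | yes _   | no _    | no _    = +≤+ z≤n
      ... | yes _   | no _    | yes _   = +≤+ z≤n
      ... | yes _   | yes _   | yes _   = ℤ.≤-refl
      ... | yes i∈S | yes v~i | no u≁i  =
        contradiction i∈S (All.lookup privates∉S (∈privates G ((λ { refl → u∉S i∈S }) , v~i , u≁i)))

    -- The edges inside `S` cancel, so the balance measures the effect of exchanging `v` for `u`;
    -- this transfers the restriction on sizes to balances.
    balance≡difference : ∀ {u v S} → u ∉ S → v ∉ S →
      balance G u v S ≡ + inducedSize G (insert u S) - + inducedSize G (insert v S)
    balance≡difference {u} {v} {S} u∉S v∉S =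
      trans (shift (+ inducedSize G S) (degreeIn G S u) (degreeIn G S v))
            (sym (cong₂ _-_ (inducedSize-insert G u∉S) (inducedSize-insert G v∉S)))
      where
      shift : ∀ x d e → d - e ≡ (x + d) - (x + e)
      shift = solve-∀

  private
    +-cancelʳ-≤ : ∀ k {i j} → i + k ≤ j + k → i ≤ j
    +-cancelʳ-≤ k i+k≤j+k = subst₂ _≤_ (simplify _ k) (simplify _ k) (ℤ.+-monoˡ-≤ (- k) i+k≤j+k)
      where
      simplify : ∀ i k → i + k - k ≡ i
      simplify = solve-∀

  difference-values : ∀ {x y p} d → x ≡ p ⊎ x ≡ p + d → y ≡ p ⊎ y ≡ p + d →
    x - y ≡ 0ℤ ⊎ x - y ≡ d ⊎ x - y ≡ - d
  difference-values {p = p} d (inj₁ refl) (inj₁ refl) = inj₁ (ℤ.+-inverseʳ p)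
  difference-values {p = p} d (inj₁ refl) (inj₂ refl) = inj₂ (inj₂ (simplify p d))
    where
    simplify : ∀ p d → p - (p + d) ≡ - d
    simplify = solve-∀
  difference-values {p = p} d (inj₂ refl) (inj₁ refl) = inj₂ (inj₁ (simplify p d))
    where
    simplify : ∀ p d → (p + d) - p ≡ d
    simplify = solve-∀
  difference-values {p = p} d (inj₂ refl) (inj₂ refl) = inj₁ (ℤ.+-inverseʳ (p + d))

  values-multiple : ∀ {x D} → x ≡ 0ℤ ⊎ x ≡ + D ⊎ x ≡ - + D → ∃ λ j → x ≡ + D * j
  values-multiple {D = D} (inj₁ eq)        = 0ℤ , trans eq (sym (ℤ.*-zeroʳ (+ D)))
  values-multiple {D = D} (inj₂ (inj₁ eq)) = 1ℤ , trans eq (sym (ℤ.*-identityʳ (+ D)))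
  values-multiple {D = D} (inj₂ (inj₂ eq)) = -1ℤ , trans eq (trans (sym (ℤ.-1*i≡-i (+ D))) (ℤ.*-comm -1ℤ (+ D)))

  values-≤ : ∀ {x D} → x ≡ 0ℤ ⊎ x ≡ + D ⊎ x ≡ - + D → x ≤ + D
  values-≤     (inj₁ refl)        = +≤+ z≤n
  values-≤     (inj₂ (inj₁ refl)) = ℤ.≤-refl
  values-≤ {D = D} (inj₂ (inj₂ refl)) = ℤ.neg-≤-pos {D}

  values-≥ : ∀ {x D} → x ≡ 0ℤ ⊎ x ≡ + D ⊎ x ≡ - + D → - + D ≤ x
  values-≥ {D = D} (inj₁ refl)        = ℤ.neg-≤-pos {D} {0}
  values-≥ {D = D} (inj₂ (inj₁ refl)) = ℤ.neg-≤-pos {D}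
  values-≥     (inj₂ (inj₂ refl)) = ℤ.≤-refl

  module _ {n} {G : Graph n} {k p D} (two : TwoValued G (suc k) p D) where

    balance-values : ∀ {u v S} → ∣ S ∣ ≡ k → u ∉ S → v ∉ S →
      balance G u v S ≡ 0ℤ ⊎ balance G u v S ≡ + D ⊎ balance G u v S ≡ - + D
    balance-values {u} {v} {S} S≡k u∉S v∉S =
      subst (λ b → b ≡ 0ℤ ⊎ b ≡ + D ⊎ b ≡ - + D) (sym (balance≡difference G u∉S v∉S))
        (difference-values (+ D)
          (size-values two (insert u S) (trans (∣insert∣ u∉S) (cong suc S≡k)))
          (size-values two (insert v S) (trans (∣insert∣ v∉S) (cong suc S≡k))))

    balance-multiple : ∀ {u v S} → ∣ S ∣ ≡ k → u ∉ S → v ∉ S → ∃ λ j → balance G u v S ≡ + D * j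
    balance-multiple S≡k u∉S v∉S = values-multiple (balance-values S≡k u∉S v∉S)

    balance-≤ : ∀ {u v S} → ∣ S ∣ ≡ k → u ∉ S → v ∉ S → balance G u v S ≤ + D
    balance-≤ S≡k u∉S v∉S = values-≤ (balance-values S≡k u∉S v∉S)

    balance-≥ : ∀ {u v S} → ∣ S ∣ ≡ k → u ∉ S → v ∉ S → - + D ≤ balance G u v S
    balance-≥ S≡k u∉S v∉S = values-≥ (balance-values S≡k u∉S v∉S)

    -- Both `S` with `x` and `S` with `y` have balances divisible by `D`; subtracting them cancels
    -- the unknown balance at `S`.
    exchange-multiple : ∀ {u v x y S} → suc (∣ S ∣) ≡ k → u ∉ S → v ∉ S → x ∉ S → y ∉ S →
      x ≢ u → x ≢ v → y ≢ u → y ≢ v →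
      ∃ λ j → (adj G u x - adj G v x) - (adj G u y - adj G v y) ≡ + D * j
    exchange-multiple {u} {v} {x} {y} {S} 1+S≡k u∉S v∉S x∉S y∉S x≢u x≢v y≢u y≢v =
      let i , eqᵢ = balance-multiple (trans (∣insert∣ x∉S) 1+S≡k) (∉insert (≢-sym x≢u) u∉S) (∉insert (≢-sym x≢v) v∉S)
          j , eqⱼ = balance-multiple (trans (∣insert∣ y∉S) 1+S≡k) (∉insert (≢-sym y≢u) u∉S) (∉insert (≢-sym y≢v) v∉S)
      in i - j , (begin
        t x - t y
          ≡⟨ shift (balance G u v S) (t x) (t y) ⟩
        (balance G u v S + t x) - (balance G u v S + t y)
          ≡⟨ cong₂ _-_ (trans (sym (balance-insert G u v x∉S)) eqᵢ) (trans (sym (balance-insert G u v y∉S)) eqⱼ) ⟩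
        + D * i - + D * j
          ≡⟨ factor (+ D) i j ⟩
        + D * (i - j)
          ∎)
      where
      open ≡-Reasoning
      t : Fin n → ℤ
      t z = adj G u z - adj G v z
      shift : ∀ b s t → s - t ≡ (b + s) - (b + t)
      shift = solve-∀
      factor : ∀ d i j → d * i - d * j ≡ d * (i - j)
      factor = solve-∀

    -- The 1 is the contribution of the private vertex `x`. The left side can only be 0, 1 or 2, so
    -- it bounds `D` unless `y` is private to `u` as well.
    private-dichotomy : ∀ {u v x y} → 1 ℕ.≤ k → k ℕ.+ 3 ℕ.≤ n → IsPrivate G u v x → y ≢ u → y ≢ v → x ≢ y →
      ∃ λ j → 1ℤ - (adj G u y - adj G v y) ≡ + D * j
    private-dichotomy {u} {v} {x} {y} 1≤k k+3≤n Px y≢u y≢v x≢y =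
      let x≢u , x≢v = private-≢ G Px
          k′ = ℕ.pred k
          1+k′≡k = ℕ.suc-pred k {{ℕ.>-nonZero 1≤k}}
          R , R≡ , _ , ∉R = select k′ [] (u ∷ v ∷ x ∷ y ∷ []) [] z≤n
            (ℕ.≤-trans (ℕ.≤-reflexive (trans (ℕ.+-suc k′ 3) (cong (ℕ._+ 3) 1+k′≡k))) k+3≤n)
          j , eq = exchange-multiple (trans (cong suc R≡) 1+k′≡k)
            (All.lookup ∉R (here refl)) (All.lookup ∉R (there (here refl)))
            (All.lookup ∉R (there (there (here refl)))) (All.lookup ∉R (there (there (there (here refl)))))
            x≢u x≢v y≢u y≢v
      in j , trans (cong (λ t → t - (adj G u y - adj G v y)) (sym (adj-private G Px))) eq

    -- Otherwise insert D + 1 vertices of one side or the other into a set that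
    -- avoids both sides as far as possible: the balance changes by more than it may.
    few-privates : ∀ {u v} → D ℕ.< k → k ℕ.+ 3 ℕ.+ D ℕ.≤ n → u ≢ v → length (privates G u v) ℕ.≤ D
    few-privates {u} {v} D<k bound u≢v = ℕ.≮⇒≥ impossible
      where
      xs ys : List (Fin n)
      xs = take (suc D) (privates G u v)
      ys = take (suc D) (privates G v u)

      -- Chosen so that `R` together with D + 1 private vertices has exactly k elements, the size at
      -- which balances are restricted.
      r : ℕ
      r = k ℕ.∸ suc D

      all-private : ∀ u v → All (IsPrivate G u v) (take (suc D) (privates G u v))
      all-private u v = All.take⁺ (suc D) (All.all-filter (isPrivate? G u v) (allFin n))

      unique : ∀ u v → Unique (take (suc D) (privates G u v))
      unique u v = Unique.take⁺ (suc D) (Unique.filter⁺ (isPrivate? G u v) (Unique.allFin⁺ n))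

      length-take : ∀ u v → length (take (suc D) (privates G u v)) ℕ.≤ suc D
      length-take u v = ℕ.≤-trans (ℕ.≤-reflexive (List.length-take (suc D) (privates G u v))) (ℕ.m⊓n≤m (suc D) _)

      -- `R` must avoid `u`, `v` and up to D + 1 vertices on either side. Since r + (D + 1) = k,
      -- this takes k + 3 + D vertices in all.
      room : r ℕ.+ (2 ℕ.+ length (xs ++ ys)) ℕ.≤ n
      room = begin
        r ℕ.+ (2 ℕ.+ length (xs ++ ys))
          ≡⟨ cong (λ l → r ℕ.+ (2 ℕ.+ l)) (List.length-++ xs) ⟩
        r ℕ.+ (2 ℕ.+ (length xs ℕ.+ length ys))
          ≤⟨ ℕ.+-monoʳ-≤ r (ℕ.+-monoʳ-≤ 2 (ℕ.+-mono-≤ (length-take u v) (length-take v u))) ⟩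
        r ℕ.+ (2 ℕ.+ (suc D ℕ.+ suc D))
          ≡⟨ regroup r D ⟩
        (r ℕ.+ suc D) ℕ.+ 3 ℕ.+ D
          ≡⟨ cong (λ l → l ℕ.+ 3 ℕ.+ D) (ℕ.m∸n+n≡m D<k) ⟩
        k ℕ.+ 3 ℕ.+ D
          ≤⟨ bound ⟩
        n ∎
        where
        open ℕ.≤-Reasoning
        open import Data.Nat.Tactic.RingSolver using () renaming (solve-∀ to solveℕ-∀)
        regroup : ∀ r D → r ℕ.+ (2 ℕ.+ (suc D ℕ.+ suc D)) ≡ (r ℕ.+ suc D) ℕ.+ 3 ℕ.+ D
        regroup = solveℕ-∀

      impossible : ¬ (D ℕ.< length (privates G u v))
      impossible D<xs = conflict (select r [] (u ∷ v ∷ xs ++ ys) [] z≤n room)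
        where
        conflict : ∃ (λ R → ∣ R ∣ ≡ r × All (_∈ R) [] × All (_∉ R) (u ∷ v ∷ xs ++ ys)) → ⊥
        conflict (R , R≡ , [] , (u∉R ∷ v∉R ∷ xsys∉R)) =
          contradiction too-small (too-large (suc D ℕ.≤? length (privates G v u)))
          where
          xs∉R : All (_∉ R) xs
          xs∉R = All.++⁻ˡ xs xsys∉R
          ys∉R : All (_∉ R) ys
          ys∉R = All.++⁻ʳ xs xsys∉R

          size-after : ∀ {zs} → length zs ≡ suc D → Unique zs → All (_∉ R) zs → ∣ insertAll zs R ∣ ≡ k
          size-after zs≡ unique zs∉R = trans (∣insertAll∣ unique zs∉R)
            (trans (cong₂ ℕ._+_ zs≡ R≡) (ℕ.m+[n∸m]≡n D<k))

          full : ∀ {u v} → suc D ℕ.≤ length (privates G u v) → length (take (suc D) (privates G u v)) ≡ suc D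
          full {u} {v} D< = trans (List.length-take (suc D) (privates G u v)) (ℕ.m≤n⇒m⊓n≡m D<)

          avoids : ∀ {u v w} → (∀ {x} → IsPrivate G u v x → w ≢ x) → All (w ≢_) (take (suc D) (privates G u v))
          avoids {u} {v} w≢ = All.map w≢ (all-private u v)

          -- Inserting the D + 1 vertices private to `u` raises the balance by D + 1, to at most D.
          too-small : balance G u v R ≤ -1ℤ
          too-small = +-cancelʳ-≤ (+ suc D) (subst₂ _≤_
            (trans (balance-insertAll G u v 1ℤ (All.map (adj-private G) (all-private u v)) (unique u v) xs∉R)
                   (cong (λ l → balance G u v R + l) (trans (ℤ.*-identityʳ (+ length xs)) (cong +_ (full D<xs)))))
            (simplify (+ D))
            (balance-≤ (size-after (full D<xs) (unique u v) xs∉R)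
              (insertAll-∉ (avoids (λ Px → proj₁ (private-≢ G Px) ∘ sym)) u∉R)
              (insertAll-∉ (avoids (λ Px → proj₂ (private-≢ G Px) ∘ sym)) v∉R)))
            where
            simplify : ∀ d → d ≡ -1ℤ + (1ℤ + d)
            simplify = solve-∀

          -- If `v` has D + 1 private vertices too, inserting them lowers the balance by D + 1, to
          -- at least -D. Otherwise `ys` contains all of them, `R` avoids them and `balance-nonneg`
          -- applies.
          too-large : Dec (suc D ℕ.≤ length (privates G v u)) → ¬ (balance G u v R ≤ -1ℤ)
          too-large (yes D<ys) b≤-1 = ℤ.<⇒≱ (ℤ.≤-<-trans b≤-1 (-<+ {0} {1})) (+-cancelʳ-≤ (- + suc D)
            (subst₂ _≤_
            (simplify (+ D))
            (trans (balance-insertAll G u v -1ℤ (All.map (adj-private′ G) (all-private v u)) (unique v u) ys∉R)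
                   (cong (λ l → balance G u v R + l) (trans (ℤ.*-comm (+ length ys) -1ℤ) (trans (ℤ.-1*i≡-i (+ length ys)) (cong (λ l → - + l) (full D<ys))))))
            (balance-≥ (size-after (full D<ys) (unique v u) ys∉R)
              (insertAll-∉ (avoids (λ Px → proj₂ (private-≢ G Px) ∘ sym)) u∉R)
              (insertAll-∉ (avoids (λ Px → proj₁ (private-≢ G Px) ∘ sym)) v∉R))))
            where
            simplify : ∀ d → - d ≡ 1ℤ - (1ℤ + d)
            simplify = solve-∀
          too-large (no D≮ys) b≤-1 = ℤ.<⇒≱ (ℤ.≤-<-trans b≤-1 (-<+ {0} {0})) (balance-nonneg G u v u∉R privates∉R)
            where
            privates∉R : All (_∉ R) (privates G v u)
            privates∉R = subst (All (_∉ R)) (List.take-all (suc D) (privates G v u) (ℕ.≰⇒≥ D≮ys)) ys∉R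

-- From private vertices to stars and matchings, up to complement.

module PrivateNeighbours where
  open Selections
  open Balances
  open import Data.Empty using (⊥)
  open import Data.List using ([]; _∷_)
  open import Data.List.Relation.Unary.All using ([]; _∷_)
  open import Data.Nat using (_≤_)

  module _ {n} (G : Graph n) where

    ~-sym : ∀ {i j} → Adj G i j → Adj G j i
    ~-sym = Graph.~-sym G

    ~⇒≢ : ∀ {i j} → Adj G i j → i ≢ j
    ~⇒≢ i~j refl = Graph.~-irrefl G refl i~j

    ∁⁻ : ∀ {i j} → i ≢ j → ¬ Adj (complement G) i j → Adj G i j
    ∁⁻ {i} {j} i≢j i≁j = decidable-stable (adj? G i j) (λ ¬i~j → i≁j (i≢j , ¬i~j))

    private-≢ʳ : ∀ {u v x} → IsPrivate G u v x → u ≢ v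
    private-≢ʳ (_ , u~x , v≁x) refl = v≁x u~x

    -- Without private vertices, a neighbour of one vertex is adjacent to every other vertex, so a
    -- single edge would spread to a complete graph.
    ∃-private : ¬ Complete G → ¬ CoComplete G → ∃ λ u → ∃₂ (IsPrivate G u)
    ∃-private ¬complete ¬cocomplete with Fin.any? (λ u → Fin.any? (λ v → Fin.any? (isPrivate? G u v)))
    ... | yes found = found
    ... | no ∄private = contradiction (λ i j i≢j → i≢j , λ i~j → ¬complete (complete i~j)) ¬cocomplete
      where
      spread : ∀ {u x} v → Adj G u x → x ≢ v → Adj G v x
      spread {u} {x} v u~x x≢v = decidable-stable (adj? G v x) (λ v≁x → ∄private (u , v , x , x≢v , u~x , v≁x))
      complete : ∀ {r s} → Adj G r s → Complete G
      complete {r} {s} r~s i j i≢j with s Fin.≟ i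
      ... | yes refl = ~-sym (spread j r~s i≢j)
      ... | no s≢i   = ~-sym (spread j (~-sym (spread i r~s s≢i)) i≢j)

    module _ (uniform : ∀ {u v x y} → IsPrivate G u v x → y ≢ u → y ≢ v → IsPrivate G u v y)
             {u v x : Fin n} (Px : IsPrivate G u v x) where
      private
        dominating : ∀ {y} → y ≢ u → y ≢ v → Adj G u y
        dominating y≢u y≢v = proj₁ (proj₂ (uniform Px y≢u y≢v))

        isolated : ∀ {y} → y ≢ u → y ≢ v → ¬ Adj G v y
        isolated y≢u y≢v = proj₂ (proj₂ (uniform Px y≢u y≢v))

        star : Adj G u v → IsStar G
        star u~v = u , λ i j → mk⇔ (λ i~j → ~⇒≢ i~j , centre i~j) from
          where
          -- `v` is adjacent to `u` but not to `i`, hence private to `u` against `i`; uniformity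
          -- then keeps `i` apart from every `j`.
          others : ∀ {i j} → i ≢ u → i ≢ v → j ≢ u → j ≢ v → ¬ Adj G i j
          others i≢u i≢v j≢u j≢v i~j =
            proj₂ (proj₂ (uniform (≢-sym i≢v , u~v , isolated i≢u i≢v ∘ ~-sym) j≢u (≢-sym (~⇒≢ i~j)))) i~j
          centre : ∀ {i j} → Adj G i j → i ≡ u ⊎ j ≡ u
          centre {i} {j} i~j with i Fin.≟ u | j Fin.≟ u | i Fin.≟ v | j Fin.≟ v
          ... | yes i≡u | _       | _        | _        = inj₁ i≡u
          ... | no _    | yes j≡u | _        | _        = inj₂ j≡u
          ... | no i≢u  | no j≢u  | yes refl | _        = contradiction i~j (isolated j≢u (≢-sym (~⇒≢ i~j)))
          ... | no i≢u  | no j≢u  | no i≢v   | yes refl = contradiction (~-sym i~j) (isolated i≢u i≢v)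
          ... | no i≢u  | no j≢u  | no i≢v   | no j≢v   = contradiction i~j (others i≢u i≢v j≢u j≢v)
          spoke : ∀ {j} → u ≢ j → Adj G u j
          spoke {j} u≢j with j Fin.≟ v
          ... | yes refl = u~v
          ... | no j≢v   = dominating (≢-sym u≢j) j≢v
          from : ∀ {i j} → i ≢ j × (i ≡ u ⊎ j ≡ u) → Adj G i j
          from (i≢j , inj₁ refl) = spoke i≢j
          from (i≢j , inj₂ refl) = ~-sym (spoke (≢-sym i≢j))

        costar : ¬ Adj G u v → IsStar (complement G)
        costar u≁v = v , λ i j → mk⇔ (λ (i≢j , i≁j) → i≢j , centre i≢j i≁j) from
          where
          u≢v : u ≢ v
          u≢v = private-≢ʳ Px
          -- `u` is adjacent to `i` but not to `v`, hence private to `i` against `v`; uniformity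
          -- then joins `i` to every `j`.
          others : ∀ {i j} → i ≢ j → i ≢ u → i ≢ v → j ≢ v → Adj G i j
          others i≢j i≢u i≢v j≢v =
            proj₁ (proj₂ (uniform (u≢v , ~-sym (dominating i≢u i≢v) , u≁v ∘ ~-sym) (≢-sym i≢j) j≢v))
          centre : ∀ {i j} → i ≢ j → ¬ Adj G i j → i ≡ v ⊎ j ≡ v
          centre {i} {j} i≢j i≁j with i Fin.≟ v | j Fin.≟ v | i Fin.≟ u
          ... | yes i≡v | _       | _        = inj₁ i≡v
          ... | no _    | yes j≡v | _        = inj₂ j≡v
          ... | no i≢v  | no j≢v  | yes refl = contradiction (dominating (≢-sym i≢j) j≢v) i≁j
          ... | no i≢v  | no j≢v  | no i≢u   = contradiction (others i≢j i≢u i≢v j≢v) i≁j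
          lonely : ∀ {j} → v ≢ j → ¬ Adj G v j
          lonely {j} v≢j with j Fin.≟ u
          ... | yes refl = u≁v ∘ ~-sym
          ... | no j≢u   = isolated j≢u (≢-sym v≢j)
          from : ∀ {i j} → i ≢ j × (i ≡ v ⊎ j ≡ v) → Adj (complement G) i j
          from (i≢j , inj₁ refl) = i≢j , lonely i≢j
          from (i≢j , inj₂ refl) = i≢j , lonely (≢-sym i≢j) ∘ ~-sym

      -- Uniformity joins `u` to all vertices outside {u, v} and `v` to none of them. If `u` and `v`
      -- are adjacent, `u` is the centre of a star; otherwise `v` is the centre of a star in the
      -- complement.
      star⊎costar : IsStar G ⊎ IsStar (complement G)
      star⊎costar with adj? G u v
      ... | yes u~v = inj₁ (star u~v)
      ... | no u≁v  = inj₂ (costar u≁v)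

  UniquePrivates : ∀ {n} → Graph n → Set
  UniquePrivates G = ∀ {u v x y} → IsPrivate G u v x → IsPrivate G u v y → x ≡ y

  -- Complementing exchanges the roles of the two vertices that are told apart.
  uniquePrivates-complement : ∀ {n} {G : Graph n} → UniquePrivates G → UniquePrivates (complement G)
  uniquePrivates-complement {G = G} unique Px Py = unique (flip Px) (flip Py)
    where
    flip : ∀ {u v x} → IsPrivate (complement G) u v x → IsPrivate G v u x
    flip (x≢v , (u≢x , u≁x) , v∤x) = ≢-sym u≢x , ∁⁻ G (≢-sym x≢v) v∤x , u≁x

  -- At most one neighbour; `a` is arbitrary when there is none. If this holds at every vertex, the
  -- edges form a matching.
  MatchedAt : ∀ {n} → Graph n → Fin n → Set
  MatchedAt G u = ∃ λ a → ∀ {z} → Adj G u z → z ≡ a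

  TwoNeighbours : ∀ {n} → Graph n → Fin n → Set
  TwoNeighbours G u = ∃₂ λ x y → x ≢ y × Adj G u x × Adj G u y

  module _ {n} (G : Graph n) where

    twoNeighbours? : ∀ u → Dec (TwoNeighbours G u)
    twoNeighbours? u = Fin.any? λ x → Fin.any? λ y → ¬? (x Fin.≟ y) ×-dec adj? G u x ×-dec adj? G u y

    matchedAt : ∀ {u} → ¬ TwoNeighbours G u → MatchedAt G u
    matchedAt {u} ∄two with Fin.any? (adj? G u)
    ... | yes (a , u~a) = a , λ {z} u~z → decidable-stable (z Fin.≟ a) λ z≢a → ∄two (z , a , z≢a , u~z , u~a)
    ... | no ∄neighbour = u , λ {z} u~z → contradiction (z , u~z) ∄neighbour

    -- At most one of three neighbours of u is not adjacent to a given non-neighbour,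
    -- so one of them is adjacent to both non-neighbours, which are then private.
    crowded : UniquePrivates G → ∀ {u x y z w w′} → x ≢ y → x ≢ z → y ≢ z → Adj G u x → Adj G u y → Adj G u z →
      w ≢ w′ → w ≢ u → w′ ≢ u → ¬ Adj G u w → ¬ Adj G u w′ → ⊥
    crowded unique {u} {x} {y} {z} {w} {w′} x≢y x≢z y≢z u~x u~y u~z w≢w′ w≢u w′≢u u≁w u≁w′
      = cover (adj? G w x) (adj? G w′ x) (adj? G w y) (adj? G w′ y)
      where
      others : ∀ {w s t} → ¬ Adj G u w → ¬ Adj G w s → Adj G u s → Adj G u t → s ≢ t → Adj G w t
      others {w} {s} {t} u≁w w≁s u~s u~t s≢t = decidable-stable (adj? G w t) λ w≁t →
        s≢t (unique ((λ { refl → u≁w u~s }) , u~s , w≁s) ((λ { refl → u≁w u~t }) , u~t , w≁t))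
      common : ∀ {t} → Adj G u t → Adj G w t → Adj G w′ t → ⊥
      common u~t w~t w′~t = w≢w′ (unique (w≢u , ~-sym G w~t , u≁w) (w′≢u , ~-sym G w′~t , u≁w′))
      cover : Dec (Adj G w x) → Dec (Adj G w′ x) → Dec (Adj G w y) → Dec (Adj G w′ y) → ⊥
      cover (yes w~x) (yes w′~x) _         _          = common u~x w~x w′~x
      cover (no w≁x)  _          _         (yes w′~y) = common u~y (others u≁w w≁x u~x u~y x≢y) w′~y
      cover (no w≁x)  _          _         (no w′≁y)  = common u~z (others u≁w w≁x u~x u~z x≢z) (others u≁w′ w′≁y u~y u~z y≢z)
      cover (yes _)   (no w′≁x)  (yes w~y) _          = common u~y w~y (others u≁w′ w′≁x u~x u~y x≢y)
      cover (yes _)   (no w′≁x)  (no w≁y)  _          = common u~z (others u≁w w≁y u~y u~z y≢z) (others u≁w′ w′≁x u~x u~z x≢z)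

  module _ {n} {G : Graph n} (6≤n : 6 ≤ n) (unique : UniquePrivates G) where

    private
      unique′ : UniquePrivates (complement G)
      unique′ = uniquePrivates-complement {G = G} unique

      -- A sixth vertex is a third neighbour or a third non-neighbour of `u`, so `crowded` applies
      -- to `G` or to its complement.
      ¬both : ∀ u → TwoNeighbours G u → ¬ TwoNeighbours (complement G) u
      ¬both u (x , y , x≢y , u~x , u~y) (w , w′ , w≢w′ , (u≢w , u≁w) , (u≢w′ , u≁w′))
        with fresh (u ∷ x ∷ y ∷ w ∷ w′ ∷ []) 6≤n
      ... | z , z≢u ∷ z≢x ∷ z≢y ∷ z≢w ∷ z≢w′ ∷ [] with adj? G u z
      ... | yes u~z = crowded G unique x≢y (≢-sym z≢x) (≢-sym z≢y) u~x u~y u~z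
              w≢w′ (≢-sym u≢w) (≢-sym u≢w′) u≁w u≁w′
      ... | no u≁z = crowded (complement G) unique′ w≢w′ (≢-sym z≢w) (≢-sym z≢w′) (u≢w , u≁w) (u≢w′ , u≁w′) (≢-sym z≢u , u≁z)
              x≢y (≢-sym (~⇒≢ G u~x)) (≢-sym (~⇒≢ G u~y)) (λ (_ , u≁x) → u≁x u~x) (λ (_ , u≁y) → u≁y u~y)

    matched⊎comatched : (∀ u → MatchedAt G u) ⊎ (∀ u → MatchedAt (complement G) u)
    matched⊎comatched with Fin.any? (twoNeighbours? G) | Fin.any? (twoNeighbours? (complement G))
    ... | no ∄u         | _               = inj₁ λ u → matchedAt G (λ two → ∄u (u , two))
    ... | yes _         | no ∄u′          = inj₂ λ u → matchedAt (complement G) (λ two → ∄u′ (u , two))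
    -- Now `u` misses at most the vertex `a` and `u′` meets at most the vertex `b`. Any two vertices
    -- outside u, u′, a, b are then private to `u` against `u′`, contrary to uniqueness.
    ... | yes (u , two) | yes (u′ , two′) =
      let a , misses = matchedAt (complement G) (¬both u two)
          b , meets = matchedAt G (λ two″ → ¬both u′ two″ two′)
      in contradiction (λ {z} → private-between {u} {u′} {a} {b} {z} misses meets) (crossed u u′ a b)
      where
      private-between : ∀ {u u′ a b z} → (∀ {z} → Adj (complement G) u z → z ≡ a) → (∀ {z} → Adj G u′ z → z ≡ b) →
        z ≢ u → z ≢ u′ → z ≢ a → z ≢ b → IsPrivate G u u′ z
      private-between misses meets z≢u z≢u′ z≢a z≢b = z≢u′ , ∁⁻ G (≢-sym z≢u) (z≢a ∘ misses) , z≢b ∘ meets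
      crossed : ∀ u u′ a b → ¬ (∀ {z} → z ≢ u → z ≢ u′ → z ≢ a → z ≢ b → IsPrivate G u u′ z)
      crossed u u′ a b all-private with fresh (u ∷ u′ ∷ a ∷ b ∷ []) (ℕ.≤-trans (ℕ.n≤1+n 5) 6≤n)
      ... | z , z≢u ∷ z≢u′ ∷ z≢a ∷ z≢b ∷ [] with fresh (z ∷ u ∷ u′ ∷ a ∷ b ∷ []) 6≤n
      ... | z′ , z′≢z ∷ z′≢u ∷ z′≢u′ ∷ z′≢a ∷ z′≢b ∷ [] =
        z′≢z (unique (all-private z′≢u z′≢u′ z′≢a z′≢b) (all-private z≢u z≢u′ z≢a z≢b))

-- Isolated, dominating and independent configurations.

module Degrees where
  open Indicators
  open InducedSizes
  open import Data.Fin.Subset using (∣_∣)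
  open import Data.Integer using (_+_; _*_; _≤_)
  open ≡-Reasoning

  module _ {n} (G : Graph n) where

    degreeIn-none : ∀ {v S} → (∀ {j} → j ∈ S → ¬ Adj G v j) → degreeIn G S v ≡ 0ℤ
    degreeIn-none {v} {S} isolated = begin
      degreeIn G S v                     ≡⟨ degreeIn≡∑ G S v ⟩
      ∑[ j < n ] (adj G v j * ⟦ S ⟧ j)   ≡⟨ sum-cong-≗ term ⟩
      ∑[ j < n ] 0ℤ                      ≡⟨ ∑-0 n ⟩
      0ℤ                                 ∎
      where
      term : ∀ j → adj G v j * ⟦ S ⟧ j ≡ 0ℤ
      term j with j ∈? S
      ... | yes j∈S = cong (_* 1ℤ) (χ-no (adj? G v j) (isolated j∈S))
      ... | no _    = ℤ.*-zeroʳ (adj G v j)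

    degreeIn-all : ∀ {v S} → (∀ {j} → j ∈ S → Adj G v j) → degreeIn G S v ≡ + ∣ S ∣
    degreeIn-all {v} {S} dominates = begin
      degreeIn G S v                     ≡⟨ degreeIn≡∑ G S v ⟩
      ∑[ j < n ] (adj G v j * ⟦ S ⟧ j)   ≡⟨ sum-cong-≗ term ⟩
      ∑[ j < n ] ⟦ S ⟧ j                 ≡⟨ ∣S∣≡∑ S ⟨
      + ∣ S ∣                            ∎
      where
      term : ∀ j → adj G v j * ⟦ S ⟧ j ≡ ⟦ S ⟧ j
      term j with j ∈? S
      ... | yes j∈S = cong (_* 1ℤ) (χ-yes (adj? G v j) (dominates j∈S))
      ... | no _    = ℤ.*-zeroʳ (adj G v j)

    degreeIn-some : ∀ {v w S} → w ∈ S → Adj G v w → 1ℤ ≤ degreeIn G S v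
    degreeIn-some {v} {w} {S} w∈S v~w = subst₂ _≤_ (∑-χ≟ (λ _ → 1ℤ) w) (sym (degreeIn≡∑ G S v)) (∑-mono term)
      where
      term : ∀ j → χ (j Fin.≟ w) * 1ℤ ≤ adj G v j * ⟦ S ⟧ j
      term j with j Fin.≟ w
      ... | yes refl = ℤ.≤-reflexive (sym (cong₂ _*_ (χ-yes (adj? G v j) v~w) (χ-yes (j ∈? S) w∈S)))
      ... | no _ with adj? G v j | j ∈? S
      ...   | yes _ | yes _ = +≤+ z≤n
      ...   | yes _ | no _  = +≤+ z≤n
      ...   | no _  | yes _ = +≤+ z≤n
      ...   | no _  | no _  = +≤+ z≤n

    inducedSize-independent : ∀ {S} → Independent G S → inducedSize G S ≡ 0
    inducedSize-independent {S} independent = ℤ.+-injective (ℤ.*-cancelˡ-≡ (+ 2) _ _ (begin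
      (+ 2) * + inducedSize G S            ≡⟨ ∑degree G S ⟨
      ∑[ i < n ] (degreeIn G S i * ⟦ S ⟧ i) ≡⟨ sum-cong-≗ term ⟩
      ∑[ i < n ] 0ℤ                       ≡⟨ ∑-0 n ⟩
      0ℤ                                  ∎))
      where
      term : ∀ i → degreeIn G S i * ⟦ S ⟧ i ≡ 0ℤ
      term i with i ∈? S
      ... | yes i∈S = cong (_* 1ℤ) (degreeIn-none (λ {j} j∈S → independent i j i∈S j∈S))
      ... | no _    = ℤ.*-zeroʳ (degreeIn G S i)

-- Matchings whose induced sizes differ by at most one.

module SingleEdges where
  open InducedSizes
  open Selections
  open Balances
  open PrivateNeighbours
  open Degrees
  open import Data.Empty using (⊥)
  open import Data.Fin.Subset using (∣_∣)
  open import Data.Integer using (_+_; _-_; -_; _≤_)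
  open import Data.Integer.Tactic.RingSolver using (solve-∀)
  open import Data.List using ([]; _∷_)
  open import Data.List.Relation.Unary.All using ([]; _∷_)
  open import Data.Nat using (suc)

  size-difference-≤ : ∀ {n} {G : Graph n} {c p D} → TwoValued G c p D →
    ∀ {S S′} → ∣ S ∣ ≡ c → ∣ S′ ∣ ≡ c → + inducedSize G S - + inducedSize G S′ ≤ + D
  size-difference-≤ {D = D} two S≡c S′≡c =
    values-≤ (difference-values (+ D) (size-values two _ S≡c) (size-values two _ S′≡c))

  module _ {n} {G : Graph n} (matched : ∀ u → MatchedAt G u) where

    private
      match : Fin n → Fin n
      match u = proj₁ (matched u)

      partner-unique : ∀ {u v w} → Adj G u v → Adj G u w → v ≡ w
      partner-unique {u} u~v u~w = trans (proj₂ (matched u) u~v) (sym (proj₂ (matched u) u~w))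

    -- Among three new vertices, `x` is adjacent to at most one of the other two.
    ∃-strangers : ∀ ys → 3 ℕ.+ length ys ℕ.≤ n →
      ∃₂ λ x y → x ≢ y × ¬ Adj G x y × All (x ≢_) ys × All (y ≢_) ys
    ∃-strangers ys room
      with fresh ys (ℕ.≤-trans (ℕ.m≤n+m _ 2) room)
    ... | x , x∉ys with fresh (x ∷ ys) (ℕ.≤-trans (ℕ.m≤n+m _ 1) room)
    ... | y , y≢x ∷ y∉ys with fresh (y ∷ x ∷ ys) room
    ... | z , z≢y ∷ z≢x ∷ z∉ys with adj? G x y
    ... | no x≁y  = x , y , ≢-sym y≢x , x≁y , x∉ys , y∉ys
    ... | yes x~y = x , z , ≢-sym z≢x , (λ x~z → z≢y (partner-unique x~z x~y)) , x∉ys , z∉ys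

    module _ {r p} (two : TwoValued G (4 ℕ.+ r) p 1) (r+8≤n : r ℕ.+ 8 ℕ.≤ n) where

      -- Start from a set containing `a` and `a′`. Adding `b` and `b′` completes both edges. Adding
      -- instead two non-adjacent vertices whose partners are kept away completes none, so the two
      -- sizes differ by at least 2.
      ¬two-edges : ∀ {a b a′ b′} → Adj G a b → Adj G a′ b′ → a′ ≢ a → a′ ≢ b → b′ ≢ a → b′ ≢ b → ⊥
      ¬two-edges {a} {b} {a′} {b′} a~b a′~b′ a′≢a a′≢b b′≢a b′≢b =
        let x , y , x≢y , x≁y , x∉ , y∉ = ∃-strangers (a ∷ b ∷ a′ ∷ b′ ∷ [])
              (ℕ.≤-trans (ℕ.m≤n+m 7 (suc r)) (ℕ.≤-trans (ℕ.≤-reflexive (sym (ℕ.+-suc r 7))) r+8≤n))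
            -- Eight vertices are avoided. The partners may repeat each other or earlier vertices,
            -- which `select` permits.
            R , R≡r , _ , ∉R = select r [] (a ∷ b ∷ a′ ∷ b′ ∷ x ∷ y ∷ match x ∷ match y ∷ []) [] z≤n r+8≤n
        in conflict R x y x≢y x≁y x∉ y∉ R≡r ∉R
        where
        conflict : ∀ R x y → x ≢ y → ¬ Adj G x y →
          All (x ≢_) (a ∷ b ∷ a′ ∷ b′ ∷ []) → All (y ≢_) (a ∷ b ∷ a′ ∷ b′ ∷ []) →
          ∣ R ∣ ≡ r → All (_∉ R) (a ∷ b ∷ a′ ∷ b′ ∷ x ∷ y ∷ match x ∷ match y ∷ []) → ⊥
        conflict R x y x≢y x≁y (x≢a ∷ x≢b ∷ x≢a′ ∷ x≢b′ ∷ []) (y≢a ∷ y≢b ∷ y≢a′ ∷ y≢b′ ∷ []) R≡r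
          (a∉R ∷ b∉R ∷ a′∉R ∷ b′∉R ∷ x∉R ∷ y∉R ∷ mx∉R ∷ my∉R ∷ []) =
          ℤ.<⇒≱ {1ℤ} {+ 2} (+<+ (s≤s (s≤s z≤n))) (ℤ.≤-trans gap (size-difference-≤ two ∣S∣ ∣S′∣))
          where
          B S S′ : Subset n
          B = insert a (insert a′ R)
          S = insert b′ (insert b B)
          S′ = insert y (insert x B)

          a∉ : a ∉ insert a′ R
          a∉ = ∉insert (≢-sym a′≢a) a∉R
          outside-B : ∀ {z} → z ≢ a → z ≢ a′ → z ∉ R → z ∉ B
          outside-B z≢a z≢a′ z∉R = ∉insert z≢a (∉insert z≢a′ z∉R)
          b∉ : b ∉ B
          b∉ = outside-B (≢-sym (~⇒≢ G a~b)) (≢-sym a′≢b) b∉R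
          b′∉ : b′ ∉ insert b B
          b′∉ = ∉insert b′≢b (outside-B b′≢a (≢-sym (~⇒≢ G a′~b′)) b′∉R)
          x∉ : x ∉ B
          x∉ = outside-B x≢a x≢a′ x∉R
          y∉ : y ∉ insert x B
          y∉ = ∉insert (≢-sym x≢y) (outside-B y≢a y≢a′ y∉R)

          ∣B∣ : ∣ B ∣ ≡ 2 ℕ.+ r
          ∣B∣ = trans (∣insert∣ a∉) (cong suc (trans (∣insert∣ a′∉R) (cong suc R≡r)))
          ∣S∣ : ∣ S ∣ ≡ 4 ℕ.+ r
          ∣S∣ = trans (∣insert∣ b′∉) (cong suc (trans (∣insert∣ b∉) (cong suc ∣B∣)))
          ∣S′∣ : ∣ S′ ∣ ≡ 4 ℕ.+ r
          ∣S′∣ = trans (∣insert∣ y∉) (cong suc (trans (∣insert∣ x∉) (cong suc ∣B∣)))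

          lonely : ∀ {z} → z ≢ b → z ≢ b′ → match z ∉ R → ∀ {j} → j ∈ B → ¬ Adj G z j
          lonely {z} z≢b z≢b′ mz∉R j∈B z~j with ∈insert⁻ j∈B
          ... | inj₁ refl = z≢b (partner-unique (~-sym G z~j) a~b)
          ... | inj₂ j∈ with ∈insert⁻ j∈
          ...   | inj₁ refl = z≢b′ (partner-unique (~-sym G z~j) a′~b′)
          ...   | inj₂ j∈R  = mz∉R (subst (_∈ R) (proj₂ (matched z) z~j) j∈R)

          lonely-y : ∀ {j} → j ∈ insert x B → ¬ Adj G y j
          lonely-y j∈ y~j with ∈insert⁻ j∈
          ... | inj₁ refl = x≁y (~-sym G y~j)
          ... | inj₂ j∈B  = lonely y≢b y≢b′ my∉R j∈B y~j

          base : ℤ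
          base = + inducedSize G B

          sparse : + inducedSize G S′ ≡ base
          sparse = begin
            + inducedSize G S′
              ≡⟨ inducedSize-insert G y∉ ⟩
            + inducedSize G (insert x B) + degreeIn G (insert x B) y
              ≡⟨ cong₂ _+_ (inducedSize-insert G x∉) (degreeIn-none G lonely-y) ⟩
            base + degreeIn G B x + 0ℤ
              ≡⟨ cong (λ d → base + d + 0ℤ) (degreeIn-none G (lonely x≢b x≢b′ mx∉R)) ⟩
            base + 0ℤ + 0ℤ
              ≡⟨ trans (ℤ.+-identityʳ _) (ℤ.+-identityʳ _) ⟩
            base
              ∎
            where open ≡-Reasoning

          dense : base + 1ℤ + 1ℤ ≤ + inducedSize G S
          dense = begin
            base + 1ℤ + 1ℤ
              ≤⟨ ℤ.+-mono-≤ (ℤ.+-monoʳ-≤ base (degreeIn-some G (v∈insert a (insert a′ R)) (~-sym G a~b)))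
                            (degreeIn-some G (⊆insert (⊆insert (v∈insert a′ R))) (~-sym G a′~b′)) ⟩
            base + degreeIn G B b + degreeIn G (insert b B) b′
              ≡⟨ cong (λ s → s + degreeIn G (insert b B) b′) (inducedSize-insert G b∉) ⟨
            + inducedSize G (insert b B) + degreeIn G (insert b B) b′
              ≡⟨ inducedSize-insert G b′∉ ⟨
            + inducedSize G S
              ∎
            where open ℤ.≤-Reasoning

          gap : + 2 ≤ + inducedSize G S - + inducedSize G S′
          gap = subst₂ _≤_ (simplify base) (cong (λ s → + inducedSize G S - s) (sym sparse)) (ℤ.+-monoˡ-≤ (- base) dense)
            where
            simplify : ∀ s → s + 1ℤ + 1ℤ - s ≡ + 2
            simplify = solve-∀

      singleEdge : ∀ {a b} → Adj G a b → IsSingleEdge G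
      singleEdge {a} {b} a~b = a , b , ~⇒≢ G a~b , λ i j → mk⇔ only from
        where
        only : ∀ {i j} → Adj G i j → (i ≡ a × j ≡ b) ⊎ (i ≡ b × j ≡ a)
        only {i} {j} i~j with i Fin.≟ a | i Fin.≟ b | j Fin.≟ a | j Fin.≟ b
        ... | yes refl | _        | _        | _        = inj₁ (refl , partner-unique i~j a~b)
        ... | no _     | yes refl | _        | _        = inj₂ (refl , partner-unique i~j (~-sym G a~b))
        ... | no _     | no i≢b   | yes refl | _        = contradiction (partner-unique (~-sym G i~j) a~b) i≢b
        ... | no i≢a   | no _     | no _     | yes refl = contradiction (partner-unique (~-sym G i~j) (~-sym G a~b)) i≢a
        ... | no i≢a   | no i≢b   | no j≢a   | no j≢b   = contradiction i~j (λ i~j → ¬two-edges a~b i~j i≢a i≢b j≢a j≢b)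
        from : ∀ {i j} → (i ≡ a × j ≡ b) ⊎ (i ≡ b × j ≡ a) → Adj G i j
        from (inj₁ (refl , refl)) = a~b
        from (inj₂ (refl , refl)) = ~-sym G a~b

-- Classification of the graphs with two induced sizes.

module Classification where
  open Indicators
  open InducedSizes
  open Selections
  open Balances
  open PrivateNeighbours
  open Degrees
  open SingleEdges
  open import Data.Fin using (zero; suc)
  open import Data.Fin.Subset using (∣_∣)
  open import Data.Integer using (_+_; _*_; _-_; -_; _≤_)
  open import Data.Integer.Tactic.RingSolver using (solve-∀)
  open import Data.List using ([]; _∷_; _++_)
  open import Data.List.Relation.Unary.All using ([]; _∷_)
  open import Data.List.Relation.Unary.Any using (here; there)
  open import Data.Nat using (suc)
  open import Data.Vec using (_∷_; here; there)

  private
    multiple-bounds : ∀ {d r j} → + suc r ≡ + d * j → 1 ℕ.≤ d × d ℕ.≤ suc r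
    multiple-bounds {d} {r} {j} eq = ℕ.n≢0⇒n>0 (λ { refl → nonzero eq }) , ℕ.∣⇒≤ (ℕ.divides (Data.Integer.∣ j ∣)
      (trans (cong Data.Integer.∣_∣ eq) (trans (ℤ.abs-* (+ d) j) (ℕ.*-comm d _))))
      where
      nonzero : + suc r ≢ 0ℤ * j
      nonzero eq with () ← trans eq (ℤ.*-zeroˡ j)

  module _ {n} {G : Graph n} {r p D} (two : TwoValued G (4 ℕ.+ r) p D) (r+8≤n : r ℕ.+ 8 ℕ.≤ n) where

    private
      k+3≤n : 3 ℕ.+ r ℕ.+ 3 ℕ.≤ n
      k+3≤n = ℕ.≤-trans (ℕ.≤-trans (ℕ.≤-reflexive (ℕ.+-comm (3 ℕ.+ r) 3)) (ℕ.+-monoˡ-≤ r (ℕ.m≤m+n 6 2)))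
                        (ℕ.≤-trans (ℕ.≤-reflexive (ℕ.+-comm 8 r)) r+8≤n)

      8≤n : 8 ℕ.≤ n
      8≤n = ℕ.≤-trans (ℕ.m≤n+m 8 r) r+8≤n

    -- If `y` contributes 1 to the balance, it is private to `u`. If it contributes -1 or 0, then
    -- `D` divides 2 or 1 respectively.
    private-or-D≤2 : ∀ {u v x y} → IsPrivate G u v x → y ≢ u → y ≢ v →
      IsPrivate G u v y ⊎ (IsPrivate G v u y × 1 ℕ.≤ D × D ℕ.≤ 2) ⊎ D ≡ 1
    private-or-D≤2 {u} {v} {x} {y} Px y≢u y≢v = decide (x Fin.≟ y)
      where
      cases : (u~y : Dec (Adj G u y)) (v~y : Dec (Adj G v y)) → ∃ (λ j → 1ℤ - (χ u~y - χ v~y) ≡ + D * j) →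
        IsPrivate G u v y ⊎ (IsPrivate G v u y × 1 ℕ.≤ D × D ℕ.≤ 2) ⊎ D ≡ 1
      cases (yes u~y) (no v≁y)  _        = inj₁ (y≢v , u~y , v≁y)
      cases (no u≁y)  (yes v~y) (_ , eq) = inj₂ (inj₁ ((y≢u , v~y , u≁y) , multiple-bounds eq))
      cases (yes _)   (yes _)   (_ , eq) = let 1≤D , D≤1 = multiple-bounds eq in inj₂ (inj₂ (ℕ.≤-antisym D≤1 1≤D))
      cases (no _)    (no _)    (_ , eq) = let 1≤D , D≤1 = multiple-bounds eq in inj₂ (inj₂ (ℕ.≤-antisym D≤1 1≤D))
      decide : Dec (x ≡ y) → IsPrivate G u v y ⊎ (IsPrivate G v u y × 1 ℕ.≤ D × D ℕ.≤ 2) ⊎ D ≡ 1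
      decide (yes refl) = inj₁ Px
      decide (no x≢y)   = cases (adj? G u y) (adj? G v y) (private-dichotomy two (s≤s z≤n) k+3≤n Px y≢u y≢v x≢y)

    -- With k = 3 + r and D ≤ 2, the conditions of `few-privates` become 2 < 3 + r and r + 8 ≤ n,
    -- which is where the range of c is used up.
    few : D ℕ.≤ 2 → ∀ {u v} → u ≢ v → length (privates G u v) ℕ.≤ D
    few D≤2 = few-privates two (ℕ.≤-trans (s≤s D≤2) (ℕ.m≤m+n 3 r))
      (ℕ.≤-trans (ℕ.+-monoʳ-≤ (3 ℕ.+ r ℕ.+ 3) D≤2) (ℕ.≤-trans (ℕ.≤-reflexive (regroup r)) r+8≤n))
      where
      open import Data.Nat.Tactic.RingSolver using () renaming (solve-∀ to solveℕ-∀)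
      regroup : ∀ r → 3 ℕ.+ r ℕ.+ 3 ℕ.+ 2 ≡ r ℕ.+ 8
      regroup = solveℕ-∀

    uniform : D ≢ 1 → D ≢ 2 → ∀ {u v x y} → IsPrivate G u v x → y ≢ u → y ≢ v → IsPrivate G u v y
    uniform D≢1 D≢2 Px y≢u y≢v with private-or-D≤2 Px y≢u y≢v
    ... | inj₁ Py                       = Py
    ... | inj₂ (inj₂ D≡1)               = contradiction D≡1 D≢1
    ... | inj₂ (inj₁ (_ , 1≤D , D≤2)) with ℕ.m≤n⇒m<n∨m≡n D≤2
    ...   | inj₁ (s≤s D≤1) = contradiction (ℕ.≤-antisym D≤1 1≤D) D≢1
    ...   | inj₂ D≡2       = contradiction D≡2 D≢2

    uniquePrivates : D ≡ 1 → UniquePrivates G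
    uniquePrivates D≡1 Px Py = short (∈privates G Px) (∈privates G Py)
      (ℕ.≤-trans (few (ℕ.≤-trans (ℕ.≤-reflexive D≡1) (s≤s z≤n)) (private-≢ʳ G Px)) (ℕ.≤-reflexive D≡1))
      where
      short : ∀ {x y : Fin n} {xs} → x ∈ₗ xs → y ∈ₗ xs → length xs ℕ.≤ 1 → x ≡ y
      short {xs = _ ∷ []}    (here refl) (here refl) _        = refl
      short {xs = _ ∷ _ ∷ _} _           _           (s≤s ())

    -- For D = 2 no vertex outside {u, v} contributes 0, so each is private to `u` or to `v`. There
    -- are at most 2 + 2 of them, but n ≥ 8.
    D≢2 : ¬ Complete G → ¬ CoComplete G → D ≢ 2
    D≢2 ¬complete ¬cocomplete refl =
      let u , v , x , Px = ∃-private G ¬complete ¬cocomplete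
          u≢v = private-≢ʳ G Px
          z , z∉ = fresh (u ∷ v ∷ privates G u v ++ privates G v u)
            (ℕ.≤-trans (s≤s (s≤s (s≤s (ℕ.≤-trans (ℕ.≤-reflexive (List.length-++ (privates G u v)))
              (ℕ.+-mono-≤ (few ℕ.≤-refl u≢v) (few ℕ.≤-refl (≢-sym u≢v))))))) (ℕ.≤-trans (ℕ.n≤1+n 7) 8≤n))
      in stray Px z z∉
      where
      stray : ∀ {u v x} → IsPrivate G u v x → ∀ z → ¬ All (z ≢_) (u ∷ v ∷ privates G u v ++ privates G v u)
      stray {u} {v} Px z (z≢u ∷ z≢v ∷ z∉) with private-or-D≤2 Px z≢u z≢v
      ... | inj₁ Pz              = All.lookup (All.++⁻ˡ (privates G u v) z∉) (∈privates G Pz) refl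
      ... | inj₂ (inj₁ (Pz , _)) = All.lookup (All.++⁻ʳ (privates G u v) z∉) (∈privates G Pz) refl

    -- By uniformity `v` has no private vertex against `u`, so a set containing the private vertex
    -- `x` of `u` has balance at least 1, while D = 0 makes all balances vanish.
    D≢0 : ¬ Complete G → ¬ CoComplete G → D ≢ 0
    D≢0 ¬complete ¬cocomplete refl =
      let u , v , x , Px = ∃-private G ¬complete ¬cocomplete
          R , R≡ , _ , ∉R = select (2 ℕ.+ r) [] (u ∷ v ∷ x ∷ []) [] z≤n
            (ℕ.≤-trans (ℕ.≤-trans (ℕ.n≤1+n _) (ℕ.≤-reflexive refl)) k+3≤n)
      in jump Px R R≡ ∉R
      where
      jump : ∀ {u v x} → IsPrivate G u v x → ∀ R → ∣ R ∣ ≡ 2 ℕ.+ r → ¬ All (_∉ R) (u ∷ v ∷ x ∷ [])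
      jump {u} {v} {x} Px R R≡ (u∉R ∷ v∉R ∷ x∉R ∷ []) =
        ℤ.<⇒≱ {0ℤ} {1ℤ} (+<+ (s≤s z≤n)) (ℤ.≤-trans positive
          (balance-≤ two (trans (∣insert∣ x∉R) (cong suc R≡)) (∉insert (≢-sym x≢u) u∉R) (∉insert (≢-sym x≢v) v∉R)))
        where
        x≢u : x ≢ u
        x≢u = proj₁ (private-≢ G Px)
        x≢v : x ≢ v
        x≢v = proj₂ (private-≢ G Px)
        outside-R : All (_∉ R) (privates G v u)
        outside-R = All.map (λ {y} Py _ → absurd Py) (All.all-filter (isPrivate? G v u) (List.allFin n))
          where
          absurd : ∀ {y} → ¬ IsPrivate G v u y
          absurd Py@(y≢u , v~y , _) = proj₂ (proj₂ (uniform (λ ()) (λ ()) Px y≢u (proj₁ (private-≢ G Py)))) v~y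
        positive : 1ℤ ≤ balance G u v (insert x R)
        positive = subst (1ℤ ≤_) (trans (cong (λ t → balance G u v R + t) (sym (adj-private G Px))) (sym (balance-insert G u v x∉R)))
          (ℤ.+-monoˡ-≤ 1ℤ (balance-nonneg G u v u∉R outside-R))

  private
    -- For the sizes x and y of S in a graph and in its complement, whose sum T
    -- does not depend on S.
    reflect : ∀ {T x y p} D → x + y ≡ T → x ≡ p ⊎ x ≡ p + D → y ≡ T - (p + D) ⊎ y ≡ T - (p + D) + D
    reflect {T} {y = y} {p} D x+y≡T (inj₁ refl) = inj₂ (trans (solution p y D) (cong (λ t → t - (p + D) + D) x+y≡T))
      where
      solution : ∀ p y d → y ≡ p + y - (p + d) + d
      solution = solve-∀
    reflect {T} {y = y} {p} D x+y≡T (inj₂ refl) = inj₁ (trans (solution (p + D) y) (cong (λ t → t - (p + D)) x+y≡T))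
      where
      solution : ∀ x y → y ≡ x + y - x
      solution = solve-∀

  module _ {n} (G : Graph n) {c : ℕ} {p : ℤ} {D : ℕ} (c≤n : c ℕ.≤ n) where

    private
      both : Subset n → ℤ
      both S = + inducedSize G S + + inducedSize (complement G) S

      both-constant : ∃ λ T → ∀ S → ∣ S ∣ ≡ c → both S ≡ T
      both-constant = let S₀ , S₀≡c , _ = select c [] [] [] z≤n (ℕ.≤-trans (ℕ.≤-reflexive (ℕ.+-identityʳ c)) c≤n) in
        both S₀ , λ S S≡c → ℤ.*-cancelˡ-≡ (+ 2) (both S) (both S₀)
          (trans (inducedSize+complement G S)
            (trans (cong (λ c → + c * (+ c - 1ℤ)) (trans S≡c (sym S₀≡c))) (sym (inducedSize+complement G S₀))))

    complement-two : TwoValued G c p D → ∃ λ p′ → TwoValued (complement G) c p′ D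
    complement-two two = let T , total = both-constant in
      T - (p + + D) , twoValued λ S S≡c → reflect (+ D) (total S S≡c) (size-values two S S≡c)

    -- Proved separately because `complement (complement G)` is not the graph `G` itself.
    uncomplement-two : TwoValued (complement G) c p D → ∃ λ p′ → TwoValued G c p′ D
    uncomplement-two two = let T , total = both-constant in
      T - (p + + D) , twoValued λ S S≡c → reflect (+ D)
        (trans (ℤ.+-comm (+ inducedSize (complement G) S) (+ inducedSize G S)) (total S S≡c)) (size-values two S S≡c)

  Extremal : ∀ {n} → Graph n → Set
  Extremal G = IsStar G ⊎ IsSingleEdge G ⊎ IsStar (complement G) ⊎ IsSingleEdge (complement G)

  module _ {n} {G : Graph n} (¬complete : ¬ Complete G) (¬cocomplete : ¬ CoComplete G) where

    private
      ¬empty : ∃₂ (Adj G)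
      ¬empty = let u , _ , x , _ , u~x , _ = ∃-private G ¬complete ¬cocomplete in u , x , u~x

      ¬coempty : ∃₂ (Adj (complement G))
      ¬coempty = let _ , v , x , x≢v , _ , v≁x = ∃-private G ¬complete ¬cocomplete in v , x , ≢-sym x≢v , v≁x

    -- For D = 1 the matching alternative may hold in the complement; `complement-two` keeps D, so
    -- `singleEdge` applies there as well. All other D fall under uniformity.
    classification : ∀ {r p D} → r ℕ.+ 8 ℕ.≤ n → TwoValued G (4 ℕ.+ r) p D → Extremal G
    classification {r} {p} {D} r+8≤n two = byD (D ℕ.≟ 1)
      where
      6≤n : 6 ℕ.≤ n
      6≤n = ℕ.≤-trans (ℕ.m≤n+m 6 (2 ℕ.+ r)) (ℕ.≤-trans (ℕ.≤-reflexive (trans (sym (ℕ.+-assoc 2 r 6)) (trans (cong (ℕ._+ 6) (ℕ.+-comm 2 r)) (ℕ.+-assoc r 2 6)))) r+8≤n)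
      c≤n : 4 ℕ.+ r ℕ.≤ n
      c≤n = ℕ.≤-trans (ℕ.≤-trans (ℕ.≤-reflexive (ℕ.+-comm 4 r)) (ℕ.+-monoʳ-≤ r (ℕ.m≤m+n 4 4))) r+8≤n
      byD : Dec (D ≡ 1) → Extremal G
      byD (yes refl) = Sum.[
          (λ matched → inj₂ (inj₁ (singleEdge matched two r+8≤n (proj₂ (proj₂ ¬empty))))) ,
          (λ comatched → inj₂ (inj₂ (inj₂ (singleEdge comatched (proj₂ (complement-two G c≤n two)) r+8≤n (proj₂ (proj₂ ¬coempty)))))) ]
        (matched⊎comatched {G = G} 6≤n (uniquePrivates two r+8≤n refl))
      byD (no D≢1) = Sum.map₂ (inj₂ ∘ inj₁)
        (star⊎costar G (uniform two r+8≤n D≢1 (D≢2 two r+8≤n ¬complete ¬cocomplete))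
          (proj₂ (proj₂ (proj₂ (∃-private G ¬complete ¬cocomplete)))))

    nonconstant : ∀ {r p} → r ℕ.+ 8 ℕ.≤ n → ¬ (∀ S → ∣ S ∣ ≡ 4 ℕ.+ r → + inducedSize G S ≡ p)
    nonconstant {p = p} r+8≤n constant = D≢0 {G = G} {p = p} {0} (twoValued λ S S≡c → inj₁ (constant S S≡c)) r+8≤n ¬complete ¬cocomplete refl

  delete : ∀ {n} {v : Fin n} {S} → v ∈ S → ∃ λ R → v ∉ R × insert v R ≡ S
  delete {v = zero}  {_ ∷ S} here        = outside ∷ S , (λ ()) , refl
  delete {v = suc v} {s ∷ S} (there v∈S) = let R , v∉R , eq = delete v∈S in
    s ∷ R , (λ { (there v∈R) → v∉R v∈R }) , cong (s ∷_) eq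

  module _ {n} {G : Graph n} where

    -- Only membership of the centre matters: a set with it induces a star on k + 1 vertices, a set
    -- without it induces no edge.
    star-two : ∀ {k} → IsStar G → TwoValued G (suc k) 0ℤ k
    star-two {k} (v , star) = twoValued λ S S≡c → counts S S≡c (v ∈? S)
      where
      spoke : ∀ {j} → v ≢ j → Adj G v j
      spoke v≢j = Equivalence.from (star v _) (v≢j , inj₁ refl)
      independent : ∀ {S} → v ∉ S → Independent G S
      independent v∉S i j i∈S j∈S i~j with proj₂ (Equivalence.to (star i j) i~j)
      ... | inj₁ refl = v∉S i∈S
      ... | inj₂ refl = v∉S j∈S
      counts : ∀ S → ∣ S ∣ ≡ suc k → Dec (v ∈ S) → + inducedSize G S ≡ 0ℤ ⊎ + inducedSize G S ≡ 0ℤ + + k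
      counts S S≡c (no v∉S)  = inj₁ (cong +_ (inducedSize-independent G (independent v∉S)))
      counts S S≡c (yes v∈S) = inj₂ (let R , v∉R , eq = delete v∈S in full R v∉R eq S≡c)
        where
        full : ∀ {S} R → v ∉ R → insert v R ≡ S → ∣ S ∣ ≡ suc k → + inducedSize G S ≡ 0ℤ + + k
        full R v∉R refl S≡c = trans (inducedSize-insert G v∉R) (cong₂ _+_
          (cong +_ (inducedSize-independent G (independent v∉R)))
          (trans (degreeIn-all G (λ j∈R → spoke λ { refl → v∉R j∈R })) (cong +_ (ℕ.suc-injective (trans (sym (∣insert∣ v∉R)) S≡c)))))

    singleEdge-two : ∀ {c} → IsSingleEdge G → TwoValued G c 0ℤ 1
    singleEdge-two {c} (x , y , x≢y , edge) = twoValued λ S _ → counts S (x ∈? S) (y ∈? S)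
      where
      independent : ∀ {S} → ¬ (x ∈ S × y ∈ S) → Independent G S
      independent ¬both i j i∈S j∈S i~j with Equivalence.to (edge i j) i~j
      ... | inj₁ (refl , refl) = ¬both (i∈S , j∈S)
      ... | inj₂ (refl , refl) = ¬both (j∈S , i∈S)
      counts : ∀ S → Dec (x ∈ S) → Dec (y ∈ S) → + inducedSize G S ≡ 0ℤ ⊎ + inducedSize G S ≡ 0ℤ + 1ℤ
      counts S (no x∉S) _ = inj₁ (cong +_ (inducedSize-independent G (independent (x∉S ∘ proj₁))))
      counts S (yes _) (no y∉S) = inj₁ (cong +_ (inducedSize-independent G (independent (y∉S ∘ proj₂))))
      counts S (yes x∈S) (yes y∈S) = inj₂ (let R , x∉R , eq = delete x∈S in both R x∉R eq y∈S)
        where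
        neighbour : ∀ j → adj G x j ≡ χ (j Fin.≟ y)
        neighbour j = χ-cong (adj? G x j) (j Fin.≟ y) only (λ { refl → Equivalence.from (edge x y) (inj₁ (refl , refl)) })
          where
          only : ∀ {j} → Adj G x j → j ≡ y
          only {j} x~j with Equivalence.to (edge x j) x~j
          ... | inj₁ (_ , j≡y)   = j≡y
          ... | inj₂ (x≡y , _) = contradiction x≡y x≢y
        both : ∀ {S} R → x ∉ R → insert x R ≡ S → y ∈ S → + inducedSize G S ≡ 0ℤ + 1ℤ
        both R x∉R refl y∈S = trans (inducedSize-insert G x∉R) (cong₂ _+_
          (cong +_ (inducedSize-independent G (independent (x∉R ∘ proj₁))))
          (trans (degreeIn≡∑ G R x) (trans (sum-cong-≗ (λ j → cong (_* ⟦ R ⟧ j) (neighbour j)))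
            (trans (∑-χ≟ ⟦ R ⟧ y) (χ-yes (y ∈? R) y∈R)))))
          where
          y∈R : y ∈ R
          y∈R with ∈insert⁻ y∈S
          ... | inj₁ y≡x = contradiction (sym y≡x) x≢y
          ... | inj₂ y∈R = y∈R

  extremal-two : ∀ {n} {G : Graph n} {k} → suc k ℕ.≤ n → Extremal G → ∃₂ (TwoValued G (suc k))
  extremal-two c≤n (inj₁ star)               = _ , _ , star-two star
  extremal-two c≤n (inj₂ (inj₁ edge))        = _ , _ , singleEdge-two edge
  extremal-two {G = G} c≤n (inj₂ (inj₂ (inj₁ costar))) = let p , two = uncomplement-two G c≤n (star-two costar) in p , _ , two
  extremal-two {G = G} c≤n (inj₂ (inj₂ (inj₂ coedge))) = let p , two = uncomplement-two G c≤n (singleEdge-two coedge) in p , _ , two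

-- Integers among the rationals, division, floor and ceiling.

module Rationals where
  open import Data.Nat using (suc)
  open import Data.Rational using (_+_; _-_; _*_; -_; _≤_; _<_)
  open import Tactic.RingSolver using (solve-∀)

  ℚ-ring : AlmostCommutativeRing 0ℓ 0ℓ
  ℚ-ring = fromCommutativeRing ℚ.+-*-commutativeRing (λ p → dec⇒maybe (0ℚ ℚ.≟ p))

  -- Casts are compared in the unnormalised rationals, where no common factors are cancelled and
  -- arithmetic reduces to integer identities.
  toℚᵘ-fromℤ : ∀ a → toℚᵘ (fromℤ a) ℚᵘ.≃ mkℚᵘ a 0
  toℚᵘ-fromℤ a = ℚ.toℚᵘ-fromℚᵘ (mkℚᵘ a 0)

  fromℤ-+ : ∀ a b → fromℤ (a ℤ.+ b) ≡ fromℤ a + fromℤ b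
  fromℤ-+ a b = ℚ.toℚᵘ-injective (begin
    toℚᵘ (fromℤ (a ℤ.+ b))                 ≈⟨ toℚᵘ-fromℤ (a ℤ.+ b) ⟩
    mkℚᵘ (a ℤ.+ b) 0                       ≈⟨ ℚᵘ.*≡* (identity a b) ⟩
    mkℚᵘ a 0 ℚᵘ.+ mkℚᵘ b 0                 ≈⟨ ℚᵘ.+-cong (toℚᵘ-fromℤ a) (toℚᵘ-fromℤ b) ⟨
    toℚᵘ (fromℤ a) ℚᵘ.+ toℚᵘ (fromℤ b)     ≈⟨ ℚ.toℚᵘ-homo-+ (fromℤ a) (fromℤ b) ⟨
    toℚᵘ (fromℤ a + fromℤ b)               ∎)
    where
    open ℚᵘ.≃-Reasoning
    identity : ∀ a b → (a ℤ.+ b) ℤ.* + 1 ≡ (a ℤ.* + 1 ℤ.+ b ℤ.* + 1) ℤ.* + 1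
    identity = solveℤ-∀

  fromℤ-* : ∀ a b → fromℤ (a ℤ.* b) ≡ fromℤ a * fromℤ b
  fromℤ-* a b = ℚ.toℚᵘ-injective (begin
    toℚᵘ (fromℤ (a ℤ.* b))                 ≈⟨ toℚᵘ-fromℤ (a ℤ.* b) ⟩
    mkℚᵘ (a ℤ.* b) 0                       ≈⟨ ℚᵘ.≃-refl ⟩
    mkℚᵘ a 0 ℚᵘ.* mkℚᵘ b 0                 ≈⟨ ℚᵘ.*-cong (toℚᵘ-fromℤ a) (toℚᵘ-fromℤ b) ⟨
    toℚᵘ (fromℤ a) ℚᵘ.* toℚᵘ (fromℤ b)     ≈⟨ ℚ.toℚᵘ-homo-* (fromℤ a) (fromℤ b) ⟨
    toℚᵘ (fromℤ a * fromℤ b)               ∎)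
    where open ℚᵘ.≃-Reasoning

  fromℤ-neg : ∀ a → fromℤ (ℤ.- a) ≡ - fromℤ a
  fromℤ-neg a = ℚ.toℚᵘ-injective (begin
    toℚᵘ (fromℤ (ℤ.- a))   ≈⟨ toℚᵘ-fromℤ (ℤ.- a) ⟩
    ℚᵘ.- mkℚᵘ a 0          ≈⟨ ℚᵘ.-‿cong (toℚᵘ-fromℤ a) ⟨
    ℚᵘ.- toℚᵘ (fromℤ a)    ≈⟨ ℚ.toℚᵘ-homo‿- (fromℤ a) ⟨
    toℚᵘ (- fromℤ a)       ∎)
    where open ℚᵘ.≃-Reasoning

  fromℤ-- : ∀ a b → fromℤ (a ℤ.- b) ≡ fromℤ a - fromℤ b
  fromℤ-- a b = trans (fromℤ-+ a (ℤ.- b)) (cong (λ r → fromℤ a + r) (fromℤ-neg b))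

  fromℤ-mono-≤ : ∀ {a b} → a ℤ.≤ b → fromℤ a ≤ fromℤ b
  fromℤ-mono-≤ {a} {b} a≤b = ℚ.toℚᵘ-cancel-≤ (begin
    toℚᵘ (fromℤ a)   ≃⟨ toℚᵘ-fromℤ a ⟩
    mkℚᵘ a 0         ≤⟨ ℚᵘ.*≤* (ℤ.*-monoʳ-≤-nonNeg (+ 1) a≤b) ⟩
    mkℚᵘ b 0         ≃⟨ toℚᵘ-fromℤ b ⟨
    toℚᵘ (fromℤ b)   ∎)
    where open ℚᵘ.≤-Reasoning

  fromℤ-mono-< : ∀ {a b} → a ℤ.< b → fromℤ a < fromℤ b
  fromℤ-mono-< {a} {b} a<b = ℚ.toℚᵘ-cancel-< (begin-strict
    toℚᵘ (fromℤ a)   ≃⟨ toℚᵘ-fromℤ a ⟩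
    mkℚᵘ a 0         <⟨ ℚᵘ.*<* (ℤ.*-monoʳ-<-pos (+ 1) a<b) ⟩
    mkℚᵘ b 0         ≃⟨ toℚᵘ-fromℤ b ⟨
    toℚᵘ (fromℤ b)   ∎)
    where open ℚᵘ.≤-Reasoning

  fromℤ-cancel-≤ : ∀ {a b} → fromℤ a ≤ fromℤ b → a ℤ.≤ b
  fromℤ-cancel-≤ {a} {b} a≤b = ℤ.≮⇒≥ λ b<a → ℚ.<-irrefl refl (ℚ.<-≤-trans (fromℤ-mono-< b<a) a≤b)

  fromℤ-cancel-< : ∀ {a b} → fromℤ a < fromℤ b → a ℤ.< b
  fromℤ-cancel-< {a} {b} a<b = ℤ.≰⇒> λ b≤a → ℚ.<-irrefl refl (ℚ.<-≤-trans a<b (fromℤ-mono-≤ b≤a))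

  fromℤ-injective : ∀ {a b} → fromℤ a ≡ fromℤ b → a ≡ b
  fromℤ-injective {a} {b} eq = ℤ.≤-antisym (fromℤ-cancel-≤ {a} {b} (ℚ.≤-reflexive eq)) (fromℤ-cancel-≤ {b} {a} (ℚ.≤-reflexive (sym eq)))

  0≤fromℕ : ∀ k → 0ℚ ≤ fromℕ k
  0≤fromℕ k = fromℤ-mono-≤ {+ 0} {+ k} (ℤ.+≤+ z≤n)

  private
    p≡r+[p-r] : ∀ p r → p ≡ r + (p - r)
    p≡r+[p-r] = solve-∀ ℚ-ring

    p-p≡0 : ∀ p → p - p ≡ 0ℚ
    p-p≡0 = ℚ.+-inverseʳ

  ≤-by-difference : ∀ {p q} → 0ℚ ≤ q - p → p ≤ q
  ≤-by-difference {p} {q} 0≤q-p = subst₂ _≤_ (ℚ.+-identityʳ p) (sym (p≡r+[p-r] q p)) (ℚ.+-monoʳ-≤ p 0≤q-p)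

  <-by-difference : ∀ {p q} → 0ℚ < q - p → p < q
  <-by-difference {p} {q} 0<q-p = subst₂ _<_ (ℚ.+-identityʳ p) (sym (p≡r+[p-r] q p)) (ℚ.+-monoʳ-< p 0<q-p)

  difference-nonneg : ∀ {p q} → p ≤ q → 0ℚ ≤ q - p
  difference-nonneg {p} {q} p≤q = subst (_≤ q - p) (p-p≡0 p) (ℚ.+-monoˡ-≤ (- p) p≤q)

  difference-pos : ∀ {p q} → p < q → 0ℚ < q - p
  difference-pos {p} {q} p<q = subst (_< q - p) (p-p≡0 p) (ℚ.+-monoˡ-< (- p) p<q)

  *-nonneg : ∀ {p q} → 0ℚ ≤ p → 0ℚ ≤ q → 0ℚ ≤ p * q
  *-nonneg {p} {q} 0≤p 0≤q = subst (_≤ p * q) (ℚ.*-zeroˡ q) (ℚ.*-monoʳ-≤-nonNeg q {{ℚ.nonNegative 0≤q}} 0≤p)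

  *-pos : ∀ {p q} → 0ℚ < p → 0ℚ < q → 0ℚ < p * q
  *-pos {p} {q} 0<p 0<q = subst (_< p * q) (ℚ.*-zeroˡ q) (ℚ.*-monoˡ-<-pos q {{ℚ.positive 0<q}} 0<p)

  *-cancelʳ-≤ : ∀ {p q r} → 0ℚ < r → p * r ≤ q * r → p ≤ q
  *-cancelʳ-≤ {r = r} 0<r = ℚ.*-cancelʳ-≤-pos r {{ℚ.positive 0<r}}

  *-cancelʳ-< : ∀ {p q r} → 0ℚ < r → p * r < q * r → p < q
  *-cancelʳ-< {r = r} 0<r = ℚ.*-cancelʳ-<-nonNeg r {{ℚ.nonNegative (ℚ.<⇒≤ 0<r)}}

  *-cancelʳ-≡ : ∀ {p q r} → 0ℚ < r → p * r ≡ q * r → p ≡ q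
  *-cancelʳ-≡ 0<r eq = ℚ.≤-antisym (*-cancelʳ-≤ 0<r (ℚ.≤-reflexive eq)) (*-cancelʳ-≤ 0<r (ℚ.≤-reflexive (sym eq)))

  -- Divisions are removed by multiplying with a positive divisor; later facts about `⟋` come down
  -- to this equation.
  ⟋-* : ∀ p {q} → 0ℚ < q → (p ⟋ q) * q ≡ p
  ⟋-* p {q} 0<q with q ℚ.≟ 0ℚ
  ... | yes refl = contradiction 0<q (ℚ.<-irrefl refl)
  ... | no q≢0   = begin
    p * (ℚ.1/ q) {{q≠0}} * q       ≡⟨ ℚ.*-assoc p ((ℚ.1/ q) {{q≠0}}) q ⟩
    p * ((ℚ.1/ q) {{q≠0}} * q)     ≡⟨ cong (p *_) (ℚ.*-inverseˡ q {{q≠0}}) ⟩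
    p * 1ℚ                         ≡⟨ ℚ.*-identityʳ p ⟩
    p                              ∎
    where
    open ≡-Reasoning
    q≠0 : ℚ.NonZero q
    q≠0 = ℚ.≢-nonZero q≢0

  ⟋-nonneg : ∀ {p q} → 0ℚ ≤ p → 0ℚ < q → 0ℚ ≤ p ⟋ q
  ⟋-nonneg {p} {q} 0≤p 0<q = *-cancelʳ-≤ 0<q (subst₂ _≤_ (sym (ℚ.*-zeroˡ q)) (sym (⟋-* p 0<q)) 0≤p)

  -- Since a < (a / d + 1) d for the divisor d, cancelling the divisor gives k < a / d + 1.
  /-greatest : ∀ {k a} d → k ℤ.* + suc d ℤ.≤ a → k ℤ.≤ a ℤ./ + suc d
  /-greatest {k} {a} d k*d≤a = subst₂ ℤ._≤_ refl (sym (ℤ.div-pos-is-/ℕ a (suc d)))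
    (subst (k ℤ.≤_) (ℤ.pred-suc (a ℤ./ℕ suc d))
      (ℤ.i<j⇒i≤pred[j] {k} {ℤ.suc (a ℤ./ℕ suc d)} (ℤ.*-cancelʳ-<-nonNeg (+ suc d) (ℤ.≤-<-trans k*d≤a (ℤ.n<s[n/ℕd]*d a (suc d))))))

  floor-greatest : ∀ {k p} → fromℤ k ≤ p → k ℤ.≤ floor p
  floor-greatest {k} {mkℚ a d _} k≤p = /-greatest d (subst (k ℤ.* + suc d ℤ.≤_) (ℤ.*-identityʳ a)
    (ℚᵘ.drop-*≤* (ℚᵘ.≤-respˡ-≃ (toℚᵘ-fromℤ k) (ℚ.toℚᵘ-mono-≤ k≤p))))

  floor-≤ : ∀ p → fromℤ (floor p) ≤ p
  floor-≤ p@(mkℚ a d _) = ℚ.toℚᵘ-cancel-≤ (ℚᵘ.≤-respˡ-≃ (ℚᵘ.≃-sym (toℚᵘ-fromℤ (floor p)))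
    (ℚᵘ.*≤* (subst (floor p ℤ.* + suc d ℤ.≤_) (sym (ℤ.*-identityʳ a)) (ℤ.[n/d]*d≤n a (+ suc d)))))

  ceiling≡-floor- : ∀ p → ceiling p ≡ ℤ.- floor (- p)
  ceiling≡-floor- (mkℚ _ _ _) = refl

  ceiling-least : ∀ {k p} → p ≤ fromℤ k → ceiling p ℤ.≤ k
  ceiling-least {k} {p} p≤k = subst₂ ℤ._≤_ (sym (ceiling≡-floor- p)) (ℤ.neg-involutive k)
    (ℤ.neg-mono-≤ (floor-greatest (subst (_≤ - p) (sym (fromℤ-neg k)) (ℚ.neg-antimono-≤ p≤k))))

  ceiling-nonneg : ∀ {p} → 0ℚ ≤ p → + 0 ℤ.≤ ceiling p
  ceiling-nonneg {p} 0≤p = subst (+ 0 ℤ.≤_) (sym (ceiling≡-floor- p))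
    (ℤ.neg-mono-≤ (fromℤ-cancel-≤ {floor (- p)} {+ 0} (ℚ.≤-trans (floor-≤ (- p)) (ℚ.neg-antimono-≤ 0≤p))))

  -- Links the rational bounds to the arithmetic of the machine. The fraction a / b need not be in
  -- lowest terms, so any positive common denominator will do.
  floor≡quotient : ∀ {q a b} → + 0 ℤ.< b → q * fromℤ b ≡ fromℤ a → floor q ≡ quotient a b
  floor≡quotient {q} {a} {b@(+ suc d)} 0<b q*b≡a = ℤ.≤-antisym
    (/-greatest d (fromℤ-cancel-≤ {floor q ℤ.* b} {a} (subst₂ _≤_ (sym (fromℤ-* (floor q) b)) q*b≡a
      (ℚ.*-monoʳ-≤-nonNeg (fromℤ b) {{ℚ.nonNegative (ℚ.<⇒≤ 0<bℚ)}} (floor-≤ q)))))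
    (floor-greatest (*-cancelʳ-≤ {fromℤ (a ℤ./ b)} {q} 0<bℚ (subst₂ _≤_ (fromℤ-* (a ℤ./ b) b) (sym q*b≡a)
      (fromℤ-mono-≤ {a ℤ./ b ℤ.* b} {a} (ℤ.[n/d]*d≤n a b)))))
    where
    0<bℚ : 0ℚ < fromℤ b
    0<bℚ = fromℤ-mono-< {+ 0} {b} 0<b
  floor≡quotient {b = + 0} (ℤ.+<+ ())

-- Means over finite lists.

module Means where
  open Rationals
  open import Data.Fin.Subset using (∣_∣)
  open import Data.List using ([]; _∷_; map)
  open import Data.List.Relation.Unary.Any using (here; there)
  open import Data.Nat using (suc)
  open import Data.Rational using (_+_; _*_; _≤_; _<_)
  open import Data.Vec using ([]; _∷_)
  open import Tactic.RingSolver using (solve-∀)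

  -- `𝔼 n c` is by definition the mean over `subsetsOfSize n c`; the general form keeps graphs out
  -- of the inequality.
  mean : ∀ {a} {A : Set a} → List A → (A → ℚ) → ℚ
  mean xs X = sum (map X xs) ⟋ fromℕ (length xs)

  module _ {a} {A : Set a} where

    private
      ∑ : List A → (A → ℚ) → ℚ
      ∑ xs X = sum (map X xs)

    sum-+ : ∀ (X Y : A → ℚ) xs → ∑ xs (λ x → X x + Y x) ≡ ∑ xs X + ∑ xs Y
    sum-+ X Y []       = sym (ℚ.+-identityˡ 0ℚ)
    sum-+ X Y (x ∷ xs) = trans (cong (λ s → X x + Y x + s) (sum-+ X Y xs)) (regroup (X x) (Y x) (∑ xs X) (∑ xs Y))
      where
      regroup : ∀ a b c d → a + b + (c + d) ≡ a + c + (b + d)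
      regroup = solve-∀ ℚ-ring

    sum-* : ∀ k (X : A → ℚ) xs → ∑ xs (λ x → k * X x) ≡ k * ∑ xs X
    sum-* k X []       = sym (ℚ.*-zeroʳ k)
    sum-* k X (x ∷ xs) = trans (cong (λ s → k * X x + s) (sum-* k X xs)) (sym (ℚ.*-distribˡ-+ k (X x) (∑ xs X)))

    sum-const : ∀ k xs → ∑ xs (λ _ → k) ≡ k * fromℕ (length xs)
    sum-const k []       = sym (ℚ.*-zeroʳ k)
    sum-const k (x ∷ xs) = begin
      k + ∑ xs (λ _ → k)                      ≡⟨ cong (λ s → k + s) (sum-const k xs) ⟩
      k + k * fromℕ (length xs)               ≡⟨ factor k (fromℕ (length xs)) ⟩
      k * (1ℚ + fromℕ (length xs))            ≡⟨ cong (k *_) (fromℤ-+ (+ 1) (+ length xs)) ⟨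
      k * fromℕ (suc (length xs))             ∎
      where
      open ≡-Reasoning
      factor : ∀ k l → k + k * l ≡ k * (1ℚ + l)
      factor = solve-∀ ℚ-ring

    sum-cong : ∀ {X Y : A → ℚ} xs → (∀ {x} → x ∈ₗ xs → X x ≡ Y x) → ∑ xs X ≡ ∑ xs Y
    sum-cong []       X≡Y = refl
    sum-cong (x ∷ xs) X≡Y = cong₂ _+_ (X≡Y (here refl)) (sum-cong xs (X≡Y ∘ there))

    sum-nonneg : ∀ {X : A → ℚ} xs → (∀ {x} → x ∈ₗ xs → 0ℚ ≤ X x) → 0ℚ ≤ ∑ xs X
    sum-nonneg []       0≤X = ℚ.≤-refl
    sum-nonneg (x ∷ xs) 0≤X = ℚ.+-mono-≤ (0≤X (here refl)) (sum-nonneg xs (0≤X ∘ there))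

    sum-pos : ∀ {X : A → ℚ} {x} xs → (∀ {x} → x ∈ₗ xs → 0ℚ ≤ X x) → x ∈ₗ xs → 0ℚ < X x → 0ℚ < ∑ xs X
    sum-pos (x ∷ xs) 0≤X (here refl) 0<X = ℚ.+-mono-<-≤ 0<X (sum-nonneg xs (0≤X ∘ there))
    sum-pos (x ∷ xs) 0≤X (there x∈)  0<X = ℚ.+-mono-≤-< (0≤X (here refl)) (sum-pos xs (0≤X ∘ there) x∈ 0<X)

    module _ (xs : List A) (nonempty : 0 ℕ.< length xs) where
      private
        0<N : 0ℚ < fromℕ (length xs)
        0<N = fromℤ-mono-< {+ 0} {+ length xs} (ℤ.+<+ nonempty)

      mean-* : ∀ X → mean xs X * fromℕ (length xs) ≡ ∑ xs X
      mean-* X = ⟋-* (∑ xs X) 0<N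

      mean-unique : ∀ {X m} → ∑ xs X ≡ m * fromℕ (length xs) → mean xs X ≡ m
      mean-unique {X} eq = *-cancelʳ-≡ 0<N (trans (mean-* X) eq)

      mean-+ : ∀ X Y → mean xs (λ x → X x + Y x) ≡ mean xs X + mean xs Y
      mean-+ X Y = mean-unique (trans (sum-+ X Y xs)
        (trans (sym (cong₂ _+_ (mean-* X) (mean-* Y))) (sym (ℚ.*-distribʳ-+ (fromℕ (length xs)) (mean xs X) (mean xs Y)))))

      mean-scale : ∀ k X → mean xs (λ x → k * X x) ≡ k * mean xs X
      mean-scale k X = mean-unique (trans (sum-* k X xs)
        (trans (cong (k *_) (sym (mean-* X))) (sym (ℚ.*-assoc k (mean xs X) (fromℕ (length xs))))))

      mean-const : ∀ k → mean xs (λ _ → k) ≡ k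
      mean-const k = mean-unique (sum-const k xs)

      mean-nonneg : ∀ {X} → (∀ {x} → x ∈ₗ xs → 0ℚ ≤ X x) → 0ℚ ≤ mean xs X
      mean-nonneg {X} 0≤X = *-cancelʳ-≤ 0<N (subst₂ _≤_ (sym (ℚ.*-zeroˡ (fromℕ (length xs)))) (sym (mean-* X)) (sum-nonneg xs 0≤X))

      mean-pos : ∀ {X x} → (∀ {x} → x ∈ₗ xs → 0ℚ ≤ X x) → x ∈ₗ xs → 0ℚ < X x → 0ℚ < mean xs X
      mean-pos {X} 0≤X x∈ 0<X = *-cancelʳ-< 0<N (subst₂ _<_ (sym (ℚ.*-zeroˡ (fromℕ (length xs)))) (sym (mean-* X)) (sum-pos xs 0≤X x∈ 0<X))

      -- The source of the equality cases: one positive value would already make the mean positive.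
      mean-zero : ∀ {X x} → (∀ {x} → x ∈ₗ xs → 0ℚ ≤ X x) → mean xs X ≡ 0ℚ → x ∈ₗ xs → X x ≡ 0ℚ
      mean-zero {X} {x} 0≤X mean≡0 x∈ with ℚ.<-cmp 0ℚ (X x)
      ... | tri< 0<X _ _ = contradiction (mean-pos 0≤X x∈ 0<X) (ℚ.<-irrefl (sym mean≡0))
      ... | tri≈ _ 0≡X _ = sym 0≡X
      ... | tri> _ _ X<0 = contradiction X<0 (λ X<0 → ℚ.<-irrefl refl (ℚ.<-≤-trans X<0 (0≤X x∈)))

    mean-cong : ∀ {X Y : A → ℚ} xs → (∀ {x} → x ∈ₗ xs → X x ≡ Y x) → mean xs X ≡ mean xs Y
    mean-cong xs X≡Y = cong (_⟋ fromℕ (length xs)) (sum-cong xs X≡Y)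

  ∈subsets : ∀ {n} (S : Subset n) → S ∈ₗ subsets n
  ∈subsets []                    = here refl
  ∈subsets (inside ∷ S)          = ∈ₗ.∈-++⁺ˡ (∈ₗ.∈-map⁺ (inside ∷_) (∈subsets S))
  ∈subsets {suc n} (outside ∷ S) = ∈ₗ.∈-++⁺ʳ (map (inside ∷_) (subsets n)) (∈ₗ.∈-map⁺ (outside ∷_) (∈subsets S))

  ∈subsetsOfSize⁺ : ∀ {n c} {S : Subset n} → ∣ S ∣ ≡ c → S ∈ₗ subsetsOfSize n c
  ∈subsetsOfSize⁺ {c = c} {S} S≡c = ∈ₗ.∈-filter⁺ (λ S → ∣ S ∣ ℕ.≟ c) (∈subsets S) S≡c

  ∈subsetsOfSize⁻ : ∀ {n c} {S : Subset n} → S ∈ₗ subsetsOfSize n c → ∣ S ∣ ≡ c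
  ∈subsetsOfSize⁻ {n} {c} S∈ = proj₂ (∈ₗ.∈-filter⁻ (λ S → ∣ S ∣ ℕ.≟ c) {xs = subsets n} S∈)

-- The Bhatia-Davis inequality and its equality case.

module BhatiaDavis where
  open Rationals
  open Means
  open import Data.Rational using (_+_; _-_; _*_; -_; _≤_; _<_)
  open import Tactic.RingSolver using (solve-∀)
  open ≡-Reasoning

  ≤∧≢⇒< : ∀ {p q} → p ≤ q → p ≢ q → p < q
  ≤∧≢⇒< {p} {q} p≤q p≢q with ℚ.<-cmp p q
  ... | tri< p<q _ _ = p<q
  ... | tri≈ _ p≡q _ = contradiction p≡q p≢q
  ... | tri> _ _ q<p = contradiction q<p (λ q<p → ℚ.<-irrefl refl (ℚ.<-≤-trans q<p p≤q))

  square-nonneg : ∀ p → 0ℚ ≤ p * p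
  square-nonneg p with ℚ.≤-total 0ℚ p
  ... | inj₁ 0≤p = *-nonneg 0≤p 0≤p
  ... | inj₂ p≤0 = subst (0ℚ ≤_) (neg-square p) (*-nonneg (ℚ.neg-antimono-≤ p≤0) (ℚ.neg-antimono-≤ p≤0))
    where
    neg-square : ∀ p → - p * - p ≡ p * p
    neg-square = solve-∀ ℚ-ring

  square-pos : ∀ {p} → p ≢ 0ℚ → 0ℚ < p * p
  square-pos {p} p≢0 with ℚ.<-cmp 0ℚ (p * p)
  ... | tri< 0<p² _ _ = 0<p²
  ... | tri> _ _ p²<0 = contradiction p²<0 (λ p²<0 → ℚ.<-irrefl refl (ℚ.<-≤-trans p²<0 (square-nonneg p)))
  ... | tri≈ _ 0≡p² _ with ℚ.<-cmp 0ℚ p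
  ...   | tri< 0<p _ _ = *-pos 0<p 0<p
  ...   | tri≈ _ 0≡p _ = contradiction (sym 0≡p) p≢0
  ...   | tri> _ _ p<0 = subst (0ℚ <_) (neg-square p) (*-pos (ℚ.neg-antimono-< p<0) (ℚ.neg-antimono-< p<0))
    where
    neg-square : ∀ p → - p * - p ≡ p * p
    neg-square = solve-∀ ℚ-ring

  -- If both factors were nonzero, p²q² would be positive, although it is a multiple of pq = 0.
  -- Squares avoid a distinction by signs.
  *-zero : ∀ {p q} → p * q ≡ 0ℚ → p ≡ 0ℚ ⊎ q ≡ 0ℚ
  *-zero {p} {q} pq≡0 with p ℚ.≟ 0ℚ | q ℚ.≟ 0ℚ
  ... | yes p≡0 | _       = inj₁ p≡0
  ... | no _    | yes q≡0 = inj₂ q≡0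
  ... | no p≢0  | no q≢0  = contradiction (*-pos (square-pos p≢0) (square-pos q≢0))
    (ℚ.<-irrefl (sym (trans (interchange p q) (trans (cong (_* (p * q)) pq≡0) (ℚ.*-zeroˡ (p * q))))))
    where
    interchange : ∀ p q → p * p * (q * q) ≡ p * q * (p * q)
    interchange = solve-∀ ℚ-ring

  module _ {a} {A : Set a} (xs : List A) (nonempty : 0 ℕ.< length xs) (X : A → ℚ) where

    private
      μ v : ℚ
      μ = mean xs X
      v = mean xs (λ x → (X x - μ) * (X x - μ))

    mean-affine : ∀ p q → mean xs (λ x → p * X x + q) ≡ p * μ + q
    mean-affine p q = trans (mean-+ xs nonempty (λ x → p * X x) (λ _ → q))
      (cong₂ _+_ (mean-scale xs nonempty p X) (mean-const xs nonempty q))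

    -- Expanding about μ writes the product as minus the squared deviation plus an affine function
    -- of X, whose means are known.
    mean-product : ∀ a b → mean xs (λ x → (X x - a) * (b - X x)) ≡ (μ - a) * (b - μ) - v
    mean-product a b = begin
      mean xs (λ x → (X x - a) * (b - X x))
        ≡⟨ mean-cong xs (λ {x} _ → expand (X x) μ a b) ⟩
      mean xs (λ x → - 1ℚ * ((X x - μ) * (X x - μ)) + ((a + b - (μ + μ)) * X x + (μ * μ - a * b)))
        ≡⟨ mean-+ xs nonempty (λ x → - 1ℚ * ((X x - μ) * (X x - μ))) (λ x → (a + b - (μ + μ)) * X x + (μ * μ - a * b)) ⟩
      mean xs (λ x → - 1ℚ * ((X x - μ) * (X x - μ))) + mean xs (λ x → (a + b - (μ + μ)) * X x + (μ * μ - a * b))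
        ≡⟨ cong₂ _+_ (mean-scale xs nonempty (- 1ℚ) (λ x → (X x - μ) * (X x - μ))) (mean-affine (a + b - (μ + μ)) (μ * μ - a * b)) ⟩
      - 1ℚ * v + ((a + b - (μ + μ)) * μ + (μ * μ - a * b))
        ≡⟨ collect v μ a b ⟩
      (μ - a) * (b - μ) - v
        ∎
      where
      expand : ∀ x μ a b → (x - a) * (b - x) ≡ - 1ℚ * ((x - μ) * (x - μ)) + ((a + b - (μ + μ)) * x + (μ * μ - a * b))
      expand = solve-∀ ℚ-ring
      collect : ∀ v μ a b → - 1ℚ * v + ((a + b - (μ + μ)) * μ + (μ * μ - a * b)) ≡ (μ - a) * (b - μ) - v
      collect = solve-∀ ℚ-ring

    -- (X - 0) (1 - X) = - X (X - 1).
    variance-formula : v ≡ fromℕ 2 * (½ * mean xs (λ x → X x * (X x - 1ℚ))) - μ * (μ - 1ℚ)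
    variance-formula = begin
      v
        ≡⟨ isolate v μ ⟩
      - 1ℚ * ((μ - 0ℚ) * (1ℚ - μ) - v) - μ * (μ - 1ℚ)
        ≡⟨ cong (λ m → - 1ℚ * m - μ * (μ - 1ℚ)) (mean-product 0ℚ 1ℚ) ⟨
      - 1ℚ * mean xs (λ x → (X x - 0ℚ) * (1ℚ - X x)) - μ * (μ - 1ℚ)
        ≡⟨ cong (λ m → m - μ * (μ - 1ℚ)) (mean-scale xs nonempty (- 1ℚ) (λ x → (X x - 0ℚ) * (1ℚ - X x))) ⟨
      mean xs (λ x → - 1ℚ * ((X x - 0ℚ) * (1ℚ - X x))) - μ * (μ - 1ℚ)
        ≡⟨ cong (λ m → m - μ * (μ - 1ℚ)) (mean-cong xs (λ {x} _ → flip (X x))) ⟩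
      m₂ - μ * (μ - 1ℚ)
        ≡⟨ cong (λ m → m - μ * (μ - 1ℚ)) (trans (sym (ℚ.*-assoc (fromℕ 2) ½ m₂)) (ℚ.*-identityˡ m₂)) ⟨
      fromℕ 2 * (½ * m₂) - μ * (μ - 1ℚ)
        ∎
      where
      m₂ : ℚ
      m₂ = mean xs (λ x → X x * (X x - 1ℚ))
      isolate : ∀ v μ → v ≡ - 1ℚ * ((μ - 0ℚ) * (1ℚ - μ) - v) - μ * (μ - 1ℚ)
      isolate = solve-∀ ℚ-ring
      flip : ∀ x → - 1ℚ * ((x - 0ℚ) * (1ℚ - x)) ≡ x * (x - 1ℚ)
      flip = solve-∀ ℚ-ring

    module _ {a : ℚ} (a<μ : a < μ) (b : ℚ) where

      -- As μ - a is positive, the gap between `b` and the bound has the sign of the mean product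
      -- and vanishes exactly with it. So one equation yields the bound and its equality case.
      upper-gap : (b - (μ + v ⟋ (μ - a))) * (μ - a) ≡ mean xs (λ x → (X x - a) * (b - X x))
      upper-gap = begin
        (b - (μ + v ⟋ (μ - a))) * (μ - a)                 ≡⟨ distribute b μ (v ⟋ (μ - a)) (μ - a) ⟩
        (μ - a) * (b - μ) - v ⟋ (μ - a) * (μ - a)         ≡⟨ cong (λ w → (μ - a) * (b - μ) - w) (⟋-* v (difference-pos a<μ)) ⟩
        (μ - a) * (b - μ) - v                             ≡⟨ mean-product a b ⟨
        mean xs (λ x → (X x - a) * (b - X x))             ∎
        where
        distribute : ∀ b μ w d → (b - (μ + w)) * d ≡ d * (b - μ) - w * d
        distribute = solve-∀ ℚ-ring

    module _ {b : ℚ} (μ<b : μ < b) (a : ℚ) where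

      lower-gap : (μ - v ⟋ (b - μ) - a) * (b - μ) ≡ mean xs (λ x → (X x - a) * (b - X x))
      lower-gap = begin
        (μ - v ⟋ (b - μ) - a) * (b - μ)                   ≡⟨ distribute a μ (v ⟋ (b - μ)) (b - μ) ⟩
        (μ - a) * (b - μ) - v ⟋ (b - μ) * (b - μ)         ≡⟨ cong (λ w → (μ - a) * (b - μ) - w) (⟋-* v (difference-pos μ<b)) ⟩
        (μ - a) * (b - μ) - v                             ≡⟨ mean-product a b ⟨
        mean xs (λ x → (X x - a) * (b - X x))             ∎
        where
        distribute : ∀ a μ w d → (μ - w - a) * d ≡ (μ - a) * d - w * d
        distribute = solve-∀ ℚ-ring

    module _ {a b : ℚ} (a≤X : ∀ {x} → x ∈ₗ xs → a ≤ X x) (X≤b : ∀ {x} → x ∈ₗ xs → X x ≤ b) where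

      private
        product-nonneg : ∀ {x} → x ∈ₗ xs → 0ℚ ≤ (X x - a) * (b - X x)
        product-nonneg x∈ = *-nonneg (difference-nonneg (a≤X x∈)) (difference-nonneg (X≤b x∈))

        difference-zero : ∀ {p q} → p - q ≡ 0ℚ → p ≡ q
        difference-zero {p} {q} p-q≡0 = trans (sym (cancel p q)) (trans (cong (_+ q) p-q≡0) (ℚ.+-identityˡ q))
          where
          cancel : ∀ p q → p - q + q ≡ p
          cancel = solve-∀ ℚ-ring

        two-valued : ∀ {x} → x ∈ₗ xs → mean xs (λ x → (X x - a) * (b - X x)) ≡ 0ℚ → X x ≡ a ⊎ X x ≡ b
        two-valued {x} x∈ m≡0 with *-zero (mean-zero xs nonempty {X = λ x → (X x - a) * (b - X x)} product-nonneg m≡0 x∈)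
        ... | inj₁ X-a≡0 = inj₁ (difference-zero X-a≡0)
        ... | inj₂ b-X≡0 = inj₂ (sym (difference-zero b-X≡0))

        mean-product-zero : (∀ {x} → x ∈ₗ xs → X x ≡ a ⊎ X x ≡ b) → mean xs (λ x → (X x - a) * (b - X x)) ≡ 0ℚ
        mean-product-zero values = trans (mean-cong xs (λ x∈ → vanish (values x∈))) (mean-const xs nonempty 0ℚ)
          where
          vanish : ∀ {x} → x ≡ a ⊎ x ≡ b → (x - a) * (b - x) ≡ 0ℚ
          vanish (inj₁ refl) = left a b
            where
            left : ∀ a b → (a - a) * (b - a) ≡ 0ℚ
            left = solve-∀ ℚ-ring
          vanish (inj₂ refl) = right a b
            where
            right : ∀ a b → (b - a) * (b - b) ≡ 0ℚ
            right = solve-∀ ℚ-ring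

      module _ (a<μ : a < μ) where

        max-≥ : μ + v ⟋ (μ - a) ≤ b
        max-≥ = ≤-by-difference (*-cancelʳ-≤ (difference-pos a<μ)
          (subst₂ _≤_ (sym (ℚ.*-zeroˡ (μ - a))) (sym (upper-gap a<μ b)) (mean-nonneg xs nonempty product-nonneg)))

        max-tight : b ≡ μ + v ⟋ (μ - a) → ∀ {x} → x ∈ₗ xs → X x ≡ a ⊎ X x ≡ b
        max-tight eq x∈ = two-valued x∈ (trans (sym (upper-gap a<μ b))
          (trans (cong (λ t → (b - t) * (μ - a)) (sym eq)) (trans (cong (_* (μ - a)) (ℚ.+-inverseʳ b)) (ℚ.*-zeroˡ (μ - a)))))

        max-attained : (∀ {x} → x ∈ₗ xs → X x ≡ a ⊎ X x ≡ b) → b ≡ μ + v ⟋ (μ - a)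
        max-attained values = difference-zero (*-cancelʳ-≡ (difference-pos a<μ)
          (trans (upper-gap a<μ b) (trans (mean-product-zero values) (sym (ℚ.*-zeroˡ (μ - a))))))

      module _ (μ<b : μ < b) where

        min-≤ : a ≤ μ - v ⟋ (b - μ)
        min-≤ = ≤-by-difference (*-cancelʳ-≤ (difference-pos μ<b)
          (subst₂ _≤_ (sym (ℚ.*-zeroˡ (b - μ))) (sym (lower-gap μ<b a)) (mean-nonneg xs nonempty product-nonneg)))

        min-tight : a ≡ μ - v ⟋ (b - μ) → ∀ {x} → x ∈ₗ xs → X x ≡ a ⊎ X x ≡ b
        min-tight eq x∈ = two-valued x∈ (trans (sym (lower-gap μ<b a))
          (trans (cong (λ t → (t - a) * (b - μ)) (sym eq)) (trans (cong (_* (b - μ)) (ℚ.+-inverseʳ a)) (ℚ.*-zeroˡ (b - μ)))))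

        min-attained : (∀ {x} → x ∈ₗ xs → X x ≡ a ⊎ X x ≡ b) → a ≡ μ - v ⟋ (b - μ)
        min-attained values = sym (difference-zero (*-cancelʳ-≡ (difference-pos μ<b)
          (trans (lower-gap μ<b a) (trans (mean-product-zero values) (sym (ℚ.*-zeroˡ (b - μ)))))))

      mean-> : ∀ {x} → x ∈ₗ xs → X x ≢ a → a < μ
      mean-> {x} x∈ X≢a = <-by-difference (subst (0ℚ <_)
        (trans (mean-cong xs (λ {x} _ → unscale (X x) a)) (trans (mean-affine 1ℚ (- a)) (cong (_+ - a) (ℚ.*-identityˡ μ))))
        (mean-pos xs nonempty (λ x∈ → difference-nonneg (a≤X x∈)) x∈ (difference-pos (≤∧≢⇒< (a≤X x∈) (λ a≡X → X≢a (sym a≡X))))))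
        where
        unscale : ∀ x a → x - a ≡ 1ℚ * x + - a
        unscale = solve-∀ ℚ-ring

      mean-< : ∀ {x} → x ∈ₗ xs → X x ≢ b → μ < b
      mean-< {x} x∈ X≢b = <-by-difference (subst (0ℚ <_)
        (trans (mean-cong xs (λ {x} _ → unscale (X x) b)) (trans (mean-affine (- 1ℚ) b) (rescale μ b)))
        (mean-pos xs nonempty (λ x∈ → difference-nonneg (X≤b x∈)) x∈ (difference-pos (≤∧≢⇒< (X≤b x∈) X≢b))))
        where
        unscale : ∀ x b → b - x ≡ - 1ℚ * x + b
        unscale = solve-∀ ℚ-ring
        rescale : ∀ x b → - 1ℚ * x + b ≡ b - x
        rescale = solve-∀ ℚ-ring

-- The extreme sizes, and the consequences of an independent set.

module Extremes where
  open InducedSizes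
  open Selections
  open Balances using (TwoValued; size-values)
  open Degrees
  open Classification
  open Means
  open import Data.Fin using (zero; suc)
  open import Data.Fin.Subset using (∣_∣)
  open import Data.List using ([]; _∷_)
  open import Data.List.Extrema.Nat using (max)
  open import Data.List.Relation.Unary.All using ([])
  open import Data.List.Relation.Unary.Any using (here; there)
  open import Data.Nat using (zero; suc; _+_; _≤_; _<_)
  open import Data.Nat.Properties
  open import Data.Vec using (_∷_; here; there)

  minimum-≤ : ∀ {k ks} → k ∈ₗ ks → minimum ks ≤ k
  minimum-≤ {ks = j ∷ ks} (here refl) = min≤⊤ j ks
  minimum-≤ {ks = j ∷ ks} (there k∈)  = All.lookup (min≤xs j ks) k∈

  minimum-∈ : ∀ {k ks} → k ∈ₗ ks → minimum ks ∈ₗ ks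
  minimum-∈ {ks = j ∷ ks} _ with argmin-sel id j ks
  ... | inj₁ ≡j = here ≡j
  ... | inj₂ ∈ks = there ∈ks

  maximum-∈ : ∀ {k ks} → k ∈ₗ ks → max 0 ks ∈ₗ ks
  maximum-∈ {k} {ks} k∈ with argmax-sel id 0 ks
  ... | inj₂ ∈ks = ∈ks
  -- The maximum is the default 0, so the listed `k` is at most 0 and hence itself that maximum.
  ... | inj₁ ≡0  = subst (_∈ₗ ks) (sym (trans ≡0 (sym (n≤0⇒n≡0 (subst (k ≤_) ≡0 (All.lookup (xs≤max 0 ks) k∈)))))) k∈

  module _ {n} (G : Graph n) {c : ℕ} where

    ∈values : ∀ S → ∣ S ∣ ≡ c → inducedSize G S ∈ₗ values G c
    ∈values S S≡c = ∈ₗ.∈-map⁺ (inducedSize G) (∈subsetsOfSize⁺ {S = S} S≡c)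

    values⁻ : ∀ {k} → k ∈ₗ values G c → ∃ λ S → ∣ S ∣ ≡ c × k ≡ inducedSize G S
    values⁻ k∈ = let S , S∈ , eq = ∈ₗ.∈-map⁻ (inducedSize G) k∈ in S , ∈subsetsOfSize⁻ {S = S} S∈ , eq

    ℓ-≤ : ∀ S → ∣ S ∣ ≡ c → ℓ G c ≤ inducedSize G S
    ℓ-≤ S S≡c = minimum-≤ (∈values S S≡c)

    ≤-u : ∀ S → ∣ S ∣ ≡ c → inducedSize G S ≤ u G c
    ≤-u S S≡c = All.lookup (xs≤max 0 (values G c)) (∈values S S≡c)

    module _ (c≤n : c ≤ n) where

      some-subset : ∃ λ (S : Subset n) → ∣ S ∣ ≡ c
      some-subset = let S , S≡c , _ = select c [] [] [] z≤n (≤-trans (≤-reflexive (+-identityʳ c)) c≤n) in S , S≡c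

      ℓ-attained : ∃ λ S → ∣ S ∣ ≡ c × ℓ G c ≡ inducedSize G S
      ℓ-attained = values⁻ (minimum-∈ (∈values (proj₁ some-subset) (proj₂ some-subset)))

      u-attained : ∃ λ S → ∣ S ∣ ≡ c × u G c ≡ inducedSize G S
      u-attained = values⁻ (maximum-∈ (∈values (proj₁ some-subset) (proj₂ some-subset)))

      subsets-nonempty : 0 < length (subsetsOfSize n c)
      subsets-nonempty = ∈ₗ.∈-length (∈subsetsOfSize⁺ {S = proj₁ some-subset} (proj₂ some-subset))

      -- Two different attained sizes must be the two permitted ones. This replaces the anonymous
      -- `p` and `p + D` by ℓ and u.
      two-values : ∀ {p D} → TwoValued G c p D → ∀ S₁ S₂ → ∣ S₁ ∣ ≡ c → ∣ S₂ ∣ ≡ c → inducedSize G S₁ ≢ inducedSize G S₂ →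
        ∀ S → ∣ S ∣ ≡ c → inducedSize G S ≡ inducedSize G S₁ ⊎ inducedSize G S ≡ inducedSize G S₂
      two-values two S₁ S₂ S₁≡c S₂≡c distinct S S≡c =
        choose (size-values two S S≡c) (size-values two S₁ S₁≡c) (size-values two S₂ S₂≡c)
        where
        choose : ∀ {p q} → + inducedSize G S ≡ p ⊎ + inducedSize G S ≡ q →
          + inducedSize G S₁ ≡ p ⊎ + inducedSize G S₁ ≡ q → + inducedSize G S₂ ≡ p ⊎ + inducedSize G S₂ ≡ q →
          inducedSize G S ≡ inducedSize G S₁ ⊎ inducedSize G S ≡ inducedSize G S₂
        choose (inj₁ x) (inj₁ y) _        = inj₁ (ℤ.+-injective (trans x (sym y)))
        choose (inj₂ x) (inj₂ y) _        = inj₁ (ℤ.+-injective (trans x (sym y)))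
        choose (inj₁ x) (inj₂ _) (inj₁ z) = inj₂ (ℤ.+-injective (trans x (sym z)))
        choose (inj₂ x) (inj₁ _) (inj₂ z) = inj₂ (ℤ.+-injective (trans x (sym z)))
        choose (inj₁ _) (inj₂ y) (inj₂ z) = contradiction (ℤ.+-injective (trans y (sym z))) distinct
        choose (inj₂ _) (inj₁ y) (inj₁ z) = contradiction (ℤ.+-injective (trans y (sym z))) distinct

  module _ {n} (G : Graph n) where

    -- Deleting one end of an edge inside `S` loses at least that edge.
    edge-drop : ∀ {S i j} → i ∈ S → j ∈ S → Adj G i j →
      ∃ λ R → ∣ S ∣ ≡ suc (∣ R ∣) × R ⊆ S × suc (inducedSize G R) ≤ inducedSize G S
    edge-drop {S} {i} {j} i∈S j∈S i~j = let R , i∉R , eq = delete i∈S in R , drop R i∉R eq j∈S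
      where
      drop : ∀ {S} R → i ∉ R → insert i R ≡ S → j ∈ S → ∣ S ∣ ≡ suc (∣ R ∣) × R ⊆ S × suc (inducedSize G R) ≤ inducedSize G S
      drop R i∉R refl j∈S = ∣insert∣ i∉R , ⊆insert , ℤ.drop‿+≤+ (ℤ.≤-trans
        (ℤ.≤-trans (ℤ.≤-reflexive (ℤ.+-comm 1ℤ (+ inducedSize G R))) (ℤ.+-monoʳ-≤ (+ inducedSize G R) (degreeIn-some G (j∈R (∈insert⁻ j∈S)) i~j)))
        (ℤ.≤-reflexive (sym (inducedSize-insert G i∉R))))
        where
        j∈R : j ≡ i ⊎ j ∈ R → j ∈ R
        j∈R (inj₁ refl) = contradiction i~j (Graph.~-irrefl G refl)
        j∈R (inj₂ j∈R)  = j∈R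

    independent-of-zero : ∀ {S} → inducedSize G S ≡ 0 → Independent G S
    independent-of-zero X≡0 i j i∈S j∈S i~j = let _ , _ , _ , drop = edge-drop i∈S j∈S i~j in
      n≮0 (≤-trans drop (≤-reflexive X≡0))

  pop : ∀ {n k} {S : Subset n} → ∣ S ∣ ≡ suc k → ∃₂ λ v R → v ∈ S × v ∉ R × R ⊆ S × ∣ R ∣ ≡ k
  pop {S = inside ∷ S}  eq = zero , outside ∷ S , here , (λ ()) , (λ { (there ∈S) → there ∈S }) , suc-injective eq
  pop {S = outside ∷ S} eq = let v , R , v∈S , v∉R , R⊆S , R≡k = pop {S = S} eq in
    suc v , outside ∷ R , there v∈S , (λ { (there v∈R) → v∉R v∈R }) , (λ { (there ∈R) → there (R⊆S ∈R) }) , R≡k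

  three-elements : ∀ {n k} (S : Subset n) → ∣ S ∣ ≡ 3 + k →
    ∃ λ x → ∃₂ λ y z → x ∈ S × y ∈ S × z ∈ S × x ≢ y × x ≢ z × y ≢ z
  three-elements S S≡3+k =
    let x , R , x∈S , x∉R , R⊆S , R≡ = pop {S = S} S≡3+k
        y , Q , y∈R , y∉Q , Q⊆R , Q≡ = pop {S = R} R≡
        z , _ , z∈Q , _              = pop {S = Q} Q≡
    in x , y , z , x∈S , R⊆S y∈R , R⊆S (Q⊆R z∈Q)
     , ∉∈⇒≢ x∉R y∈R , ∉∈⇒≢ x∉R (Q⊆R z∈Q) , ∉∈⇒≢ y∉Q z∈Q
    where
    ∉∈⇒≢ : ∀ {n} {i j : Fin n} {P} → i ∉ P → j ∈ P → i ≢ j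
    ∉∈⇒≢ i∉P j∈P refl = i∉P j∈P

  module _ {n} {H : Graph n} {x y z : Fin n} (x~y : Adj H x y) (x~z : Adj H x z) (y~z : Adj H y z) where

    star-triangle-free : ¬ IsStar H
    star-triangle-free (v , star)
      with proj₂ (Equivalence.to (star x y) x~y) | proj₂ (Equivalence.to (star x z) x~z) | proj₂ (Equivalence.to (star y z) y~z)
    ... | inj₁ refl | _         | inj₁ refl = Graph.~-irrefl H refl x~y
    ... | inj₁ refl | _         | inj₂ refl = Graph.~-irrefl H refl x~z
    ... | inj₂ refl | inj₁ refl | _         = Graph.~-irrefl H refl x~y
    ... | inj₂ refl | inj₂ refl | _         = Graph.~-irrefl H refl y~z

    singleEdge-triangle-free : ¬ IsSingleEdge H
    singleEdge-triangle-free (a , b , a≢b , edge)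
      with Equivalence.to (edge x y) x~y | Equivalence.to (edge x z) x~z | Equivalence.to (edge y z) y~z
    ... | inj₁ (refl , refl) | inj₁ (_ , refl) | _ = Graph.~-irrefl H refl y~z
    ... | inj₁ (refl , refl) | inj₂ (a≡b , _)  | _ = a≢b a≡b
    ... | inj₂ (refl , refl) | inj₁ (b≡a , _)  | _ = a≢b (sym b≡a)
    ... | inj₂ (refl , refl) | inj₂ (_ , refl) | _ = Graph.~-irrefl H refl y~z

  -- Three vertices of an independent set form a triangle in the complement, which can therefore be
  -- neither a star nor a single edge.
  zero⇒star⊎edge : ∀ {n k} {G : Graph n} S → ∣ S ∣ ≡ 3 + k → inducedSize G S ≡ 0 → Extremal G → IsStar G ⊎ IsSingleEdge G
  zero⇒star⊎edge {G = G} S S≡ X≡0 extremal = exclude extremal (three-elements S S≡)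
    where
    nonadjacent : ∀ {i j} → i ∈ S → j ∈ S → i ≢ j → Adj (complement G) i j
    nonadjacent {i} {j} i∈S j∈S i≢j = i≢j , independent-of-zero G X≡0 i j i∈S j∈S
    exclude : Extremal G → (∃ λ x → ∃₂ λ y z → x ∈ S × y ∈ S × z ∈ S × x ≢ y × x ≢ z × y ≢ z) → IsStar G ⊎ IsSingleEdge G
    exclude (inj₁ star)        _ = inj₁ star
    exclude (inj₂ (inj₁ edge)) _ = inj₂ edge
    exclude (inj₂ (inj₂ (inj₁ costar))) (x , y , z , x∈ , y∈ , z∈ , x≢y , x≢z , y≢z) =
      contradiction costar (star-triangle-free {H = complement G} (nonadjacent x∈ y∈ x≢y) (nonadjacent x∈ z∈ x≢z) (nonadjacent y∈ z∈ y≢z))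
    exclude (inj₂ (inj₂ (inj₂ coedge))) (x , y , z , x∈ , y∈ , z∈ , x≢y , x≢z , y≢z) =
      contradiction coedge (singleEdge-triangle-free {H = complement G} (nonadjacent x∈ y∈ x≢y) (nonadjacent x∈ z∈ x≢z) (nonadjacent y∈ z∈ y≢z))

-- The bounds for induced sizes and the graphs that attain them.

module Bounds where
  open Balances using (TwoValued; twoValued; size-values)
  open Classification
  open Rationals
  open Means
  open BhatiaDavis
  open Extremes
  open import Data.Fin.Subset using (∣_∣)
  open import Data.Rational using (_+_; _-_; _*_; -_; _≤_; _<_)
  open import Tactic.RingSolver using (solve-∀)

  module _ {n} (G : Graph n) {r} (r+8≤n : r ℕ.+ 8 ℕ.≤ n) (¬complete : ¬ Complete G) (¬cocomplete : ¬ CoComplete G) where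

    private
      c : ℕ
      c = 4 ℕ.+ r

      c≤n : c ℕ.≤ n
      c≤n = ℕ.≤-trans (ℕ.≤-trans (ℕ.≤-reflexive (ℕ.+-comm 4 r)) (ℕ.+-monoʳ-≤ r (ℕ.m≤m+n 4 4))) r+8≤n

      xs : List (Subset n)
      xs = subsetsOfSize n c

      nonempty : 0 ℕ.< length xs
      nonempty = subsets-nonempty G c≤n

      Sℓ Sᵤ : Subset n
      Sℓ = proj₁ (ℓ-attained G c≤n)
      Sᵤ = proj₁ (u-attained G c≤n)

      ∣Sℓ∣ : ∣ Sℓ ∣ ≡ c
      ∣Sℓ∣ = proj₁ (proj₂ (ℓ-attained G c≤n))
      ∣Sᵤ∣ : ∣ Sᵤ ∣ ≡ c
      ∣Sᵤ∣ = proj₁ (proj₂ (u-attained G c≤n))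

      Xℓ : ℓ G c ≡ inducedSize G Sℓ
      Xℓ = proj₂ (proj₂ (ℓ-attained G c≤n))
      Xᵤ : u G c ≡ inducedSize G Sᵤ
      Xᵤ = proj₂ (proj₂ (u-attained G c≤n))

      ℓ≤X : ∀ {S} → S ∈ₗ xs → fromℕ (ℓ G c) ≤ M G S
      ℓ≤X {S} S∈ = fromℤ-mono-≤ {+ ℓ G c} {+ inducedSize G S} (ℤ.+≤+ (ℓ-≤ G S (∈subsetsOfSize⁻ {S = S} S∈)))

      X≤u : ∀ {S} → S ∈ₗ xs → M G S ≤ fromℕ (u G c)
      X≤u {S} S∈ = fromℤ-mono-≤ {+ inducedSize G S} {+ u G c} (ℤ.+≤+ (≤-u G S (∈subsetsOfSize⁻ {S = S} S∈)))

      fromℕ-injective : ∀ {a b} → fromℕ a ≡ fromℕ b → a ≡ b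
      fromℕ-injective {a} {b} eq = ℤ.+-injective (fromℤ-injective {+ a} {+ b} eq)

    ℓ≢u : ℓ G c ≢ u G c
    ℓ≢u ℓ≡u = nonconstant {G = G} ¬complete ¬cocomplete {p = + ℓ G c} r+8≤n λ S S≡c →
      cong +_ (ℕ.≤-antisym (subst (inducedSize G S ℕ.≤_) (sym ℓ≡u) (≤-u G S S≡c)) (ℓ-≤ G S S≡c))

    ℓ<S₁ : fromℕ (ℓ G c) < S₁ G c
    ℓ<S₁ = mean-> xs nonempty (M G) ℓ≤X X≤u (∈subsetsOfSize⁺ {S = Sᵤ} ∣Sᵤ∣)
      (λ Xᵤ≡ℓ → ℓ≢u (sym (trans Xᵤ (fromℕ-injective {inducedSize G Sᵤ} {ℓ G c} Xᵤ≡ℓ))))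

    S₁<u : S₁ G c < fromℕ (u G c)
    S₁<u = mean-< xs nonempty (M G) ℓ≤X X≤u (∈subsetsOfSize⁺ {S = Sℓ} ∣Sℓ∣)
      (λ Xℓ≡u → ℓ≢u (trans Xℓ (fromℕ-injective {inducedSize G Sℓ} {u G c} Xℓ≡u)))

    σ²-formula : σ² G c ≡ fromℕ 2 * S₂ G c - S₁ G c * (S₁ G c - 1ℚ)
    σ²-formula = variance-formula xs nonempty (M G)

    lowerTerm≤u : ∀ ℓ⋆ → ℓ⋆ ℤ.≤ + ℓ G c → lowerTerm G c ℓ⋆ ≤ fromℕ (u G c)
    lowerTerm≤u ℓ⋆ ℓ⋆≤ℓ = max-≥ xs nonempty (M G) {fromℤ ℓ⋆} {fromℕ (u G c)}
      (λ S∈ → ℚ.≤-trans ℓ⋆≤ℓℚ (ℓ≤X S∈)) X≤u (ℚ.≤-<-trans ℓ⋆≤ℓℚ ℓ<S₁)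
      where
      ℓ⋆≤ℓℚ : fromℤ ℓ⋆ ≤ fromℕ (ℓ G c)
      ℓ⋆≤ℓℚ = fromℤ-mono-≤ {ℓ⋆} {+ ℓ G c} ℓ⋆≤ℓ

    ℓ≤upperBound : ∀ u⋆ → + u G c ℤ.≤ u⋆ → fromℕ (ℓ G c) ≤ upperBound G c u⋆
    ℓ≤upperBound u⋆ u≤u⋆ = min-≤ xs nonempty (M G) {fromℕ (ℓ G c)} {fromℤ u⋆}
      ℓ≤X (λ S∈ → ℚ.≤-trans (X≤u S∈) u≤u⋆ℚ) (ℚ.<-≤-trans S₁<u u≤u⋆ℚ)
      where
      u≤u⋆ℚ : fromℕ (u G c) ≤ fromℤ u⋆
      u≤u⋆ℚ = fromℤ-mono-≤ {+ u G c} {u⋆} u≤u⋆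

    -- The minimum is estimated by its second term, which stays below u for every integer ℓ⋆ ≤ ℓ,
    -- also for a negative one such as c - α⋆ may be.
    ceiling-lowerBound : ∀ ℓ⋆ → ℓ⋆ ℤ.≤ + ℓ G c → ceiling (lowerBound G c ℓ⋆) ℤ.≤ + u G c
    ceiling-lowerBound ℓ⋆ ℓ⋆≤ℓ = ceiling-least {+ u G c} {lowerBound G c ℓ⋆}
      (ℚ.≤-trans (ℚ.p⊓q≤q (fromℕ 2 * S₂ G c ⟋ S₁ G c + 1ℚ) (lowerTerm G c ℓ⋆)) (lowerTerm≤u ℓ⋆ ℓ⋆≤ℓ))

    floor-upperBound : ∀ u⋆ → + u G c ℤ.≤ u⋆ → + ℓ G c ℤ.≤ floor (upperBound G c u⋆)
    floor-upperBound u⋆ u≤u⋆ = floor-greatest {+ ℓ G c} {upperBound G c u⋆} (ℓ≤upperBound u⋆ u≤u⋆)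

    at-least : ∀ ℓ⋆ → ℓ⋆ ℤ.≤ + ℓ G c → HasSubgraphOfSizeAtLeast G c (ceiling (lowerBound G c ℓ⋆))
    at-least ℓ⋆ ℓ⋆≤ℓ = Sᵤ , ∣Sᵤ∣ , ℤ.≤-trans (ceiling-lowerBound ℓ⋆ ℓ⋆≤ℓ) (ℤ.≤-reflexive (cong +_ Xᵤ))

    at-most : ∀ u⋆ → + u G c ℤ.≤ u⋆ → HasSubgraphOfSizeAtMost G c (floor (upperBound G c u⋆))
    at-most u⋆ u≤u⋆ = Sℓ , ∣Sℓ∣ , ℤ.≤-trans (ℤ.≤-reflexive (cong +_ (sym Xℓ))) (floor-upperBound u⋆ u≤u⋆)

    0<S₁ : 0ℚ < S₁ G c
    0<S₁ = ℚ.≤-<-trans (0≤fromℕ (ℓ G c)) ℓ<S₁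

    0≤σ² : 0ℚ ≤ σ² G c
    0≤σ² = mean-nonneg xs nonempty (λ {S} _ → square-nonneg (M G S - S₁ G c))

    -- After multiplication by S₁, the variance formula turns 2 S₂ + S₁ into S₁² + σ².
    firstTerm≡lowerTerm : fromℕ 2 * S₂ G c ⟋ S₁ G c + 1ℚ ≡ lowerTerm G c (+ 0)
    firstTerm≡lowerTerm = *-cancelʳ-≡ 0<S₁ (begin
      (fromℕ 2 * S₂ G c ⟋ S₁ G c + 1ℚ) * S₁ G c
        ≡⟨ expand (fromℕ 2 * S₂ G c ⟋ S₁ G c) (S₁ G c) ⟩
      fromℕ 2 * S₂ G c ⟋ S₁ G c * S₁ G c + S₁ G c
        ≡⟨ cong (λ s → s + S₁ G c) (⟋-* (fromℕ 2 * S₂ G c) 0<S₁) ⟩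
      fromℕ 2 * S₂ G c + S₁ G c
        ≡⟨ rearrange (fromℕ 2 * S₂ G c) (S₁ G c) ⟩
      S₁ G c * S₁ G c + (fromℕ 2 * S₂ G c - S₁ G c * (S₁ G c - 1ℚ))
        ≡⟨ cong (λ v → S₁ G c * S₁ G c + v) σ²-formula ⟨
      S₁ G c * S₁ G c + σ² G c
        ≡⟨ cong (λ v → S₁ G c * S₁ G c + v) (⟋-* (σ² G c) 0<S₁) ⟨
      S₁ G c * S₁ G c + σ² G c ⟋ S₁ G c * S₁ G c
        ≡⟨ ℚ.*-distribʳ-+ (S₁ G c) (S₁ G c) (σ² G c ⟋ S₁ G c) ⟨
      (S₁ G c + σ² G c ⟋ S₁ G c) * S₁ G c
        ≡⟨ cong (λ d → (S₁ G c + σ² G c ⟋ d) * S₁ G c) (minus-zero (S₁ G c)) ⟩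
      lowerTerm G c (+ 0) * S₁ G c
        ∎)
      where
      open ≡-Reasoning
      expand : ∀ x s → (x + 1ℚ) * s ≡ x * s + s
      expand = solve-∀ ℚ-ring
      rearrange : ∀ t s → t + s ≡ s * s + (t - s * (s - 1ℚ))
      rearrange = solve-∀ ℚ-ring
      minus-zero : ∀ s → s ≡ s - 0ℚ
      minus-zero = solve-∀ ℚ-ring

    -- For ℓ⋆ ≥ 0 the divisor S₁ - ℓ⋆ is at most S₁, so the second term of the minimum is at least
    -- `lowerTerm` at 0, which is the first term.
    lowerBound≡firstTerm : ∀ ℓ⋆ → + 0 ℤ.≤ ℓ⋆ → ℓ⋆ ℤ.≤ + ℓ G c → lowerBound G c ℓ⋆ ≡ fromℕ 2 * S₂ G c ⟋ S₁ G c + 1ℚ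
    lowerBound≡firstTerm ℓ⋆ 0≤ℓ⋆ ℓ⋆≤ℓ = ℚ.p≤q⇒p⊓q≡p (subst (_≤ lowerTerm G c ℓ⋆) (sym firstTerm≡lowerTerm) (ℚ.+-monoʳ-≤ (S₁ G c) quotients))
      where
      d e : ℚ
      d = S₁ G c - fromℤ ℓ⋆
      e = S₁ G c - fromℤ (+ 0)
      0<d : 0ℚ < d
      0<d = difference-pos (ℚ.≤-<-trans (fromℤ-mono-≤ {ℓ⋆} {+ ℓ G c} ℓ⋆≤ℓ) ℓ<S₁)
      d≤e : d ≤ e
      d≤e = ℚ.+-monoʳ-≤ (S₁ G c) (ℚ.neg-antimono-≤ (fromℤ-mono-≤ {+ 0} {ℓ⋆} 0≤ℓ⋆))
      0<e : 0ℚ < e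
      0<e = ℚ.<-≤-trans 0<d d≤e
      0≤w : 0ℚ ≤ σ² G c ⟋ d
      0≤w = ⟋-nonneg 0≤σ² 0<d
      quotients : σ² G c ⟋ e ≤ σ² G c ⟋ d
      quotients = *-cancelʳ-≤ 0<e (subst (_≤ σ² G c ⟋ d * e) (trans (⟋-* (σ² G c) 0<d) (sym (⟋-* (σ² G c) 0<e)))
        (ℚ.*-monoˡ-≤-nonNeg (σ² G c ⟋ d) {{ℚ.nonNegative 0≤w}} d≤e))

    -- Together with the estimate by u from above, this limits the word in which the program stores
    -- the result.
    ceiling-lowerBound-nonneg : ∀ ℓ⋆ → + 0 ℤ.≤ ℓ⋆ → ℓ⋆ ℤ.≤ + ℓ G c → + 0 ℤ.≤ ceiling (lowerBound G c ℓ⋆)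
    ceiling-lowerBound-nonneg ℓ⋆ 0≤ℓ⋆ ℓ⋆≤ℓ = ceiling-nonneg {lowerBound G c ℓ⋆}
      (subst (0ℚ ≤_) (sym (trans (lowerBound≡firstTerm ℓ⋆ 0≤ℓ⋆ ℓ⋆≤ℓ) firstTerm≡lowerTerm))
        (ℚ.+-mono-≤ (ℚ.<⇒≤ 0<S₁) (⟋-nonneg 0≤σ² (difference-pos 0<S₁))))

    floor-upperBound-≤ : ∀ u⋆ → + u G c ℤ.≤ u⋆ → floor (upperBound G c u⋆) ℤ.≤ + u G c
    floor-upperBound-≤ u⋆ u≤u⋆ = fromℤ-cancel-≤ {floor (upperBound G c u⋆)} {+ u G c}
      (ℚ.≤-trans (floor-≤ (upperBound G c u⋆)) (ℚ.≤-trans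
        (subst (upperBound G c u⋆ ≤_) (ℚ.+-identityʳ (S₁ G c)) (ℚ.+-monoʳ-≤ (S₁ G c) (ℚ.neg-antimono-≤ (⟋-nonneg 0≤σ²
          (difference-pos (ℚ.<-≤-trans S₁<u (fromℤ-mono-≤ {+ u G c} {u⋆} u≤u⋆)))))))
        (ℚ.<⇒≤ S₁<u)))

    private
      extremal : ∀ {a b} → a ℕ.≤ b → (∀ {S} → S ∈ₗ xs → M G S ≡ fromℕ a ⊎ M G S ≡ fromℕ b) → Extremal G
      extremal {a} {b} a≤b two = classification {G = G} ¬complete ¬cocomplete {p = + a} {b ℕ.∸ a} r+8≤n (twoValued λ S S≡c →
        Sum.map (λ X≡a → cong +_ (fromℕ-injective {inducedSize G S} {a} X≡a))
                (λ X≡b → cong +_ (trans (fromℕ-injective {inducedSize G S} {b} X≡b) (sym (ℕ.m+[n∸m]≡n a≤b))))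
                (two {S} (∈subsetsOfSize⁺ {S = S} S≡c)))

      ℓ≤u : ℓ G c ℕ.≤ u G c
      ℓ≤u = ℕ.≤-trans (ℓ-≤ G Sℓ ∣Sℓ∣) (≤-u G Sℓ ∣Sℓ∣)

      two-values-ℓu : Extremal G → ∀ {S} → S ∈ₗ xs → M G S ≡ fromℕ (ℓ G c) ⊎ M G S ≡ fromℕ (u G c)
      two-values-ℓu ext {S} S∈ = let _ , _ , two = extremal-two {G = G} c≤n ext in
        Sum.map (λ X≡ → cong fromℕ (trans X≡ (sym Xℓ))) (λ X≡ → cong fromℕ (trans X≡ (sym Xᵤ)))
          (two-values G c≤n two Sℓ Sᵤ ∣Sℓ∣ ∣Sᵤ∣ (λ eq → ℓ≢u (trans Xℓ (trans eq (sym Xᵤ)))) S (∈subsetsOfSize⁻ {S = S} S∈))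

    lowerTerm-tight : fromℕ (u G c) ≡ lowerTerm G c (+ ℓ G c) ⇔ Extremal G
    lowerTerm-tight = mk⇔
      (λ eq → extremal ℓ≤u (max-tight xs nonempty (M G) ℓ≤X X≤u ℓ<S₁ eq))
      (λ ext → max-attained xs nonempty (M G) ℓ≤X X≤u ℓ<S₁ (two-values-ℓu ext))

    upperBound-tight : fromℕ (ℓ G c) ≡ upperBound G c (+ u G c) ⇔ Extremal G
    upperBound-tight = mk⇔
      (λ eq → extremal ℓ≤u (min-tight xs nonempty (M G) ℓ≤X X≤u S₁<u eq))
      (λ ext → min-attained xs nonempty (M G) ℓ≤X X≤u S₁<u (two-values-ℓu ext))

    -- Even at ℓ the bound is `lowerTerm` at 0, so the inequality is applied with 0 in place of ℓ.
    -- Equality makes 0 an attained size and thereby excludes the two complements.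
    lowerBound-tight : fromℕ (u G c) ≡ lowerBound G c (+ ℓ G c) ⇔ (IsStar G ⊎ IsSingleEdge G)
    lowerBound-tight = mk⇔ to from
      where
      lowerBound≡ : lowerBound G c (+ ℓ G c) ≡ lowerTerm G c (+ 0)
      lowerBound≡ = trans (lowerBound≡firstTerm (+ ℓ G c) (ℤ.+≤+ z≤n) ℤ.≤-refl) firstTerm≡lowerTerm

      0≤X : ∀ {S} → S ∈ₗ xs → fromℕ 0 ≤ M G S
      0≤X {S} _ = 0≤fromℕ (inducedSize G S)

      to : fromℕ (u G c) ≡ lowerBound G c (+ ℓ G c) → IsStar G ⊎ IsSingleEdge G
      to eq = zero⇒star⊎edge {G = G} Sℓ ∣Sℓ∣ (ℓ-value (two (∈subsetsOfSize⁺ {S = Sℓ} ∣Sℓ∣))) (extremal {0} {u G c} z≤n two)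
        where
        two : ∀ {S} → S ∈ₗ xs → M G S ≡ fromℕ 0 ⊎ M G S ≡ fromℕ (u G c)
        two = max-tight xs nonempty (M G) 0≤X X≤u 0<S₁ (trans eq lowerBound≡)
        ℓ-value : M G Sℓ ≡ fromℕ 0 ⊎ M G Sℓ ≡ fromℕ (u G c) → inducedSize G Sℓ ≡ 0
        ℓ-value (inj₁ X≡0) = fromℕ-injective {inducedSize G Sℓ} {0} X≡0
        ℓ-value (inj₂ X≡u) = contradiction (trans Xℓ (fromℕ-injective {inducedSize G Sℓ} {u G c} X≡u)) ℓ≢u

      from : IsStar G ⊎ IsSingleEdge G → fromℕ (u G c) ≡ lowerBound G c (+ ℓ G c)
      from star⊎edge = trans (max-attained xs nonempty (M G) 0≤X X≤u 0<S₁ values₀) (sym lowerBound≡)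
        where
        two : ∃ λ D → TwoValued G c (+ 0) D
        two = Sum.[ (λ star → _ , star-two star) , (λ edge → _ , singleEdge-two edge) ] star⊎edge
        D : ℕ
        D = proj₁ two
        -- ℓ and u are distinct elements of {0 , D}, and ℓ ≤ u.
        u≡D : u G c ≡ D
        u≡D = pick (size-values (proj₂ two) Sℓ ∣Sℓ∣) (size-values (proj₂ two) Sᵤ ∣Sᵤ∣)
          where
          pick : + inducedSize G Sℓ ≡ + 0 ⊎ + inducedSize G Sℓ ≡ + D → + inducedSize G Sᵤ ≡ + 0 ⊎ + inducedSize G Sᵤ ≡ + D → u G c ≡ D
          pick _        (inj₂ u≡) = trans Xᵤ (ℤ.+-injective u≡)
          pick _        (inj₁ u≡) = contradiction
            (ℕ.≤-antisym ℓ≤u (subst (ℕ._≤ ℓ G c) (sym (trans Xᵤ (ℤ.+-injective u≡))) z≤n)) ℓ≢u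
        values₀ : ∀ {S} → S ∈ₗ xs → M G S ≡ fromℕ 0 ⊎ M G S ≡ fromℕ (u G c)
        values₀ {S} S∈ = Sum.map (cong fromℤ) (λ X≡ → trans (cong fromℤ X≡) (cong fromℕ (sym u≡D)))
          (size-values (proj₂ two) S (∈subsetsOfSize⁻ {S = S} S∈))

-- Admissible choices of the parameters: γ and the independence number.

module SizeBounds where
  open Indicators
  open InducedSizes
  open Extremes
  open import Data.Fin.Subset using (∣_∣)
  open import Data.Integer using (_+_; _*_; _-_; _≤_)
  open import Data.Integer.Tactic.RingSolver using (solve-∀)
  open import Data.Nat using (suc)
  open Means using (∈subsets)

  private
    -- With t = h - p, the sum condition gives q = t + H. Moving t from the larger factor to the
    -- smaller one replaces p t by H t and yields h H.
    balanced-product-≤ : ∀ {p q} → p ℕ.≤ q → p ℕ.* q ℕ.≤ ⌊ p ℕ.+ q /2⌋ ℕ.* ⌈ p ℕ.+ q /2⌉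
    balanced-product-≤ {p} {q} p≤q = begin
      p ℕ.* q                   ≡⟨ cong (p ℕ.*_) q≡t+H ⟩
      p ℕ.* (t ℕ.+ H)           ≡⟨ ℕ.*-distribˡ-+ p t H ⟩
      p ℕ.* t ℕ.+ p ℕ.* H       ≤⟨ ℕ.+-monoˡ-≤ (p ℕ.* H) (ℕ.*-monoˡ-≤ t (ℕ.≤-trans p≤h (ℕ.⌊n/2⌋≤⌈n/2⌉ (p ℕ.+ q)))) ⟩
      H ℕ.* t ℕ.+ p ℕ.* H       ≡⟨ regroup p t H ⟩
      (p ℕ.+ t) ℕ.* H           ≡⟨ cong (ℕ._* H) (ℕ.m+[n∸m]≡n p≤h) ⟩
      h ℕ.* H                   ∎
      where
      open ℕ.≤-Reasoning
      h H t : ℕ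
      h = ⌊ p ℕ.+ q /2⌋
      H = ⌈ p ℕ.+ q /2⌉
      t = h ℕ.∸ p
      p≤h : p ℕ.≤ h
      p≤h = subst (ℕ._≤ h) (sym (ℕ.n≡⌊n+n/2⌋ p)) (ℕ.⌊n/2⌋-mono (ℕ.+-monoʳ-≤ p p≤q))
      q≡t+H : q ≡ t ℕ.+ H
      q≡t+H = ℕ.+-cancelˡ-≡ p q (t ℕ.+ H) (sym (trans (sym (ℕ.+-assoc p t H))
        (trans (cong (ℕ._+ H) (ℕ.m+[n∸m]≡n p≤h)) (ℕ.⌊n/2⌋+⌈n/2⌉≡n (p ℕ.+ q)))))
      regroup : ∀ p t H → H ℕ.* t ℕ.+ p ℕ.* H ≡ (p ℕ.+ t) ℕ.* H
      regroup = solveℕ-∀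

  balanced-product : ∀ p q → p ℕ.* q ℕ.≤ ⌊ p ℕ.+ q /2⌋ ℕ.* ⌈ p ℕ.+ q /2⌉
  balanced-product p q with ℕ.≤-total p q
  ... | inj₁ p≤q = balanced-product-≤ p≤q
  ... | inj₂ q≤p = subst₂ (λ x c → x ℕ.≤ ⌊ c /2⌋ ℕ.* ⌈ c /2⌉) (ℕ.*-comm q p) (ℕ.+-comm q p) (balanced-product-≤ q≤p)

  ∑-* : ∀ {n} (f g : Fin n → ℤ) → ∑[ i < n ] (∑[ j < n ] (f i * g j)) ≡ ∑[ i < n ] f i * ∑[ j < n ] g j
  ∑-* {n} f g = trans (sum-cong-≗ λ i → sym (*-distribˡ-sum (f i) g)) (sym (*-distribʳ-sum (∑[ j < n ] g j) f))

  module _ {n} (G : Graph n) where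

    private
      edge? : ∀ S → Dec (∃₂ λ i j → i ∈ S × j ∈ S × Adj G i j)
      edge? S = Fin.any? λ i → Fin.any? λ j → (i ∈? S) ×-dec (j ∈? S) ×-dec adj? G i j

    -- Remove an end of an edge from S until no edge is left.
    independent-subset : ∀ k S → ∣ S ∣ ≡ k → ∃ λ T → Independent G T × ∣ S ∣ ℕ.≤ inducedSize G S ℕ.+ ∣ T ∣
    independent-subset k S S≡k = remove k S S≡k (edge? S)
      where
      remove : ∀ k S → ∣ S ∣ ≡ k → Dec (∃₂ λ i j → i ∈ S × j ∈ S × Adj G i j) →
        ∃ λ T → Independent G T × ∣ S ∣ ℕ.≤ inducedSize G S ℕ.+ ∣ T ∣
      remove k S S≡k (no ∄edge) = S , (λ i j i∈S j∈S i~j → ∄edge (i , j , i∈S , j∈S , i~j)) , ℕ.m≤n+m (∣ S ∣) (inducedSize G S)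
      remove ℕ.zero S S≡0 (yes (i , j , i∈S , j∈S , i~j)) =
        let R , S≡1+R , _ = edge-drop G {S} i∈S j∈S i~j in contradiction (trans (sym S≡1+R) S≡0) (λ ())
      remove (suc k) S S≡k (yes (i , j , i∈S , j∈S , i~j)) =
        let R , S≡1+R , _ , drop = edge-drop G {S} i∈S j∈S i~j
            T , independent , R≤ = remove k R (ℕ.suc-injective (trans (sym S≡1+R) S≡k)) (edge? R)
        in T , independent , ℕ.≤-trans (ℕ.≤-reflexive S≡1+R) (ℕ.≤-trans (s≤s R≤) (ℕ.+-monoˡ-≤ (∣ T ∣) drop))

    independent-≤ : ∀ T → Independent G T → ∣ T ∣ ℕ.≤ independenceNumber G
    independent-≤ T independent = All.lookup (xs≤max 0 _)
      (∈ₗ.∈-map⁺ ∣_∣ (∈ₗ.∈-filter⁺ (independent? G) (∈subsets T) independent))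

    -- A set with ℓ edges becomes independent after the removal of at most ℓ vertices, so at least c
    -- - ℓ independent vertices remain.
    c≤ℓ+α : ∀ {c} → c ℕ.≤ n → c ℕ.≤ ℓ G c ℕ.+ independenceNumber G
    c≤ℓ+α {c} c≤n =
      let S , S≡c , ℓ≡X = ℓ-attained G c≤n
          T , independent , S≤ = independent-subset c S S≡c
      in ℕ.≤-trans (ℕ.≤-reflexive (sym S≡c)) (ℕ.≤-trans S≤
           (ℕ.+-mono-≤ (ℕ.≤-reflexive (sym ℓ≡X)) (independent-≤ T independent)))

    c-α≤ℓ : ∀ {c α⋆} → c ℕ.≤ n → independenceNumber G ℕ.≤ α⋆ → + c - + α⋆ ≤ + ℓ G c
    c-α≤ℓ {c} {α⋆} c≤n α≤α⋆ = subst (+ c - + α⋆ ≤_) (cancel (+ ℓ G c) (+ α⋆))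
      (ℤ.+-monoˡ-≤ (ℤ.- + α⋆) (+≤+ (ℕ.≤-trans (c≤ℓ+α c≤n) (ℕ.+-monoʳ-≤ (ℓ G c) α≤α⋆))))
      where
      cancel : ∀ x y → x + y - y ≡ x
      cancel = solve-∀

    -- Adding the edges of the complement inside `S` gives all pairs of vertices of `S`.
    size-≤-complete : ∀ S → inducedSize G S ℕ.≤ (∣ S ∣ ℕ.* (∣ S ∣ ℕ.∸ 1)) ℕ./ 2
    size-≤-complete S = subst (ℕ._≤ _) (ℕ.m*n/n≡m (inducedSize G S) 2) (ℕ./-monoˡ-≤ 2 (ℤ.drop‿+≤+ (begin
      + (inducedSize G S ℕ.* 2)
        ≡⟨ twice ⟩
      + 2 * + inducedSize G S
        ≤⟨ ℤ.*-monoˡ-≤-nonNeg (+ 2) (ℤ.i≤i+j (+ inducedSize G S) (+ inducedSize (complement G) S)) ⟩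
      + 2 * (+ inducedSize G S + + inducedSize (complement G) S)
        ≡⟨ inducedSize+complement G S ⟩
      + (∣ S ∣) * (+ (∣ S ∣) - 1ℤ)
        ≡⟨ pairs (∣ S ∣) ⟩
      + (∣ S ∣ ℕ.* (∣ S ∣ ℕ.∸ 1))
        ∎)))
      where
      open ℤ.≤-Reasoning
      twice : + (inducedSize G S ℕ.* 2) ≡ + 2 * + inducedSize G S
      twice = trans (ℤ.pos-* (inducedSize G S) 2) (ℤ.*-comm (+ inducedSize G S) (+ 2))
      pairs : ∀ k → + k * (+ k - 1ℤ) ≡ + (k ℕ.* (k ℕ.∸ 1))
      pairs ℕ.zero  = refl
      pairs (suc k) = sym (ℤ.pos-* (suc k) k)

    module _ {A : Subset n} (bipartition : ∀ i j → Adj G i j → (i ∈ A × j ∉ A) ⊎ (i ∉ A × j ∈ A)) where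

      private
        module _ (S : Subset n) where

          inner outer : Fin n → ℤ
          inner i = ⟦ S ⟧ i * ⟦ A ⟧ i
          outer i = ⟦ S ⟧ i * (1ℤ - ⟦ A ⟧ i)

          inner-nonneg : ∀ i → 0ℤ ≤ inner i
          inner-nonneg i with i ∈? S | i ∈? A
          ... | yes _ | yes _ = +≤+ z≤n
          ... | yes _ | no _  = +≤+ z≤n
          ... | no _  | yes _ = +≤+ z≤n
          ... | no _  | no _  = +≤+ z≤n

          outer-nonneg : ∀ i → 0ℤ ≤ outer i
          outer-nonneg i with i ∈? S | i ∈? A
          ... | yes _ | yes _ = +≤+ z≤n
          ... | yes _ | no _  = +≤+ z≤n
          ... | no _  | yes _ = +≤+ z≤n
          ... | no _  | no _  = +≤+ z≤n

          crossing : ∀ i j → adj G i j * (⟦ S ⟧ i * ⟦ S ⟧ j) ≤ inner i * outer j + outer i * inner j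
          crossing i j with adj? G i j
          ... | no _    = ℤ.≤-trans (ℤ.≤-reflexive (ℤ.*-zeroˡ (⟦ S ⟧ i * ⟦ S ⟧ j)))
            (ℤ.+-mono-≤ (nonneg-* (inner-nonneg i) (outer-nonneg j)) (nonneg-* (outer-nonneg i) (inner-nonneg j)))
            where
            nonneg-* : ∀ {x y} → 0ℤ ≤ x → 0ℤ ≤ y → 0ℤ ≤ x * y
            nonneg-* {x} {y} 0≤x 0≤y = subst (_≤ x * y) (ℤ.*-zeroˡ y) (ℤ.*-monoʳ-≤-nonNeg y {{ℤ.nonNegative 0≤y}} 0≤x)
          ... | yes i~j with bipartition i j i~j
          ...   | inj₁ (i∈A , j∉A) = ℤ.≤-reflexive (trans (identity (⟦ S ⟧ i) (⟦ S ⟧ j))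
            (cong₂ (λ x y → ⟦ S ⟧ i * x * (⟦ S ⟧ j * (1ℤ - y)) + ⟦ S ⟧ i * (1ℤ - x) * (⟦ S ⟧ j * y))
              (sym (χ-yes (i ∈? A) i∈A)) (sym (χ-no (j ∈? A) j∉A))))
            where
            identity : ∀ s t → 1ℤ * (s * t) ≡ s * 1ℤ * (t * (1ℤ - 0ℤ)) + s * (1ℤ - 1ℤ) * (t * 0ℤ)
            identity = solve-∀
          ...   | inj₂ (i∉A , j∈A) = ℤ.≤-reflexive (trans (identity (⟦ S ⟧ i) (⟦ S ⟧ j))
            (cong₂ (λ x y → ⟦ S ⟧ i * x * (⟦ S ⟧ j * (1ℤ - y)) + ⟦ S ⟧ i * (1ℤ - x) * (⟦ S ⟧ j * y))
              (sym (χ-no (i ∈? A) i∉A)) (sym (χ-yes (j ∈? A) j∈A))))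
            where
            identity : ∀ s t → 1ℤ * (s * t) ≡ s * 0ℤ * (t * (1ℤ - 1ℤ)) + s * (1ℤ - 0ℤ) * (t * 1ℤ)
            identity = solve-∀

          I O : ℤ
          I = ∑[ i < n ] inner i
          O = ∑[ i < n ] outer i

          0≤I : 0ℤ ≤ I
          0≤I = subst (_≤ I) (∑-0 n) (∑-mono inner-nonneg)

          0≤O : 0ℤ ≤ O
          0≤O = subst (_≤ O) (∑-0 n) (∑-mono outer-nonneg)

          I+O≡∣S∣ : I + O ≡ + (∣ S ∣)
          I+O≡∣S∣ = trans (sym (∑-distrib-+ inner outer))
            (trans (sum-cong-≗ λ i → split (⟦ S ⟧ i) (⟦ A ⟧ i)) (sym (∣S∣≡∑ S)))
            where
            split : ∀ s x → s * x + s * (1ℤ - x) ≡ s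
            split = solve-∀

          -- Each edge counts as two ordered pairs, one leading from the inner to the outer part of
          -- `S` and one back, and there are I O pairs in each direction.
          size-≤-product : + inducedSize G S ≤ I * O
          size-≤-product = ℤ.*-cancelˡ-≤-pos (+ inducedSize G S) (I * O) (+ 2) (begin
            + 2 * + inducedSize G S
              ≡⟨ handshake G S ⟩
            ∑[ i < n ] (∑[ j < n ] (adj G i j * (⟦ S ⟧ i * ⟦ S ⟧ j)))
              ≤⟨ ∑-mono (λ i → ∑-mono (crossing i)) ⟩
            ∑[ i < n ] (∑[ j < n ] (inner i * outer j + outer i * inner j))
              ≡⟨ sum-cong-≗ (λ i → ∑-distrib-+ (λ j → inner i * outer j) (λ j → outer i * inner j)) ⟩
            ∑[ i < n ] (∑[ j < n ] (inner i * outer j) + ∑[ j < n ] (outer i * inner j))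
              ≡⟨ ∑-distrib-+ (λ i → ∑[ j < n ] (inner i * outer j)) (λ i → ∑[ j < n ] (outer i * inner j)) ⟩
            ∑[ i < n ] (∑[ j < n ] (inner i * outer j)) + ∑[ i < n ] (∑[ j < n ] (outer i * inner j))
              ≡⟨ cong₂ _+_ (∑-* inner outer) (∑-* outer inner) ⟩
            I * O + O * I
              ≡⟨ double I O ⟩
            + 2 * (I * O)
              ∎)
            where
            open ℤ.≤-Reasoning
            double : ∀ x y → x * y + y * x ≡ + 2 * (x * y)
            double = solve-∀

      size-≤-bipartite : ∀ S → inducedSize G S ℕ.≤ ⌊ ∣ S ∣ /2⌋ ℕ.* ⌈ ∣ S ∣ /2⌉
      size-≤-bipartite S = subst (λ c → inducedSize G S ℕ.≤ ⌊ c /2⌋ ℕ.* ⌈ c /2⌉) p+q≡∣S∣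
        (ℕ.≤-trans (ℤ.drop‿+≤+ (ℤ.≤-trans (size-≤-product S) (ℤ.≤-reflexive (trans (sym (cong₂ _*_ p≡I q≡O)) (sym (ℤ.pos-* p q))))))
          (balanced-product p q))
        where
        p q : ℕ
        p = ℤ.∣ I S ∣
        q = ℤ.∣ O S ∣
        p≡I : + p ≡ I S
        p≡I = ℤ.0≤i⇒+∣i∣≡i (0≤I S)
        q≡O : + q ≡ O S
        q≡O = ℤ.0≤i⇒+∣i∣≡i (0≤O S)
        p+q≡∣S∣ : p ℕ.+ q ≡ ∣ S ∣
        p+q≡∣S∣ = ℤ.+-injective (trans (cong₂ _+_ p≡I q≡O) (I+O≡∣S∣ S))

    u≤γ : ∀ {c} → c ℕ.≤ n → u G c ℕ.≤ γ G c
    u≤γ {c} c≤n = let S , S≡c , u≡X = u-attained G c≤n in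
      subst (ℕ._≤ γ G c) (sym u≡X) (bounded S S≡c (bipartite? G))
      where
      bounded : ∀ S → ∣ S ∣ ≡ c → (b : Dec (Bipartite G)) →
        inducedSize G S ℕ.≤ (if does b then ⌊ c /2⌋ ℕ.* ⌈ c /2⌉ else (c ℕ.* (c ℕ.∸ 1)) ℕ./ 2)
      bounded S refl (yes (A , bipartition)) = size-≤-bipartite bipartition S
      bounded S refl (no _)                  = size-≤-complete S

-- Counting the sets of given size that contain a given set.

module Subsets where
  open Indicators
  open InducedSizes
  open import Data.Fin using (zero; suc)
  open import Data.Fin.Subset using (∣_∣)
  open import Data.List using ([]; _∷_; map)
  open import Data.Nat using (zero; suc; _+_; _*_; _∸_; _<_; _≟_)
  open import Data.Nat.Properties
  open import Data.Nat.Tactic.RingSolver using (solve-∀)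
  open import Data.Vec using ([]; _∷_)
  open ≡-Reasoning

  -- Pascal's rule reduces it to two smaller instances. It supplies the ratio of consecutive
  -- containment probabilities.
  absorption : ∀ n k → suc k * (suc n C suc k) ≡ suc n * (n C k)
  absorption zero    zero    = refl
  absorption zero    (suc k) = *-zeroʳ (suc (suc k))
  absorption (suc n) zero    = begin
    1 * (suc (suc n) C 1)   ≡⟨ *-identityˡ _ ⟩
    suc (suc n) C 1         ≡⟨ nC1≡n (suc (suc n)) ⟩
    suc (suc n)             ≡⟨ *-identityʳ (suc (suc n)) ⟨
    suc (suc n) * 1         ∎
  absorption (suc n) (suc k) = begin
    suc (suc k) * (suc (suc n) C suc (suc k))
      ≡⟨ cong (suc (suc k) *_) (nCk+nC[k+1]≡[n+1]C[k+1] (suc n) (suc k)) ⟨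
    suc (suc k) * (a + b)
      ≡⟨ split k a b ⟩
    suc k * a + a + suc (suc k) * b
      ≡⟨ cong₂ (λ x y → x + a + y) (absorption n k) (absorption n (suc k)) ⟩
    suc n * (n C k) + a + suc n * (n C suc k)
      ≡⟨ merge n (n C k) (n C suc k) a ⟩
    suc n * (n C k + n C suc k) + a
      ≡⟨ cong (λ x → suc n * x + a) (nCk+nC[k+1]≡[n+1]C[k+1] n k) ⟩
    suc n * a + a
      ≡⟨ +-comm (suc n * a) a ⟩
    suc (suc n) * a
      ∎
    where
    a b : ℕ
    a = suc n C suc k
    b = suc n C suc (suc k)
    split : ∀ k a b → suc (suc k) * (a + b) ≡ suc k * a + a + suc (suc k) * b
    split = solve-∀
    merge : ∀ n x y a → suc n * x + a + suc n * y ≡ suc n * (x + y) + a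
    merge = solve-∀

  private
    contains : ∀ {n} → ℕ → Subset n → Subset n → ℤ
    contains c T S = χ (∣ S ∣ ≟ c) ℤ.* χ (T ⊆? S)

    ⊇-count : ∀ {n} → ℕ → Subset n → ℤ
    ⊇-count {n} c T = ∑ₗ (contains c T) (subsets n)

    ∑ₗ-0 : ∀ {a} {A : Set a} {f : A → ℤ} (xs : List A) → (∀ x → f x ≡ 0ℤ) → ∑ₗ f xs ≡ 0ℤ
    ∑ₗ-0 []       f≡0 = refl
    ∑ₗ-0 (x ∷ xs) f≡0 = cong₂ ℤ._+_ (f≡0 x) (∑ₗ-0 xs f≡0)

    ∑ₗ-subsets : ∀ n (f : Subset (suc n) → ℤ) →
      ∑ₗ f (subsets (suc n)) ≡ ∑ₗ (λ S → f (inside ∷ S)) (subsets n) ℤ.+ ∑ₗ (λ S → f (outside ∷ S)) (subsets n)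
    ∑ₗ-subsets n f = trans (∑ₗ-++ f (map (inside ∷_) (subsets n)) _)
      (cong₂ ℤ._+_ (∑ₗ-map f (inside ∷_) (subsets n)) (∑ₗ-map f (outside ∷_) (subsets n)))

    suc≟suc : ∀ a c → χ (suc a ≟ suc c) ≡ χ (a ≟ c)
    suc≟suc a c = χ-cong (suc a ≟ suc c) (a ≟ c) suc-injective (cong suc)

    count-in-zero : ∀ {n} (T : Subset n) → ⊇-count 0 (inside ∷ T) ≡ 0ℤ
    count-in-zero {n} T = ∑ₗ-0 (subsets (suc n)) vanish
      where
      vanish : ∀ S → χ (∣ S ∣ ≟ 0) ℤ.* χ (inside ∷ T ⊆? S) ≡ 0ℤ
      vanish (inside ∷ S)  = ℤ.*-zeroˡ (χ (inside ∷ T ⊆? inside ∷ S))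
      vanish (outside ∷ S) = ℤ.*-zeroʳ (χ (∣ S ∣ ≟ 0))

    count-in : ∀ {n} c (T : Subset n) → ⊇-count (suc c) (inside ∷ T) ≡ ⊇-count c T
    count-in {n} c T = begin
      ⊇-count (suc c) (inside ∷ T)
        ≡⟨ ∑ₗ-subsets n (contains (suc c) (inside ∷ T)) ⟩
      ∑ₗ (λ S → χ (suc (∣ S ∣) ≟ suc c) ℤ.* χ (inside ∷ T ⊆? inside ∷ S)) (subsets n) ℤ.+
        ∑ₗ (λ S → χ (∣ S ∣ ≟ suc c) ℤ.* χ (inside ∷ T ⊆? outside ∷ S)) (subsets n)
        ≡⟨ cong₂ ℤ._+_
             (∑ₗ-cong (λ S → cong₂ ℤ._*_ (suc≟suc (∣ S ∣) c) (χ-cong (inside ∷ T ⊆? inside ∷ S) (T ⊆? S) drop-∷-⊆ s⊆s)) (subsets n))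
             (∑ₗ-0 (subsets n) λ S → ℤ.*-zeroʳ (χ (∣ S ∣ ≟ suc c))) ⟩
      ⊇-count c T ℤ.+ 0ℤ
        ≡⟨ ℤ.+-identityʳ _ ⟩
      ⊇-count c T
        ∎

    count-out : ∀ {n} c (T : Subset n) → ⊇-count (suc c) (outside ∷ T) ≡ ⊇-count c T ℤ.+ ⊇-count (suc c) T
    count-out {n} c T = trans (∑ₗ-subsets n (contains (suc c) (outside ∷ T))) (cong₂ ℤ._+_
      (∑ₗ-cong (λ S → cong₂ ℤ._*_ (suc≟suc (∣ S ∣) c) (χ-cong (outside ∷ T ⊆? inside ∷ S) (T ⊆? S) drop-∷-⊆ out⊆)) (subsets n))
      (∑ₗ-cong (λ S → cong (χ (∣ S ∣ ≟ suc c) ℤ.*_) (χ-cong (outside ∷ T ⊆? outside ∷ S) (T ⊆? S) drop-∷-⊆ s⊆s)) (subsets n)))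

    count-out-zero : ∀ {n} (T : Subset n) → ⊇-count 0 (outside ∷ T) ≡ ⊇-count 0 T
    count-out-zero {n} T = trans (∑ₗ-subsets n (contains 0 (outside ∷ T))) (trans (cong₂ ℤ._+_
      (∑ₗ-0 (subsets n) λ S → ℤ.*-zeroˡ (χ (outside ∷ T ⊆? inside ∷ S)))
      (∑ₗ-cong (λ S → cong (χ (∣ S ∣ ≟ 0) ℤ.*_) (χ-cong (outside ∷ T ⊆? outside ∷ S) (T ⊆? S) drop-∷-⊆ s⊆s)) (subsets n)))
      (ℤ.+-identityˡ _))

    count-small : ∀ {n} c (T : Subset n) → c < ∣ T ∣ → ⊇-count c T ≡ 0ℤ
    count-small c []            ()
    count-small zero    (inside ∷ T)  _         = count-in-zero T
    count-small (suc c) (inside ∷ T)  (s≤s c<T) = trans (count-in c T) (count-small c T c<T)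
    count-small zero    (outside ∷ T) 0<T       = trans (count-out-zero T) (count-small zero T 0<T)
    count-small (suc c) (outside ∷ T) 1+c<T     = trans (count-out c T)
      (cong₂ ℤ._+_ (count-small c T (<-trans (n<1+n c) 1+c<T)) (count-small (suc c) T 1+c<T))

    -- A first vertex in `T` is forced; a first vertex outside `T` may be taken or not, which is
    -- Pascal's rule. Counting the surplus `d` over ∣T∣ avoids subtraction in the size.
    count-C : ∀ {n} d (T : Subset n) → ⊇-count (∣ T ∣ + d) T ≡ + ((n ∸ ∣ T ∣) C d)
    count-C zero    []            = refl
    count-C (suc d) []            = refl
    count-C d       (inside ∷ T)  = trans (count-in (∣ T ∣ + d) T) (count-C d T)
    count-C {suc n} (suc d) (outside ∷ T) = begin
      ⊇-count (∣ T ∣ + suc d) (outside ∷ T)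
        ≡⟨ cong (λ c → ⊇-count c (outside ∷ T)) (+-suc (∣ T ∣) d) ⟩
      ⊇-count (suc (∣ T ∣ + d)) (outside ∷ T)
        ≡⟨ count-out (∣ T ∣ + d) T ⟩
      ⊇-count (∣ T ∣ + d) T ℤ.+ ⊇-count (suc (∣ T ∣ + d)) T
        ≡⟨ cong (λ c → ⊇-count (∣ T ∣ + d) T ℤ.+ ⊇-count c T) (+-suc (∣ T ∣) d) ⟨
      ⊇-count (∣ T ∣ + d) T ℤ.+ ⊇-count (∣ T ∣ + suc d) T
        ≡⟨ cong₂ ℤ._+_ (count-C d T) (count-C (suc d) T) ⟩
      + ((n ∸ ∣ T ∣) C d + (n ∸ ∣ T ∣) C suc d)
        ≡⟨ cong +_ (nCk+nC[k+1]≡[n+1]C[k+1] (n ∸ ∣ T ∣) d) ⟩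
      + (suc (n ∸ ∣ T ∣) C suc d)
        ≡⟨ cong (λ k → + (k C suc d)) (+-∸-assoc 1 (∣p∣≤n T)) ⟨
      + ((suc n ∸ ∣ T ∣) C suc d)
        ∎
    -- The sets have exactly ∣T∣ elements. Taking a first vertex outside `T` leaves too few places
    -- for `T`, so that summand is 0; for empty `T` it does not arise.
    count-C {suc n} zero (outside ∷ T) = start (∣ T ∣) refl
      where
      start : ∀ t → ∣ T ∣ ≡ t → ⊇-count (∣ T ∣ + 0) (outside ∷ T) ≡ + ((suc n ∸ ∣ T ∣) C 0)
      start zero T≡0 = begin
        ⊇-count (∣ T ∣ + 0) (outside ∷ T)   ≡⟨ cong (λ c → ⊇-count (c + 0) (outside ∷ T)) T≡0 ⟩
        ⊇-count 0 (outside ∷ T)             ≡⟨ count-out-zero T ⟩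
        ⊇-count 0 T                         ≡⟨ cong (λ c → ⊇-count (c + 0) T) T≡0 ⟨
        ⊇-count (∣ T ∣ + 0) T               ≡⟨ count-C 0 T ⟩
        1ℤ                                  ∎
      start (suc t) T≡1+t = begin
        ⊇-count (∣ T ∣ + 0) (outside ∷ T)        ≡⟨ cong (λ c → ⊇-count c (outside ∷ T)) (trans (+-identityʳ (∣ T ∣)) T≡1+t) ⟩
        ⊇-count (suc t) (outside ∷ T)            ≡⟨ count-out t T ⟩
        ⊇-count t T ℤ.+ ⊇-count (suc t) T        ≡⟨ cong (ℤ._+ ⊇-count (suc t) T) (count-small t T (≤-reflexive (sym T≡1+t))) ⟩
        0ℤ ℤ.+ ⊇-count (suc t) T                 ≡⟨ ℤ.+-identityˡ _ ⟩
        ⊇-count (suc t) T                        ≡⟨ cong (λ c → ⊇-count c T) (trans (+-identityʳ (∣ T ∣)) T≡1+t) ⟨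
        ⊇-count (∣ T ∣ + 0) T                    ≡⟨ count-C 0 T ⟩
        1ℤ                                       ∎

  ∑ₗ-⊇ : ∀ {n} d (T : Subset n) → ∑ₗ (λ S → χ (T ⊆? S)) (subsetsOfSize n (∣ T ∣ + d)) ≡ + ((n ∸ ∣ T ∣) C d)
  ∑ₗ-⊇ {n} d T = trans (∑ₗ-filter (λ S → ∣ S ∣ ≟ ∣ T ∣ + d) (λ S → χ (T ⊆? S)) (subsets n)) (count-C d T)

-- The two moments of the induced size in terms of edges and adjacent pairs.

module Moments where
  open Indicators
  open InducedSizes
  open Selections using (insertAll)
  open Balances using (∣insertAll∣)
  open Rationals
  open Means
  open Subsets
  open import Data.Fin.Subset using (∣_∣; ⊥)
  open import Data.List using ([]; _∷_; map)
  open import Data.List.Relation.Unary.All using ([]; _∷_)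
  open import Data.List.Relation.Unary.AllPairs using ([]; _∷_)
  open import Data.Nat using (suc; _∸_)
  open import Data.Rational using (_+_; _-_; _*_; -_; _<_)
  open import Tactic.RingSolver using (solve-∀)
  open ≡-Reasoning

  Pair : ℕ → Set
  Pair n = Fin n × Fin n

  ∏ : ∀ {n} → List (Fin n) → Subset n → ℤ
  ∏ []       S = 1ℤ
  ∏ (v ∷ vs) S = ⟦ S ⟧ v ℤ.* ∏ vs S

  ∏≡χ⊆ : ∀ {n} (vs : List (Fin n)) S → ∏ vs S ≡ χ (insertAll vs ⊥ ⊆? S)
  ∏≡χ⊆ []       S = sym (χ-yes (⊥ ⊆? S) (λ x∈⊥ → contradiction x∈⊥ ∉⊥))
  ∏≡χ⊆ (v ∷ vs) S = trans (cong (⟦ S ⟧ v ℤ.*_) (∏≡χ⊆ vs S)) (trans (sym (χ-× (v ∈? S) (insertAll vs ⊥ ⊆? S)))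
    (χ-cong ((v ∈? S) ×-dec (insertAll vs ⊥ ⊆? S)) (insertAll (v ∷ vs) ⊥ ⊆? S) to from))
    where
    to : v ∈ S × insertAll vs ⊥ ⊆ S → insertAll (v ∷ vs) ⊥ ⊆ S
    to (v∈S , vs⊆S) x∈ with ∈insert⁻ x∈
    ... | inj₁ refl = v∈S
    ... | inj₂ x∈vs = vs⊆S x∈vs
    from : insertAll (v ∷ vs) ⊥ ⊆ S → v ∈ S × insertAll vs ⊥ ⊆ S
    from ⊆S = ⊆S (v∈insert v (insertAll vs ⊥)) , λ x∈ → ⊆S (⊆insert x∈)

  both : ∀ {n} → Subset n → Pair n → ℤ
  both S (i , j) = ⟦ S ⟧ i ℤ.* ⟦ S ⟧ j

  inside-count : ∀ {n} → List (Pair n) → Subset n → ℤ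
  inside-count L S = ∑ₗ (both S) L

  meets : ∀ {n} → Fin n → Pair n → ℤ
  meets v (k , l) = χ (v Fin.≟ k) ℤ.+ χ (v Fin.≟ l)

  degree : ∀ {n} → List (Pair n) → Fin n → ℤ
  degree L v = ∑ₗ (meets v) L

  -- Each adjacent pair of edges is counted when the one nearer the head is added. This recurrence
  -- is also what the program executes.
  adjacent-pairs : ∀ {n} → List (Pair n) → ℤ
  adjacent-pairs []            = 0ℤ
  adjacent-pairs ((i , j) ∷ L) = adjacent-pairs L ℤ.+ (degree L i ℤ.+ degree L j)

  -- Excludes loops and the two orientations of one edge, so distinct pairs share at most one
  -- vertex.
  Increasing : ∀ {n} → Pair n → Set
  Increasing (i , j) = i Fin.< j

  module _ {n} (G : Graph n) where

    -- Stated for every ordering of the edges, since the input of the program lists them in an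
    -- arbitrary order.
    inducedSize≡inside-count : ∀ {L} → L ↭ edges G → ∀ S → + inducedSize G S ≡ inside-count L S
    inducedSize≡inside-count {L} L↭ S = begin
      + inducedSize G S
        ≡⟨ length-filter≡∑ₗ inS? (edges G) ⟩
      ∑ₗ (λ e → χ (inS? e)) (edges G)
        ≡⟨ ∑ₗ-cong (λ (i , j) → χ-× (i ∈? S) (j ∈? S)) (edges G) ⟩
      inside-count (edges G) S
        ≡⟨ ∑ₗ-↭ (both S) (↭-sym L↭) ⟩
      inside-count L S
        ∎
      where
      inS? : ∀ ((i , j) : Pair n) → Dec (i ∈ S × j ∈ S)
      inS? (i , j) = (i ∈? S) ×-dec (j ∈? S)
      ∑ₗ-↭ : ∀ (f : Pair n → ℤ) {xs ys} → xs ↭ ys → ∑ₗ f xs ≡ ∑ₗ f ys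
      ∑ₗ-↭ f ↭.refl          = refl
      ∑ₗ-↭ f (↭.prep x p)    = cong (λ s → f x ℤ.+ s) (∑ₗ-↭ f p)
      ∑ₗ-↭ f {_ ∷ _ ∷ xs} (↭.swap x y p) = trans (exchange (f x) (f y) (∑ₗ f xs)) (cong (λ s → f y ℤ.+ (f x ℤ.+ s)) (∑ₗ-↭ f p))
        where
        exchange : ∀ a b s → a ℤ.+ (b ℤ.+ s) ≡ b ℤ.+ (a ℤ.+ s)
        exchange = solveℤ-∀
      ∑ₗ-↭ f (↭.trans p q)   = trans (∑ₗ-↭ f p) (∑ₗ-↭ f q)

    edges-increasing : ∀ {L} → L ↭ edges G → All Increasing L
    edges-increasing L↭ = ↭.All-resp-↭ (↭-sym L↭) (All.map proj₁
      (All.all-filter (λ (i , j) → (i Fin.<? j) ×-dec adj? G i j) (cartesianProduct (allFin n) (allFin n))))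

    edges-unique : ∀ {L} → L ↭ edges G → Unique L
    edges-unique L↭ = ↭ₛ.Unique-resp-↭ (setoid (Pair n)) (↭.↭⇒↭ₛ (↭-sym L↭))
      (Unique.filter⁺ (λ (i , j) → (i Fin.<? j) ×-dec adj? G i j) (Unique.cartesianProduct⁺ (Unique.allFin⁺ n) (Unique.allFin⁺ n)))

  module _ (n c : ℕ) (nonempty : 0 ℕ.< length (subsetsOfSize n c)) where

    private
      xs : List (Subset n)
      xs = subsetsOfSize n c

      N : ℚ
      N = fromℕ (length xs)

      0<N : 0ℚ < N
      0<N = fromℤ-mono-< {+ 0} {+ length xs} (ℤ.+<+ nonempty)

    𝔼ℤ : (Subset n → ℤ) → ℚ
    𝔼ℤ f = mean xs (λ S → fromℤ (f S))

    𝔼ℤ-cong : ∀ {f g} → f ≗ g → 𝔼ℤ f ≡ 𝔼ℤ g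
    𝔼ℤ-cong f≗g = mean-cong xs (λ {S} _ → cong fromℤ (f≗g S))

    𝔼ℤ-+ : ∀ f g → 𝔼ℤ (λ S → f S ℤ.+ g S) ≡ 𝔼ℤ f + 𝔼ℤ g
    𝔼ℤ-+ f g = trans (mean-cong xs (λ {S} _ → fromℤ-+ (f S) (g S))) (mean-+ xs nonempty (λ S → fromℤ (f S)) (λ S → fromℤ (g S)))

    𝔼ℤ-* : ∀ k f → 𝔼ℤ (λ S → k ℤ.* f S) ≡ fromℤ k * 𝔼ℤ f
    𝔼ℤ-* k f = trans (mean-cong xs (λ {S} _ → fromℤ-* k (f S))) (mean-scale xs nonempty (fromℤ k) (λ S → fromℤ (f S)))

    𝔼ℤ-const : ∀ k → 𝔼ℤ (λ _ → k) ≡ fromℤ k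
    𝔼ℤ-const k = mean-const xs nonempty (fromℤ k)

    -- The probability that k given vertices all belong to the random set.
    P : ℕ → ℚ
    P k = fromℕ ((n ∸ k) C (c ∸ k)) ⟋ N

    -- After multiplication by N this is `absorption` at n - k - 1 and c - k - 1.
    P-suc : ∀ k → k ℕ.< c → k ℕ.< n → P (suc k) * fromℕ (n ∸ k) ≡ P k * fromℕ (c ∸ k)
    P-suc k k<c k<n = *-cancelʳ-≡ 0<N (begin
      P (suc k) * fromℕ (n ∸ k) * N
        ≡⟨ swap (P (suc k)) (fromℕ (n ∸ k)) N ⟩
      fromℕ (n ∸ k) * (P (suc k) * N)
        ≡⟨ cong (fromℕ (n ∸ k) *_) (⟋-* (fromℕ ((n ∸ suc k) C (c ∸ suc k))) 0<N) ⟩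
      fromℕ (n ∸ k) * fromℕ ((n ∸ suc k) C (c ∸ suc k))
        ≡⟨ fromℕ-* (n ∸ k) ((n ∸ suc k) C (c ∸ suc k)) ⟨
      fromℕ ((n ∸ k) ℕ.* ((n ∸ suc k) C (c ∸ suc k)))
        ≡⟨ cong fromℕ (trans (cong (ℕ._* ((n ∸ suc k) C (c ∸ suc k))) n∸k)
             (trans (sym (absorption (n ∸ suc k) (c ∸ suc k))) (sym (cong₂ (λ a b → a ℕ.* (b C a)) c∸k n∸k)))) ⟩
      fromℕ ((c ∸ k) ℕ.* ((n ∸ k) C (c ∸ k)))
        ≡⟨ fromℕ-* (c ∸ k) ((n ∸ k) C (c ∸ k)) ⟩
      fromℕ (c ∸ k) * fromℕ ((n ∸ k) C (c ∸ k))
        ≡⟨ cong (fromℕ (c ∸ k) *_) (⟋-* (fromℕ ((n ∸ k) C (c ∸ k))) 0<N) ⟨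
      fromℕ (c ∸ k) * (P k * N)
        ≡⟨ swap (P k) (fromℕ (c ∸ k)) N ⟨
      P k * fromℕ (c ∸ k) * N
        ∎)
      where
      n∸k : n ∸ k ≡ suc (n ∸ suc k)
      n∸k = ℕ.+-∸-assoc 1 k<n
      c∸k : c ∸ k ≡ suc (c ∸ suc k)
      c∸k = ℕ.+-∸-assoc 1 k<c
      fromℕ-* : ∀ a b → fromℕ (a ℕ.* b) ≡ fromℕ a * fromℕ b
      fromℕ-* a b = trans (cong fromℤ (ℤ.pos-* a b)) (fromℤ-* (+ a) (+ b))
      swap : ∀ p a b → p * a * b ≡ a * (p * b)
      swap = solve-∀ ℚ-ring

    𝔼ℤ-∏ : ∀ {vs} → Unique vs → length vs ℕ.≤ c → 𝔼ℤ (∏ vs) ≡ P (length vs)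
    𝔼ℤ-∏ {vs} unique vs≤c = *-cancelʳ-≡ 0<N (begin
      𝔼ℤ (∏ vs) * N
        ≡⟨ mean-* xs nonempty (λ S → fromℤ (∏ vs S)) ⟩
      sum (map (λ S → fromℤ (∏ vs S)) xs)
        ≡⟨ sum-fromℤ (∏ vs) xs ⟩
      fromℤ (∑ₗ (∏ vs) xs)
        ≡⟨ cong fromℤ (trans (∑ₗ-cong (∏≡χ⊆ vs) xs) count) ⟩
      fromℕ ((n ∸ length vs) C (c ∸ length vs))
        ≡⟨ ⟋-* (fromℕ ((n ∸ length vs) C (c ∸ length vs))) 0<N ⟨
      P (length vs) * N
        ∎)
      where
      sum-fromℤ : ∀ (f : Subset n → ℤ) ys → sum (map (λ S → fromℤ (f S)) ys) ≡ fromℤ (∑ₗ f ys)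
      sum-fromℤ f []       = refl
      sum-fromℤ f (y ∷ ys) = trans (cong (λ s → fromℤ (f y) + s) (sum-fromℤ f ys)) (sym (fromℤ-+ (f y) (∑ₗ f ys)))
      T : Subset n
      T = insertAll vs ⊥
      ∣T∣ : ∣ T ∣ ≡ length vs
      ∣T∣ = trans (∣insertAll∣ unique (All.universal (λ _ → ∉⊥) vs)) (trans (cong (λ k → length vs ℕ.+ k) (∣⊥∣≡0 n)) (ℕ.+-identityʳ _))
      count : ∑ₗ (λ S → χ (T ⊆? S)) xs ≡ + ((n ∸ length vs) C (c ∸ length vs))
      count = begin
        ∑ₗ (λ S → χ (T ⊆? S)) (subsetsOfSize n c)
          ≡⟨ cong (λ c → ∑ₗ (λ S → χ (T ⊆? S)) (subsetsOfSize n c)) (trans (cong (ℕ._+ (c ∸ length vs)) ∣T∣) (ℕ.m+[n∸m]≡n vs≤c)) ⟨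
        ∑ₗ (λ S → χ (T ⊆? S)) (subsetsOfSize n (∣ T ∣ ℕ.+ (c ∸ length vs)))
          ≡⟨ ∑ₗ-⊇ (c ∸ length vs) T ⟩
        + ((n ∸ ∣ T ∣) C (c ∸ length vs))
          ≡⟨ cong (λ t → + ((n ∸ t) C (c ∸ length vs))) ∣T∣ ⟩
        + ((n ∸ length vs) C (c ∸ length vs))
          ∎

    private
      -- The `meets` terms count the common ends of the two edges. This number is 0, and four
      -- vertices are involved, or it is 1, and there are three.
      pair-moment : ∀ {e f} → Increasing e → Increasing f → e ≢ f → 4 ℕ.≤ c →
        𝔼ℤ (λ S → both S e ℤ.* both S f) ≡ P 4 + fromℤ (meets (proj₁ e) f ℤ.+ meets (proj₂ e) f) * (P 3 - P 4)
      pair-moment {i , j} {k , l} i<j k<l e≢f 4≤c = cases (i Fin.≟ k) (i Fin.≟ l) (j Fin.≟ k) (j Fin.≟ l)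
        where
        i≢j : i ≢ j
        i≢j refl = Fin.<-irrefl refl i<j
        k≢l : k ≢ l
        k≢l refl = Fin.<-irrefl refl k<l

        conclude-3 : ∀ {x y z} → x ≢ y → x ≢ z → y ≢ z →
          (∀ S → both S (i , j) ℤ.* both S (k , l) ≡ ∏ (x ∷ y ∷ z ∷ []) S) →
          ∀ {m} → m ≡ 1ℤ → 𝔼ℤ (λ S → both S (i , j) ℤ.* both S (k , l)) ≡ P 4 + fromℤ m * (P 3 - P 4)
        conclude-3 {x} {y} {z} x≢y x≢z y≢z product refl = begin
          𝔼ℤ (λ S → both S (i , j) ℤ.* both S (k , l))
            ≡⟨ 𝔼ℤ-cong product ⟩
          𝔼ℤ (∏ (x ∷ y ∷ z ∷ []))
            ≡⟨ 𝔼ℤ-∏ ((x≢y ∷ x≢z ∷ []) ∷ (y≢z ∷ []) ∷ [] ∷ []) (ℕ.≤-trans (ℕ.n≤1+n 3) 4≤c) ⟩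
          P 3
            ≡⟨ once (P 3) (P 4) ⟩
          P 4 + 1ℚ * (P 3 - P 4)
            ∎
          where
          once : ∀ p q → p ≡ q + 1ℚ * (p - q)
          once = solve-∀ ℚ-ring

        conclude-4 : i ≢ k → i ≢ l → j ≢ k → j ≢ l → ∀ {m} → m ≡ 0ℤ →
          𝔼ℤ (λ S → both S (i , j) ℤ.* both S (k , l)) ≡ P 4 + fromℤ m * (P 3 - P 4)
        conclude-4 i≢k i≢l j≢k j≢l refl = begin
          𝔼ℤ (λ S → both S (i , j) ℤ.* both S (k , l))
            ≡⟨ 𝔼ℤ-cong (λ S → regroup (⟦ S ⟧ i) (⟦ S ⟧ j) (⟦ S ⟧ k) (⟦ S ⟧ l)) ⟩
          𝔼ℤ (∏ (i ∷ j ∷ k ∷ l ∷ []))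
            ≡⟨ 𝔼ℤ-∏ ((i≢j ∷ i≢k ∷ i≢l ∷ []) ∷ (j≢k ∷ j≢l ∷ []) ∷ (k≢l ∷ []) ∷ [] ∷ []) 4≤c ⟩
          P 4
            ≡⟨ never (P 3) (P 4) ⟩
          P 4 + 0ℚ * (P 3 - P 4)
            ∎
          where
          regroup : ∀ a b c d → (a ℤ.* b) ℤ.* (c ℤ.* d) ≡ a ℤ.* (b ℤ.* (c ℤ.* (d ℤ.* 1ℤ)))
          regroup = solveℤ-∀
          never : ∀ p q → q ≡ q + 0ℚ * (p - q)
          never = solve-∀ ℚ-ring

        four : ∀ {w x y z w′ x′ y′ z′} → w ≡ w′ → x ≡ x′ → y ≡ y′ → z ≡ z′ →
          (w ℤ.+ x) ℤ.+ (y ℤ.+ z) ≡ (w′ ℤ.+ x′) ℤ.+ (y′ ℤ.+ z′)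
        four refl refl refl refl = refl

        duplicate : ∀ S x y z {t} → t ≡ ⟦ S ⟧ x ℤ.* ⟦ S ⟧ x ℤ.* (⟦ S ⟧ y ℤ.* ⟦ S ⟧ z) → t ≡ ∏ (x ∷ y ∷ z ∷ []) S
        duplicate S x y z eq = trans eq (trans (cong (ℤ._* (⟦ S ⟧ y ℤ.* ⟦ S ⟧ z)) (χ-idem (x ∈? S))) (regroup (⟦ S ⟧ x) (⟦ S ⟧ y) (⟦ S ⟧ z)))
          where
          regroup : ∀ a b c → a ℤ.* (b ℤ.* c) ≡ a ℤ.* (b ℤ.* (c ℤ.* 1ℤ))
          regroup = solveℤ-∀

        cases : Dec (i ≡ k) → Dec (i ≡ l) → Dec (j ≡ k) → Dec (j ≡ l) →
          𝔼ℤ (λ S → both S (i , j) ℤ.* both S (k , l)) ≡ P 4 + fromℤ (meets i (k , l) ℤ.+ meets j (k , l)) * (P 3 - P 4)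
        cases (no i≢k)   (no i≢l)   (no j≢k)   (no j≢l)   = conclude-4 i≢k i≢l j≢k j≢l
          (four (χ-no (i Fin.≟ k) i≢k) (χ-no (i Fin.≟ l) i≢l) (χ-no (j Fin.≟ k) j≢k) (χ-no (j Fin.≟ l) j≢l))
        cases (yes refl) i≟l        j≟k        (yes refl) = contradiction refl e≢f
        cases (yes refl) i≟l        j≟k        (no j≢l)   = conclude-3 i≢j k≢l j≢l
          (λ S → duplicate S i j l (regroup (⟦ S ⟧ i) (⟦ S ⟧ j) (⟦ S ⟧ l)))
          (four (χ-yes (i Fin.≟ i) refl) (χ-no (i Fin.≟ l) k≢l) (χ-no (j Fin.≟ i) (≢-sym i≢j)) (χ-no (j Fin.≟ l) j≢l))
          where
          regroup : ∀ a b c → (a ℤ.* b) ℤ.* (a ℤ.* c) ≡ a ℤ.* a ℤ.* (b ℤ.* c)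
          regroup = solveℤ-∀
        cases (no i≢k)   (yes refl) (yes refl) j≟l        = contradiction k<l (Fin.<-asym i<j)
        cases (no i≢k)   (yes refl) (no j≢k)   j≟l        = conclude-3 i≢j i≢k j≢k
          (λ S → duplicate S i j k (regroup (⟦ S ⟧ i) (⟦ S ⟧ j) (⟦ S ⟧ k)))
          (four (χ-no (i Fin.≟ k) i≢k) (χ-yes (i Fin.≟ i) refl) (χ-no (j Fin.≟ k) j≢k) (χ-no (j Fin.≟ i) (≢-sym i≢j)))
          where
          regroup : ∀ a b c → (a ℤ.* b) ℤ.* (c ℤ.* a) ≡ a ℤ.* a ℤ.* (b ℤ.* c)
          regroup = solveℤ-∀
        cases (no i≢k)   (no i≢l)   (yes refl) j≟l        = conclude-3 (≢-sym i≢j) k≢l i≢l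
          (λ S → duplicate S j i l (regroup (⟦ S ⟧ i) (⟦ S ⟧ j) (⟦ S ⟧ l)))
          (four (χ-no (i Fin.≟ j) i≢j) (χ-no (i Fin.≟ l) i≢l) (χ-yes (j Fin.≟ j) refl) (χ-no (j Fin.≟ l) k≢l))
          where
          regroup : ∀ a b c → (a ℤ.* b) ℤ.* (b ℤ.* c) ≡ b ℤ.* b ℤ.* (a ℤ.* c)
          regroup = solveℤ-∀
        cases (no i≢k)   (no i≢l)   (no j≢k)   (yes refl) = conclude-3 (≢-sym i≢j) j≢k i≢k
          (λ S → duplicate S j i k (regroup (⟦ S ⟧ i) (⟦ S ⟧ j) (⟦ S ⟧ k)))
          (four (χ-no (i Fin.≟ k) i≢k) (χ-no (i Fin.≟ j) i≢j) (χ-no (j Fin.≟ k) j≢k) (χ-yes (j Fin.≟ j) refl))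
          where
          regroup : ∀ a b c → (a ℤ.* b) ℤ.* (c ℤ.* b) ≡ b ℤ.* b ℤ.* (a ℤ.* c)
          regroup = solveℤ-∀

    first-moment : ∀ {L} → All Increasing L → 2 ℕ.≤ c → 𝔼ℤ (inside-count L) ≡ fromℕ (length L) * P 2
    first-moment []  2≤c = trans (𝔼ℤ-const 0ℤ) (sym (ℚ.*-zeroˡ (P 2)))
    first-moment {(i , j) ∷ L} (i<j ∷ increasing) 2≤c = begin
      𝔼ℤ (λ S → both S (i , j) ℤ.+ inside-count L S)
        ≡⟨ 𝔼ℤ-+ (λ S → both S (i , j)) (inside-count L) ⟩
      𝔼ℤ (λ S → both S (i , j)) + 𝔼ℤ (inside-count L)
        ≡⟨ cong₂ _+_ (trans (𝔼ℤ-cong (λ S → cong (⟦ S ⟧ i ℤ.*_) (sym (ℤ.*-identityʳ (⟦ S ⟧ j)))))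
             (𝔼ℤ-∏ {i ∷ j ∷ []} (((λ { refl → Fin.<-irrefl refl i<j }) ∷ []) ∷ [] ∷ []) 2≤c)) (first-moment increasing 2≤c) ⟩
      P 2 + fromℕ (length L) * P 2
        ≡⟨ factor (P 2) (fromℕ (length L)) ⟩
      (1ℚ + fromℕ (length L)) * P 2
        ≡⟨ cong (_* P 2) (fromℤ-+ 1ℤ (+ length L)) ⟨
      fromℕ (suc (length L)) * P 2
        ∎
      where
      factor : ∀ p l → p + l * p ≡ (1ℚ + l) * p
      factor = solve-∀ ℚ-ring

    private
      cross-moment : ∀ {e L} → Increasing e → All Increasing L → All (e ≢_) L → 4 ℕ.≤ c →
        𝔼ℤ (λ S → both S e ℤ.* inside-count L S) ≡
        fromℕ (length L) * P 4 + fromℤ (degree L (proj₁ e) ℤ.+ degree L (proj₂ e)) * (P 3 - P 4)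
      cross-moment {e} {[]} inc [] [] 4≤c = begin
        𝔼ℤ (λ S → both S e ℤ.* 0ℤ)          ≡⟨ 𝔼ℤ-cong (λ S → ℤ.*-zeroʳ (both S e)) ⟩
        𝔼ℤ (λ _ → 0ℤ)                       ≡⟨ 𝔼ℤ-const 0ℤ ⟩
        0ℚ                                  ≡⟨ vanish (P 4) (P 3 - P 4) ⟩
        0ℚ * P 4 + 0ℚ * (P 3 - P 4)         ∎
        where
        vanish : ∀ p q → 0ℚ ≡ 0ℚ * p + 0ℚ * q
        vanish = solve-∀ ℚ-ring
      cross-moment {e} {f ∷ L} inc (incf ∷ incL) (e≢f ∷ e∉L) 4≤c = begin
        𝔼ℤ (λ S → both S e ℤ.* (both S f ℤ.+ inside-count L S))
          ≡⟨ 𝔼ℤ-cong (λ S → ℤ.*-distribˡ-+ (both S e) (both S f) (inside-count L S)) ⟩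
        𝔼ℤ (λ S → both S e ℤ.* both S f ℤ.+ both S e ℤ.* inside-count L S)
          ≡⟨ 𝔼ℤ-+ (λ S → both S e ℤ.* both S f) (λ S → both S e ℤ.* inside-count L S) ⟩
        𝔼ℤ (λ S → both S e ℤ.* both S f) + 𝔼ℤ (λ S → both S e ℤ.* inside-count L S)
          ≡⟨ cong₂ _+_ (pair-moment inc incf e≢f 4≤c) (cross-moment inc incL e∉L 4≤c) ⟩
        (P 4 + fromℤ m * q) + (fromℕ (length L) * P 4 + fromℤ d * q)
          ≡⟨ collect (P 4) q (fromℤ m) (fromℕ (length L)) (fromℤ d) ⟩
        (1ℚ + fromℕ (length L)) * P 4 + (fromℤ m + fromℤ d) * q
          ≡⟨ cong₂ (λ l s → l * P 4 + s * q) (fromℤ-+ 1ℤ (+ length L)) (fromℤ-+ m d) ⟨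
        fromℕ (suc (length L)) * P 4 + fromℤ (m ℤ.+ d) * q
          ≡⟨ cong (λ s → fromℕ (suc (length L)) * P 4 + fromℤ s * q) (regroup (meets (proj₁ e) f) (meets (proj₂ e) f) (degree L (proj₁ e)) (degree L (proj₂ e))) ⟩
        fromℕ (suc (length L)) * P 4 + fromℤ (degree (f ∷ L) (proj₁ e) ℤ.+ degree (f ∷ L) (proj₂ e)) * q
          ∎
        where
        q : ℚ
        q = P 3 - P 4
        m d : ℤ
        m = meets (proj₁ e) f ℤ.+ meets (proj₂ e) f
        d = degree L (proj₁ e) ℤ.+ degree L (proj₂ e)
        collect : ∀ p q m l d → (p + m * q) + (l * p + d * q) ≡ (1ℚ + l) * p + (m + d) * q
        collect = solve-∀ ℚ-ring
        regroup : ∀ a b x y → (a ℤ.+ b) ℤ.+ (x ℤ.+ y) ≡ (a ℤ.+ x) ℤ.+ (b ℤ.+ y)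
        regroup = solveℤ-∀

    -- Adding an edge e to L changes X (X - 1) by twice the product of the
    -- indicator of e and the old X.
    second-moment : ∀ {L} → All Increasing L → Unique L → 4 ℕ.≤ c →
      𝔼ℤ (λ S → inside-count L S ℤ.* (inside-count L S ℤ.- 1ℤ)) ≡
      fromℤ (+ length L ℤ.* (+ length L ℤ.- 1ℤ)) * P 4 + fromℤ (+ 2 ℤ.* adjacent-pairs L) * (P 3 - P 4)
    second-moment [] [] 4≤c = trans (𝔼ℤ-const 0ℤ) (vanish (P 4) (P 3 - P 4))
      where
      vanish : ∀ p q → 0ℚ ≡ 0ℚ * p + 0ℚ * q
      vanish = solve-∀ ℚ-ring
    second-moment {e ∷ L} (inc ∷ incL) (e∉L ∷ unique) 4≤c = begin
      𝔼ℤ (λ S → (both S e ℤ.+ X S) ℤ.* (both S e ℤ.+ X S ℤ.- 1ℤ))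
        ≡⟨ 𝔼ℤ-cong (λ S → trans (expand (both S e) (X S)) (trans (cong (λ b → b ℤ.+ (X S ℤ.* (X S ℤ.- 1ℤ) ℤ.+ + 2 ℤ.* (both S e ℤ.* X S) ℤ.- both S e)) (square S)) (simplify (both S e) (X S)))) ⟩
      𝔼ℤ (λ S → X S ℤ.* (X S ℤ.- 1ℤ) ℤ.+ + 2 ℤ.* (both S e ℤ.* X S))
        ≡⟨ 𝔼ℤ-+ (λ S → X S ℤ.* (X S ℤ.- 1ℤ)) (λ S → + 2 ℤ.* (both S e ℤ.* X S)) ⟩
      𝔼ℤ (λ S → X S ℤ.* (X S ℤ.- 1ℤ)) + 𝔼ℤ (λ S → + 2 ℤ.* (both S e ℤ.* X S))
        ≡⟨ cong₂ _+_ (second-moment incL unique 4≤c) (trans (𝔼ℤ-* (+ 2) (λ S → both S e ℤ.* X S))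
             (cong (fromℤ (+ 2) *_) (cross-moment inc incL e∉L 4≤c))) ⟩
      fromℤ (l ℤ.* (l ℤ.- 1ℤ)) * P 4 + fromℤ (+ 2 ℤ.* a) * q + fromℤ (+ 2) * (fromℤ l * P 4 + fromℤ d * q)
        ≡⟨ collect (fromℤ (l ℤ.* (l ℤ.- 1ℤ))) (fromℤ (+ 2 ℤ.* a)) (fromℤ (+ 2)) (fromℤ l) (fromℤ d) (P 4) q ⟩
      (fromℤ (l ℤ.* (l ℤ.- 1ℤ)) + fromℤ (+ 2) * fromℤ l) * P 4 + (fromℤ (+ 2 ℤ.* a) + fromℤ (+ 2) * fromℤ d) * q
        ≡⟨ cong₂ (λ x y → x * P 4 + y * q) (casts (l ℤ.* (l ℤ.- 1ℤ)) l) (casts (+ 2 ℤ.* a) d) ⟨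
      fromℤ (l ℤ.* (l ℤ.- 1ℤ) ℤ.+ + 2 ℤ.* l) * P 4 + fromℤ (+ 2 ℤ.* a ℤ.+ + 2 ℤ.* d) * q
        ≡⟨ cong₂ (λ x y → fromℤ x * P 4 + fromℤ y * q) (grow l) (sym (ℤ.*-distribˡ-+ (+ 2) a d)) ⟩
      fromℤ ((1ℤ ℤ.+ l) ℤ.* ((1ℤ ℤ.+ l) ℤ.- 1ℤ)) * P 4 + fromℤ (+ 2 ℤ.* (a ℤ.+ d)) * q
        ∎
      where
      X : Subset n → ℤ
      X = inside-count L
      q : ℚ
      q = P 3 - P 4
      l a d : ℤ
      l = + length L
      a = adjacent-pairs L
      d = degree L (proj₁ e) ℤ.+ degree L (proj₂ e)
      casts : ∀ x y → fromℤ (x ℤ.+ + 2 ℤ.* y) ≡ fromℤ x + fromℤ (+ 2) * fromℤ y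
      casts x y = trans (fromℤ-+ x (+ 2 ℤ.* y)) (cong (λ z → fromℤ x + z) (fromℤ-* (+ 2) y))
      collect : ∀ x y t l d p q → x * p + y * q + t * (l * p + d * q) ≡ (x + t * l) * p + (y + t * d) * q
      collect = solve-∀ ℚ-ring
      grow : ∀ l → l ℤ.* (l ℤ.- 1ℤ) ℤ.+ + 2 ℤ.* l ≡ (1ℤ ℤ.+ l) ℤ.* ((1ℤ ℤ.+ l) ℤ.- 1ℤ)
      grow = solveℤ-∀
      expand : ∀ b x → (b ℤ.+ x) ℤ.* (b ℤ.+ x ℤ.- 1ℤ) ≡ b ℤ.* b ℤ.+ (x ℤ.* (x ℤ.- 1ℤ) ℤ.+ + 2 ℤ.* (b ℤ.* x) ℤ.- b)
      expand = solveℤ-∀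
      simplify : ∀ b x → b ℤ.+ (x ℤ.* (x ℤ.- 1ℤ) ℤ.+ + 2 ℤ.* (b ℤ.* x) ℤ.- b) ≡ x ℤ.* (x ℤ.- 1ℤ) ℤ.+ + 2 ℤ.* (b ℤ.* x)
      simplify = solveℤ-∀
      square : ∀ S → both S e ℤ.* both S e ≡ both S e
      square S = trans (regroup (⟦ S ⟧ (proj₁ e)) (⟦ S ⟧ (proj₂ e)))
        (cong₂ ℤ._*_ (χ-idem (proj₁ e ∈? S)) (χ-idem (proj₂ e ∈? S)))
        where
        regroup : ∀ s t → (s ℤ.* t) ℤ.* (s ℤ.* t) ≡ (s ℤ.* s) ℤ.* (t ℤ.* t)
        regroup = solveℤ-∀

-- The bounds as quotients of integer polynomials.

module ClosedForms where
  open Rationals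
  open Means
  open Moments
  open Extremes using (subsets-nonempty)
  open Bounds
  open import Data.Nat using (suc; _∸_)
  open import Data.Rational using (_+_; _-_; _*_; -_; _<_)
  open import Tactic.RingSolver using (solve-∀)
  open ≡-Reasoning

  module _ (n m c A : ℤ) where

    -- A is twice the number of pairs of adjacent edges.  For ℓ⋆ ≥ 0 the lower bound
    -- is lowerNumerator / lowerDenominator, whatever ℓ⋆ is.
    pairTerm lowerNumerator lowerDenominator : ℤ
    pairTerm         = A ℤ.* (n ℤ.- + 3) ℤ.+ (m ℤ.* (m ℤ.- + 1) ℤ.- A) ℤ.* (c ℤ.- + 3)
    lowerDenominator = m ℤ.* ((n ℤ.- + 2) ℤ.* (n ℤ.- + 3))
    lowerNumerator   = (c ℤ.- + 2) ℤ.* pairTerm ℤ.+ lowerDenominator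

    -- By the variance formula the bound is (S₁ (u - 1) - 2 S₂) / (u - S₁); both parts are
    -- multiplied by n (n - 1) (n - 2) (n - 3).
    upperNumerator upperDenominator : ℤ → ℤ
    upperNumerator u   = (c ℤ.* (c ℤ.- + 1)) ℤ.* ((m ℤ.* (u ℤ.- + 1)) ℤ.* ((n ℤ.- + 2) ℤ.* (n ℤ.- + 3)) ℤ.- (c ℤ.- + 2) ℤ.* pairTerm)
    upperDenominator u = ((n ℤ.- + 2) ℤ.* (n ℤ.- + 3)) ℤ.* (u ℤ.* (n ℤ.* (n ℤ.- + 1)) ℤ.- m ℤ.* (c ℤ.* (c ℤ.- + 1)))

  private
    infixl 7 _⊠_
    infixl 6 _⊞_ _⊟_

    _⊞_ : ∀ {a b x y} → fromℤ a ≡ x → fromℤ b ≡ y → fromℤ (a ℤ.+ b) ≡ x + y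
    _⊞_ {a} {b} refl refl = fromℤ-+ a b

    _⊟_ : ∀ {a b x y} → fromℤ a ≡ x → fromℤ b ≡ y → fromℤ (a ℤ.- b) ≡ x - y
    _⊟_ {a} {b} refl refl = fromℤ-- a b

    _⊠_ : ∀ {a b x y} → fromℤ a ≡ x → fromℤ b ≡ y → fromℤ (a ℤ.* b) ≡ x * y
    _⊠_ {a} {b} refl refl = fromℤ-* a b

    module Casts (n m c A : ℤ) where

      E-ℚ D-ℚ : ℚ
      E-ℚ = fromℤ A * (fromℤ n - fromℤ (+ 3)) + (fromℤ m * (fromℤ m - 1ℚ) - fromℤ A) * (fromℤ c - fromℤ (+ 3))
      D-ℚ = fromℤ m * ((fromℤ n - fromℤ (+ 2)) * (fromℤ n - fromℤ (+ 3)))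

      cast-E : fromℤ (pairTerm n m c A) ≡ E-ℚ
      cast-E = _⊞_ {A ℤ.* (n ℤ.- + 3)} {(m ℤ.* (m ℤ.- + 1) ℤ.- A) ℤ.* (c ℤ.- + 3)}
        (_⊠_ {A} {n ℤ.- + 3} refl (fromℤ-- n (+ 3)))
        (_⊠_ {m ℤ.* (m ℤ.- + 1) ℤ.- A} {c ℤ.- + 3}
          (_⊟_ {m ℤ.* (m ℤ.- + 1)} {A} (_⊠_ {m} {m ℤ.- + 1} refl (fromℤ-- m (+ 1))) refl) (fromℤ-- c (+ 3)))

      cast-N : fromℤ ((n ℤ.- + 2) ℤ.* (n ℤ.- + 3)) ≡ (fromℤ n - fromℤ (+ 2)) * (fromℤ n - fromℤ (+ 3))
      cast-N = _⊠_ {n ℤ.- + 2} {n ℤ.- + 3} (fromℤ-- n (+ 2)) (fromℤ-- n (+ 3))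

      cast-D : fromℤ (lowerDenominator n m c A) ≡ D-ℚ
      cast-D = _⊠_ {m} {(n ℤ.- + 2) ℤ.* (n ℤ.- + 3)} refl cast-N

      cast-cE : fromℤ ((c ℤ.- + 2) ℤ.* pairTerm n m c A) ≡ (fromℤ c - fromℤ (+ 2)) * E-ℚ
      cast-cE = _⊠_ {c ℤ.- + 2} {pairTerm n m c A} (fromℤ-- c (+ 2)) cast-E

      cast-lower : fromℤ (lowerNumerator n m c A) ≡ (fromℤ c - fromℤ (+ 2)) * E-ℚ + D-ℚ
      cast-lower = _⊞_ {(c ℤ.- + 2) ℤ.* pairTerm n m c A} {lowerDenominator n m c A} cast-cE cast-D

      cast-pair : ∀ k → fromℤ (k ℤ.* (k ℤ.- + 1)) ≡ fromℤ k * (fromℤ k - 1ℚ)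
      cast-pair k = _⊠_ {k} {k ℤ.- + 1} refl (fromℤ-- k (+ 1))

      cast-upper-N : ∀ u → fromℤ (upperNumerator n m c A u) ≡
        (fromℤ c * (fromℤ c - 1ℚ)) * ((fromℤ m * (fromℤ u - 1ℚ)) * ((fromℤ n - fromℤ (+ 2)) * (fromℤ n - fromℤ (+ 3))) - (fromℤ c - fromℤ (+ 2)) * E-ℚ)
      cast-upper-N u = _⊠_ {c ℤ.* (c ℤ.- + 1)} {(m ℤ.* (u ℤ.- + 1)) ℤ.* ((n ℤ.- + 2) ℤ.* (n ℤ.- + 3)) ℤ.- (c ℤ.- + 2) ℤ.* pairTerm n m c A}
        (cast-pair c)
        (_⊟_ {(m ℤ.* (u ℤ.- + 1)) ℤ.* ((n ℤ.- + 2) ℤ.* (n ℤ.- + 3))} {(c ℤ.- + 2) ℤ.* pairTerm n m c A}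
          (_⊠_ {m ℤ.* (u ℤ.- + 1)} {(n ℤ.- + 2) ℤ.* (n ℤ.- + 3)} (_⊠_ {m} {u ℤ.- + 1} refl (fromℤ-- u (+ 1))) cast-N) cast-cE)

      cast-upper-D : ∀ u → fromℤ (upperDenominator n m c A u) ≡
        ((fromℤ n - fromℤ (+ 2)) * (fromℤ n - fromℤ (+ 3))) * (fromℤ u * (fromℤ n * (fromℤ n - 1ℚ)) - fromℤ m * (fromℤ c * (fromℤ c - 1ℚ)))
      cast-upper-D u = _⊠_ {(n ℤ.- + 2) ℤ.* (n ℤ.- + 3)} {u ℤ.* (n ℤ.* (n ℤ.- + 1)) ℤ.- m ℤ.* (c ℤ.* (c ℤ.- + 1))} cast-N
        (_⊟_ {u ℤ.* (n ℤ.* (n ℤ.- + 1))} {m ℤ.* (c ℤ.* (c ℤ.- + 1))}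
          (_⊠_ {u} {n ℤ.* (n ℤ.- + 1)} refl (cast-pair n)) (_⊠_ {m} {c ℤ.* (c ℤ.- + 1)} refl (cast-pair c)))

    fromℕ-∸ : ∀ {n k} → k ℕ.≤ n → fromℕ (n ∸ k) ≡ fromℕ n - fromℕ k
    fromℕ-∸ {n} {k} k≤n = trans (cong fromℤ (sym (trans (ℤ.m-n≡m⊖n n k) (ℤ.⊖-≥ k≤n)))) (fromℤ-- (+ n) (+ k))

  module _ {n} (G : Graph n) {r} (r+8≤n : r ℕ.+ 8 ℕ.≤ n) (¬complete : ¬ Complete G) (¬cocomplete : ¬ CoComplete G)
           {L} (L↭ : L ↭ edges G) where

    private
      c : ℕ
      c = 4 ℕ.+ r

      c≤n : c ℕ.≤ n
      c≤n = ℕ.≤-trans (ℕ.≤-trans (ℕ.≤-reflexive (ℕ.+-comm 4 r)) (ℕ.+-monoʳ-≤ r (ℕ.m≤m+n 4 4))) r+8≤n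

      4≤n : 4 ℕ.≤ n
      4≤n = ℕ.≤-trans (ℕ.m≤m+n 4 r) c≤n

      nonempty : 0 ℕ.< length (subsetsOfSize n c)
      nonempty = subsets-nonempty G c≤n

      p : ℕ → ℚ
      p = P n c nonempty

      m A : ℤ
      m = + length L
      A = + 2 ℤ.* adjacent-pairs L

      open Casts (+ n) m (+ c) A

      N C m′ A′ two three : ℚ
      N = fromℕ n
      C = fromℕ c
      m′ = fromℤ m
      A′ = fromℤ A
      two = fromℕ 2
      three = fromℕ 3

      ratio : ∀ k → k ℕ.< 4 → p (suc k) * (N - fromℕ k) ≡ p k * (C - fromℕ k)
      ratio k k<4 = subst₂ (λ x y → p (suc k) * x ≡ p k * y) (fromℕ-∸ (ℕ.<⇒≤ (ℕ.<-≤-trans k<4 4≤n))) (fromℕ-∸ (ℕ.<⇒≤ (ℕ.<-≤-trans k<4 (ℕ.m≤m+n 4 r))))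
        (P-suc n c nonempty k (ℕ.<-≤-trans k<4 (ℕ.m≤m+n 4 r)) (ℕ.<-≤-trans k<4 4≤n))

      -- Read as the expectation of the empty product, which spares a separate count of the sets of
      -- c vertices.
      p₀≡1 : p 0 ≡ 1ℚ
      p₀≡1 = trans (sym (𝔼ℤ-∏ n c nonempty {[]} [] z≤n)) (𝔼ℤ-const n c nonempty 1ℤ)
        where
        open import Data.List using ([])
        open import Data.List.Relation.Unary.AllPairs using ([])

      p₂ : p 2 * (N * (N - 1ℚ)) ≡ C * (C - 1ℚ)
      p₂ = begin
        p 2 * (N * (N - 1ℚ))            ≡⟨ swap (p 2) N (N - 1ℚ) ⟩
        p 2 * (N - 1ℚ) * N              ≡⟨ cong (_* N) (ratio 1 (s≤s (s≤s z≤n))) ⟩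
        p 1 * (C - 1ℚ) * N              ≡⟨ swap′ (p 1) (C - 1ℚ) N ⟩
        p 1 * (N - 0ℚ) * (C - 1ℚ)       ≡⟨ cong (_* (C - 1ℚ)) (ratio 0 (s≤s z≤n)) ⟩
        p 0 * (C - 0ℚ) * (C - 1ℚ)       ≡⟨ cong (λ x → x * (C - 0ℚ) * (C - 1ℚ)) p₀≡1 ⟩
        1ℚ * (C - 0ℚ) * (C - 1ℚ)        ≡⟨ finish C ⟩
        C * (C - 1ℚ)                    ∎
        where
        swap : ∀ p x y → p * (x * y) ≡ p * y * x
        swap = solve-∀ ℚ-ring
        swap′ : ∀ p x y → p * x * y ≡ p * (y - 0ℚ) * x
        swap′ = solve-∀ ℚ-ring
        finish : ∀ x → 1ℚ * (x - 0ℚ) * (x - 1ℚ) ≡ x * (x - 1ℚ)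
        finish = solve-∀ ℚ-ring

      positive-difference : ∀ {k j} → j ℕ.< k → 0ℚ < fromℕ k - fromℕ j
      positive-difference {k} {j} j<k = difference-pos (fromℤ-mono-< {+ j} {+ k} (ℤ.+<+ j<k))

      0<N[N-1] : 0ℚ < N * (N - 1ℚ)
      0<N[N-1] = *-pos (fromℤ-mono-< {+ 0} {+ n} (ℤ.+<+ (ℕ.<-≤-trans (s≤s z≤n) 4≤n)))
        (positive-difference {n} {1} (ℕ.<-≤-trans (s≤s (s≤s z≤n)) 4≤n))

      0<[N-2][N-3] : 0ℚ < (N - two) * (N - three)
      0<[N-2][N-3] = *-pos (positive-difference {n} {2} (ℕ.<-≤-trans (s≤s (s≤s (s≤s z≤n))) 4≤n)) (positive-difference {n} {3} 4≤n)

      0<p₂ : 0ℚ < p 2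
      0<p₂ = *-cancelʳ-< 0<N[N-1] (subst₂ _<_ (sym (ℚ.*-zeroˡ (N * (N - 1ℚ)))) (sym p₂)
        (*-pos (fromℤ-mono-< {+ 0} {+ c} (ℤ.+<+ (s≤s z≤n))) (positive-difference {c} {1} (s≤s (s≤s z≤n)))))

      S₁≡ : S₁ G c ≡ m′ * p 2
      S₁≡ = trans (mean-cong (subsetsOfSize n c) (λ {S} _ → cong fromℤ (inducedSize≡inside-count G L↭ S)))
        (first-moment n c nonempty (edges-increasing G L↭) (s≤s (s≤s z≤n)))

      2S₂≡ : two * S₂ G c ≡ m′ * (m′ - 1ℚ) * p 4 + A′ * (p 3 - p 4)
      2S₂≡ = begin
        two * (½ * S)
          ≡⟨ trans (sym (ℚ.*-assoc two ½ S)) (ℚ.*-identityˡ S) ⟩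
        S
          ≡⟨ mean-cong (subsetsOfSize n c) (λ {S} _ → integral S) ⟩
        𝔼ℤ n c nonempty (λ S → inside-count L S ℤ.* (inside-count L S ℤ.- 1ℤ))
          ≡⟨ second-moment n c nonempty (edges-increasing G L↭) (edges-unique G L↭) (ℕ.m≤m+n 4 r) ⟩
        fromℤ (m ℤ.* (m ℤ.- 1ℤ)) * p 4 + A′ * (p 3 - p 4)
          ≡⟨ cong (λ x → x * p 4 + A′ * (p 3 - p 4)) (cast-pair m) ⟩
        m′ * (m′ - 1ℚ) * p 4 + A′ * (p 3 - p 4)
          ∎
        where
        S : ℚ
        S = 𝔼 n c (λ S → M G S * (M G S - 1ℚ))
        integral : ∀ S → M G S * (M G S - 1ℚ) ≡ fromℤ (inside-count L S ℤ.* (inside-count L S ℤ.- 1ℤ))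
        integral S = trans (sym (cast-pair (+ inducedSize G S)))
          (cong (λ x → fromℤ (x ℤ.* (x ℤ.- 1ℤ))) (inducedSize≡inside-count G L↭ S))

      -- The ratios reduce P 4 and P 3 to P 2. For the lower bound the remaining P 2 cancels against
      -- S₁ = m P 2, so no binomial coefficient has to be computed.
      2S₂-scaled : two * S₂ G c * ((N - two) * (N - three)) ≡ p 2 * ((C - two) * E-ℚ)
      2S₂-scaled = begin
        two * S₂ G c * ((N - two) * (N - three))
          ≡⟨ cong (_* ((N - two) * (N - three))) 2S₂≡ ⟩
        (m′ * (m′ - 1ℚ) * p 4 + A′ * (p 3 - p 4)) * ((N - two) * (N - three))
          ≡⟨ separate (m′ * (m′ - 1ℚ)) A′ (p 3) (p 4) (N - two) (N - three) ⟩
        (m′ * (m′ - 1ℚ) - A′) * (p 4 * (N - three)) * (N - two) + A′ * (p 3 * (N - two)) * (N - three)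
          ≡⟨ cong₂ (λ x y → (m′ * (m′ - 1ℚ) - A′) * x * (N - two) + A′ * y * (N - three)) (ratio 3 ℕ.≤-refl) (ratio 2 (s≤s (s≤s (s≤s z≤n)))) ⟩
        (m′ * (m′ - 1ℚ) - A′) * (p 3 * (C - three)) * (N - two) + A′ * (p 2 * (C - two)) * (N - three)
          ≡⟨ regroup (m′ * (m′ - 1ℚ) - A′) A′ (p 3) (p 2) (C - three) (C - two) (N - two) (N - three) ⟩
        (m′ * (m′ - 1ℚ) - A′) * (p 3 * (N - two)) * (C - three) + A′ * (p 2 * (C - two)) * (N - three)
          ≡⟨ cong (λ x → (m′ * (m′ - 1ℚ) - A′) * x * (C - three) + A′ * (p 2 * (C - two)) * (N - three)) (ratio 2 (s≤s (s≤s (s≤s z≤n)))) ⟩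
        (m′ * (m′ - 1ℚ) - A′) * (p 2 * (C - two)) * (C - three) + A′ * (p 2 * (C - two)) * (N - three)
          ≡⟨ collect (m′ * (m′ - 1ℚ) - A′) A′ (p 2) (C - two) (C - three) (N - three) ⟩
        p 2 * ((C - two) * (A′ * (N - three) + (m′ * (m′ - 1ℚ) - A′) * (C - three)))
          ∎
        where
        separate : ∀ d a q q′ x y → (d * q′ + a * (q - q′)) * (x * y) ≡ (d - a) * (q′ * y) * x + a * (q * x) * y
        separate = solve-∀ ℚ-ring
        regroup : ∀ d a q q′ c₃ c₂ n₂ n₃ → d * (q * c₃) * n₂ + a * (q′ * c₂) * n₃ ≡ d * (q * n₂) * c₃ + a * (q′ * c₂) * n₃
        regroup = solve-∀ ℚ-ring
        collect : ∀ d a q c₂ c₃ n₃ → d * (q * c₂) * c₃ + a * (q * c₂) * n₃ ≡ q * (c₂ * (a * n₃ + d * c₃))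
        collect = solve-∀ ℚ-ring

      0<S : 0ℚ < S₁ G c
      0<S = 0<S₁ G r+8≤n ¬complete ¬cocomplete

      first : ℚ
      first = two * S₂ G c ⟋ S₁ G c + 1ℚ

      first-scaled : first * D-ℚ ≡ (C - two) * E-ℚ + D-ℚ
      first-scaled = *-cancelʳ-≡ 0<p₂ (begin
        first * (m′ * ((N - two) * (N - three))) * p 2
          ≡⟨ arrange (two * S₂ G c ⟋ S₁ G c) m′ ((N - two) * (N - three)) (p 2) ⟩
        two * S₂ G c ⟋ S₁ G c * (m′ * p 2) * ((N - two) * (N - three)) + D-ℚ * p 2
          ≡⟨ cong (λ s → two * S₂ G c ⟋ S₁ G c * s * ((N - two) * (N - three)) + D-ℚ * p 2) S₁≡ ⟨
        two * S₂ G c ⟋ S₁ G c * S₁ G c * ((N - two) * (N - three)) + D-ℚ * p 2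
          ≡⟨ cong (λ s → s * ((N - two) * (N - three)) + D-ℚ * p 2) (⟋-* (two * S₂ G c) 0<S) ⟩
        two * S₂ G c * ((N - two) * (N - three)) + D-ℚ * p 2
          ≡⟨ cong (λ s → s + D-ℚ * p 2) 2S₂-scaled ⟩
        p 2 * ((C - two) * E-ℚ) + D-ℚ * p 2
          ≡⟨ factor (p 2) ((C - two) * E-ℚ) D-ℚ ⟩
        ((C - two) * E-ℚ + D-ℚ) * p 2
          ∎)
        where
        arrange : ∀ q m x p → (q + 1ℚ) * (m * x) * p ≡ q * (m * p) * x + m * x * p
        arrange = solve-∀ ℚ-ring
        factor : ∀ p e d → p * e + d * p ≡ (e + d) * p
        factor = solve-∀ ℚ-ring

      0<m′ : 0ℚ < m′
      0<m′ = *-cancelʳ-< 0<p₂ (subst₂ _<_ (sym (ℚ.*-zeroˡ (p 2))) S₁≡ 0<S)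

    lowerDenominator-pos : + 0 ℤ.< lowerDenominator (+ n) m (+ c) A
    lowerDenominator-pos = fromℤ-cancel-< {+ 0} {lowerDenominator (+ n) m (+ c) A} (subst (0ℚ <_) (sym cast-D) (*-pos 0<m′ 0<[N-2][N-3]))

    -- The machine divides with rounding down, so the ceiling is formed as the negative of the floor
    -- of the negative.
    ceiling-lowerBound≡ : ∀ ℓ⋆ → + 0 ℤ.≤ ℓ⋆ → ℓ⋆ ℤ.≤ + ℓ G c →
      ceiling (lowerBound G c ℓ⋆) ≡ + 0 ℤ.- quotient (+ 0 ℤ.- lowerNumerator (+ n) m (+ c) A) (lowerDenominator (+ n) m (+ c) A)
    ceiling-lowerBound≡ ℓ⋆ 0≤ℓ⋆ ℓ⋆≤ℓ = begin
      ceiling (lowerBound G c ℓ⋆)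
        ≡⟨ cong ceiling (lowerBound≡firstTerm G r+8≤n ¬complete ¬cocomplete ℓ⋆ 0≤ℓ⋆ ℓ⋆≤ℓ) ⟩
      ceiling first
        ≡⟨ ceiling≡-floor- first ⟩
      ℤ.- floor (- first)
        ≡⟨ cong ℤ.-_ (floor≡quotient {(- first)} {+ 0 ℤ.- lowerNumerator (+ n) m (+ c) A} {lowerDenominator (+ n) m (+ c) A} lowerDenominator-pos scaled) ⟩
      ℤ.- quotient (+ 0 ℤ.- lowerNumerator (+ n) m (+ c) A) (lowerDenominator (+ n) m (+ c) A)
        ≡⟨ ℤ.+-identityˡ _ ⟨
      + 0 ℤ.- quotient (+ 0 ℤ.- lowerNumerator (+ n) m (+ c) A) (lowerDenominator (+ n) m (+ c) A)
        ∎
      where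
      scaled : - first * fromℤ (lowerDenominator (+ n) m (+ c) A) ≡ fromℤ (+ 0 ℤ.- lowerNumerator (+ n) m (+ c) A)
      scaled = begin
        - first * fromℤ (lowerDenominator (+ n) m (+ c) A)   ≡⟨ cong (- first *_) cast-D ⟩
        - first * D-ℚ                                        ≡⟨ ℚ.neg-distribˡ-* first D-ℚ ⟨
        - (first * D-ℚ)                                      ≡⟨ cong -_ first-scaled ⟩
        - ((C - two) * E-ℚ + D-ℚ)                            ≡⟨ ℚ.+-identityˡ _ ⟨
        0ℚ - ((C - two) * E-ℚ + D-ℚ)                         ≡⟨ _⊟_ {+ 0} {lowerNumerator (+ n) m (+ c) A} refl cast-lower ⟨
        fromℤ (+ 0 ℤ.- lowerNumerator (+ n) m (+ c) A)       ∎

    floor-upperBound≡ : ∀ u⋆ → + u G c ℤ.≤ u⋆ →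
      floor (upperBound G c u⋆) ≡ quotient (upperNumerator (+ n) m (+ c) A u⋆) (upperDenominator (+ n) m (+ c) A u⋆)
    floor-upperBound≡ u⋆ u≤u⋆ = floor≡quotient {upperBound G c u⋆} {upperNumerator (+ n) m (+ c) A u⋆} {upperDenominator (+ n) m (+ c) A u⋆}
      (fromℤ-cancel-< {+ 0} {upperDenominator (+ n) m (+ c) A u⋆} (subst (0ℚ <_) (trans denominator (sym (cast-upper-D u⋆))) (*-pos 0<U (*-pos 0<N[N-1] 0<[N-2][N-3]))))
      (begin
        t * fromℤ (upperDenominator (+ n) m (+ c) A u⋆)
          ≡⟨ cong (t *_) (trans (cast-upper-D u⋆) (sym denominator)) ⟩
        t * (U * (N * (N - 1ℚ) * ((N - two) * (N - three))))
          ≡⟨ expand (S₁ G c) (σ² G c ⟋ U) U (N * (N - 1ℚ) * ((N - two) * (N - three))) ⟩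
        (S₁ G c * U - σ² G c ⟋ U * U) * (N * (N - 1ℚ) * ((N - two) * (N - three)))
          ≡⟨ cong (λ v → (S₁ G c * U - v) * (N * (N - 1ℚ) * ((N - two) * (N - three)))) (trans (⟋-* (σ² G c) 0<U) (σ²-formula G r+8≤n ¬complete ¬cocomplete)) ⟩
        (S₁ G c * U - (two * S₂ G c - S₁ G c * (S₁ G c - 1ℚ))) * (N * (N - 1ℚ) * ((N - two) * (N - three)))
          ≡⟨ simplify (S₁ G c) (fromℤ u⋆) (two * S₂ G c) (N * (N - 1ℚ)) ((N - two) * (N - three)) ⟩
        S₁ G c * (N * (N - 1ℚ)) * ((fromℤ u⋆ - 1ℚ) * ((N - two) * (N - three))) - two * S₂ G c * ((N - two) * (N - three)) * (N * (N - 1ℚ))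
          ≡⟨ cong₂ (λ s q → s * ((fromℤ u⋆ - 1ℚ) * ((N - two) * (N - three))) - q * (N * (N - 1ℚ))) S₁-scaled 2S₂-scaled ⟩
        m′ * (C * (C - 1ℚ)) * ((fromℤ u⋆ - 1ℚ) * ((N - two) * (N - three))) - p 2 * ((C - two) * E-ℚ) * (N * (N - 1ℚ))
          ≡⟨ cong (λ s → m′ * (C * (C - 1ℚ)) * ((fromℤ u⋆ - 1ℚ) * ((N - two) * (N - three))) - s)
               (trans (move (p 2) ((C - two) * E-ℚ) (N * (N - 1ℚ))) (cong (λ s → s * ((C - two) * E-ℚ)) p₂)) ⟩
        m′ * (C * (C - 1ℚ)) * ((fromℤ u⋆ - 1ℚ) * ((N - two) * (N - three))) - C * (C - 1ℚ) * ((C - two) * E-ℚ)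
          ≡⟨ factor m′ (C * (C - 1ℚ)) (fromℤ u⋆ - 1ℚ) ((N - two) * (N - three)) ((C - two) * E-ℚ) ⟩
        (C * (C - 1ℚ)) * ((m′ * (fromℤ u⋆ - 1ℚ)) * ((N - two) * (N - three)) - (C - two) * E-ℚ)
          ≡⟨ cast-upper-N u⋆ ⟨
        fromℤ (upperNumerator (+ n) m (+ c) A u⋆)
          ∎)
      where
      t U : ℚ
      t = upperBound G c u⋆
      U = fromℤ u⋆ - S₁ G c
      0<U : 0ℚ < U
      0<U = difference-pos (ℚ.<-≤-trans (S₁<u G r+8≤n ¬complete ¬cocomplete) (fromℤ-mono-≤ {+ u G c} {u⋆} u≤u⋆))
      S₁-scaled : S₁ G c * (N * (N - 1ℚ)) ≡ m′ * (C * (C - 1ℚ))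
      S₁-scaled = trans (cong (_* (N * (N - 1ℚ))) S₁≡) (trans (ℚ.*-assoc m′ (p 2) (N * (N - 1ℚ))) (cong (m′ *_) p₂))
      denominator : U * (N * (N - 1ℚ) * ((N - two) * (N - three))) ≡
        ((N - two) * (N - three)) * (fromℤ u⋆ * (N * (N - 1ℚ)) - m′ * (C * (C - 1ℚ)))
      denominator = trans (spread (fromℤ u⋆) (S₁ G c) (N * (N - 1ℚ)) ((N - two) * (N - three)))
        (cong (λ s → ((N - two) * (N - three)) * (fromℤ u⋆ * (N * (N - 1ℚ)) - s)) S₁-scaled)
        where
        spread : ∀ u s x y → (u - s) * (x * y) ≡ y * (u * x - s * x)
        spread = solve-∀ ℚ-ring
      expand : ∀ s w U x → (s - w) * (U * x) ≡ (s * U - w * U) * x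
      expand = solve-∀ ℚ-ring
      simplify : ∀ s u q x y → (s * (u - s) - (q - s * (s - 1ℚ))) * (x * y) ≡ s * x * ((u - 1ℚ) * y) - q * y * x
      simplify = solve-∀ ℚ-ring
      move : ∀ p e x → p * e * x ≡ p * x * e
      move = solve-∀ ℚ-ring
      factor : ∀ m k u y e → m * k * (u * y) - k * e ≡ k * ((m * u) * y - e)
      factor = solve-∀ ℚ-ring

-- The program and its loop invariant.

module Algorithm where
  open Indicators
  open Moments
  open ClosedForms
  open import Data.Integer using (_+_; _*_; _-_; _≤_)
  open import Data.List using ([]; _∷_; _++_)
  open import Data.List.Relation.Unary.All using ([]; _∷_)
  open import Data.Nat using (suc)

  -- Variable 5 counts the edges read, variable 6 accumulates adjacent-pairs, and
  -- the work array holds the degrees in the graph of the edges read.  One round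
  -- takes 52 steps, 48 of them in step, and the final test takes 4.
  tail-index head-index : Expr
  tail-index = lit (+ 2) ⊗ var 5
  head-index = lit (+ 2) ⊗ var 5 ⊕ lit 1ℤ

  step loop finish program : Program
  step =
    6 ≔ var 6 ⊕ work (input tail-index) ⊕ work (input head-index) ⨟
    work[ input tail-index ]≔ work (input tail-index) ⊕ lit 1ℤ ⨟
    work[ input head-index ]≔ work (input head-index) ⊕ lit 1ℤ ⨟
    5 ≔ var 5 ⊕ lit 1ℤ
  loop = while>0 (var 1 ⊖ var 5) step

  pairTermₑ lowerNumeratorₑ lowerDenominatorₑ upperNumeratorₑ upperDenominatorₑ : Expr
  pairTermₑ = var 7 ⊗ (var 0 ⊖ lit (+ 3)) ⊕ (var 1 ⊗ (var 1 ⊖ lit 1ℤ) ⊖ var 7) ⊗ (var 2 ⊖ lit (+ 3))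
  lowerDenominatorₑ = var 1 ⊗ ((var 0 ⊖ lit (+ 2)) ⊗ (var 0 ⊖ lit (+ 3)))
  lowerNumeratorₑ = (var 2 ⊖ lit (+ 2)) ⊗ pairTermₑ ⊕ lowerDenominatorₑ
  upperNumeratorₑ = (var 2 ⊗ (var 2 ⊖ lit 1ℤ)) ⊗
    ((var 1 ⊗ (var 4 ⊖ lit 1ℤ)) ⊗ ((var 0 ⊖ lit (+ 2)) ⊗ (var 0 ⊖ lit (+ 3))) ⊖ (var 2 ⊖ lit (+ 2)) ⊗ pairTermₑ)
  upperDenominatorₑ = ((var 0 ⊖ lit (+ 2)) ⊗ (var 0 ⊖ lit (+ 3))) ⊗
    (var 4 ⊗ (var 0 ⊗ (var 0 ⊖ lit 1ℤ)) ⊖ var 1 ⊗ (var 2 ⊗ (var 2 ⊖ lit 1ℤ)))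

  finish =
    7 ≔ lit (+ 2) ⊗ var 6 ⨟
    -- Variables 0 and 1 must keep n and m until both quotients have been formed, so the lower bound
    -- waits in variable 5, which has served as counter.
    5 ≔ lit 0ℤ ⊖ (lit 0ℤ ⊖ lowerNumeratorₑ) ⊘ lowerDenominatorₑ ⨟
    1 ≔ upperNumeratorₑ ⊘ upperDenominatorₑ ⨟
    0 ≔ var 5

  program = loop ⨟ finish

  -- Every edge occupies two cells of the input, hence the offset of twice the number of edges
  -- skipped.
  encoded-at : ∀ {n} (ds rest : List (Pair n)) t →
    encodeEdges (ds ++ rest) at (+ (2 ℕ.* length ds ℕ.+ t)) ≡ encodeEdges rest at (+ t)
  encoded-at []       rest t = refl
  encoded-at (d ∷ ds) rest t = trans (cong (λ k → encodeEdges (d ∷ ds ++ rest) at (+ k)) (shift (length ds) t)) (encoded-at ds rest t)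
    where
    shift : ∀ l t → 2 ℕ.* suc l ℕ.+ t ≡ suc (suc (2 ℕ.* l ℕ.+ t))
    shift = solveℕ-∀

  Within : ℕ → ℤ → Set
  Within b x = 0ℤ ≤ x × x ≤ + b

  within-+ : ∀ {a b x y} → Within a x → Within b y → Within (a ℕ.+ b) (x + y)
  within-+ (0≤x , x≤a) (0≤y , y≤b) = ℤ.+-mono-≤ 0≤x 0≤y , ℤ.+-mono-≤ x≤a y≤b

  within-mono : ∀ {a b x} → a ℕ.≤ b → Within a x → Within b x
  within-mono a≤b (0≤x , x≤a) = 0≤x , ℤ.≤-trans x≤a (+≤+ a≤b)

  within-abs : ∀ {b x} → Within b x → ℤ.∣ x ∣ ℕ.≤ b
  within-abs (0≤x , x≤b) = ℤ.drop‿+≤+ (ℤ.≤-trans (ℤ.≤-reflexive (ℤ.0≤i⇒+∣i∣≡i 0≤x)) x≤b)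

  within-χ : ∀ {p} {P : Set p} (P? : Relation.Nullary.Dec P) → Within 1 (χ P?)
  within-χ (yes _) = +≤+ z≤n , +≤+ (s≤s z≤n)
  within-χ (no _)  = +≤+ z≤n , +≤+ z≤n

  degree-within : ∀ {n} (L : List (Pair n)) v → Within (2 ℕ.* length L) (degree L v)
  degree-within []            v = +≤+ z≤n , +≤+ z≤n
  degree-within ((k , l) ∷ L) v = subst (λ b → Within b (degree ((k , l) ∷ L) v)) (grow (length L))
    (within-+ (within-+ (within-χ (v Fin.≟ k)) (within-χ (v Fin.≟ l))) (degree-within L v))
    where
    grow : ∀ l → 1 ℕ.+ 1 ℕ.+ 2 ℕ.* l ≡ 2 ℕ.* suc l
    grow = solveℕ-∀

  -- An edge added to l others contributes at most 4 l, and 4 l² + 4 l ≤ 4 (l + 1)². A crude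
  -- quadratic bound is enough for the word size.
  adjacent-pairs-within : ∀ {n} (L : List (Pair n)) → Within (4 ℕ.* (length L ℕ.* length L)) (adjacent-pairs L)
  adjacent-pairs-within []            = +≤+ z≤n , +≤+ z≤n
  adjacent-pairs-within ((i , j) ∷ L) = within-mono (ℕ.≤-trans (ℕ.m≤m+n _ (4 ℕ.* length L ℕ.+ 4)) (ℕ.≤-reflexive (grow (length L))))
    (within-+ (adjacent-pairs-within L) (within-+ (degree-within L i) (degree-within L j)))
    where
    grow : ∀ l → 4 ℕ.* (l ℕ.* l) ℕ.+ (2 ℕ.* l ℕ.+ 2 ℕ.* l) ℕ.+ (4 ℕ.* l ℕ.+ 4) ≡ 4 ℕ.* (suc l ℕ.* suc l)
    grow = solveℕ-∀

  module _ {n : ℕ} (m c : ℕ) (ℓ⋆ u⋆ : ℤ) where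

    -- `L` lists the edges read, newest first, so that one round adds one head and the recurrences
    -- of `degree` and `adjacent-pairs` become the stores of `step`.
    record Invariant (L : List (Pair n)) (s : State) : Set where
      field
        order     : variables s 0 ≡ + n
        size-m    : variables s 1 ≡ + m
        subsize   : variables s 2 ≡ + c
        upper     : variables s 4 ≡ u⋆
        index     : variables s 5 ≡ + length L
        adjacency : variables s 6 ≡ adjacent-pairs L
        degrees   : ∀ v → workArray s (+ toℕ v) ≡ degree L v
    open Invariant

    initial-invariant : Invariant [] (initial n m c ℓ⋆ u⋆)
    initial-invariant = record
      { order = refl ; size-m = refl ; subsize = refl ; upper = refl ; index = refl ; adjacency = refl ; degrees = λ _ → refl }

    module _ (W : ℕ) (es : List (Pair n)) (n≤W : n ℕ.≤ W) (values≤W : 8 ℕ.* (length es ℕ.* length es) ℕ.+ 8 ℕ.≤ W) where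

      private
        I : List ℤ
        I = encodeEdges es

      module _ {i j : Fin n} {rest : List (Pair n)} {L : List (Pair n)} {s : State} (inv : Invariant L s)
               (i≢j : i ≢ j) (tail-at : I at (+ 2 * + length L) ≡ + toℕ i) (head-at : I at (+ 2 * + length L + 1ℤ) ≡ + toℕ j)
               (L<es : length L ℕ.< length es) where

        private
          l : ℕ
          l = length L

          small : ∀ {x} → Within (8 ℕ.* (length es ℕ.* length es) ℕ.+ 8) x → ℤ.∣ x ∣ ℕ.≤ W
          small x = ℕ.≤-trans (within-abs x) values≤W

          l≤e² : l ℕ.≤ length es ℕ.* length es
          l≤e² = ℕ.≤-trans (ℕ.<⇒≤ L<es) (ℕ.m≤m*n (length es) (length es) {{ℕ.>-nonZero (ℕ.≤-<-trans z≤n L<es)}})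

        s₁ s₂ s₃ s₄ : State
        s₁ = setVar s 6 (eval I s (var 6 ⊕ work (input tail-index) ⊕ work (input head-index)))
        s₂ = setWork s₁ (eval I s₁ (input tail-index)) (eval I s₁ (work (input tail-index) ⊕ lit 1ℤ))
        s₃ = setWork s₂ (eval I s₂ (input head-index)) (eval I s₂ (work (input head-index) ⊕ lit 1ℤ))
        s₄ = setVar s₃ 5 (eval I s₃ (var 5 ⊕ lit 1ℤ))

        private
          tail≡ : I at (+ 2 * variables s 5) ≡ + toℕ i
          tail≡ = trans (cong (λ k → I at (+ 2 * k)) (index inv)) tail-at
          head≡ : I at (+ 2 * variables s 5 + 1ℤ) ≡ + toℕ j
          head≡ = trans (cong (λ k → I at (+ 2 * k + 1ℤ)) (index inv)) head-at

          degree-i : workArray s (I at (+ 2 * variables s 5)) ≡ degree L i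
          degree-i = trans (cong (workArray s) tail≡) (degrees inv i)

          degree-j : workArray s (I at (+ 2 * variables s 5 + 1ℤ)) ≡ degree L j
          degree-j = trans (cong (workArray s) head≡) (degrees inv j)

          new-adjacency : variables s₁ 6 ≡ adjacent-pairs ((i , j) ∷ L)
          new-adjacency = trans (cong₂ _+_ (cong₂ _+_ (adjacency inv) degree-i) degree-j) (ℤ.+-assoc (adjacent-pairs L) (degree L i) (degree L j))

          -- The second store does not see the first, since i and j differ.
          degree-j′ : workArray s₂ (I at (+ 2 * variables s 5 + 1ℤ)) ≡ degree L j
          degree-j′ with (I at (+ 2 * variables s 5 + 1ℤ)) ℤ.≟ (I at (+ 2 * variables s 5))
          ... | yes eq = contradiction (Fin.toℕ-injective (ℤ.+-injective (trans (sym tail≡) (trans (sym eq) head≡)))) i≢j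
          ... | no _   = degree-j

          new-degrees : ∀ v → workArray s₃ (+ toℕ v) ≡ degree ((i , j) ∷ L) v
          new-degrees v with (+ toℕ v) ℤ.≟ (I at (+ 2 * variables s 5 + 1ℤ))
          ... | yes eq = trans (cong (λ d → d + 1ℤ) degree-j′) (trans (ℤ.+-comm (degree L j) 1ℤ) (at-j v≡j))
            where
            v≡j : v ≡ j
            v≡j = Fin.toℕ-injective (ℤ.+-injective (trans eq head≡))
            at-j : v ≡ j → 1ℤ + degree L j ≡ degree ((i , j) ∷ L) v
            at-j refl = cong (λ x → x + degree L j) (sym (cong₂ _+_ (χ-no (j Fin.≟ i) (≢-sym i≢j)) (χ-yes (j Fin.≟ j) refl)))
          ... | no v≢ with (+ toℕ v) ℤ.≟ (I at (+ 2 * variables s 5))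
          ...   | yes eq = trans (cong (λ d → d + 1ℤ) degree-i) (trans (ℤ.+-comm (degree L i) 1ℤ) (at-i v≡i))
            where
            v≡i : v ≡ i
            v≡i = Fin.toℕ-injective (ℤ.+-injective (trans eq tail≡))
            at-i : v ≡ i → 1ℤ + degree L i ≡ degree ((i , j) ∷ L) v
            at-i refl = cong (λ x → x + degree L i) (sym (cong₂ _+_ (χ-yes (i Fin.≟ i) refl) (χ-no (i Fin.≟ j) i≢j)))
          ...   | no v≢′ = trans (degrees inv v) (trans (sym (ℤ.+-identityˡ (degree L v)))
            (cong (λ x → x + degree L v) (sym (cong₂ _+_ (χ-no (v Fin.≟ i) (λ { refl → v≢′ (sym tail≡) })) (χ-no (v Fin.≟ j) (λ { refl → v≢ (sym head≡) }))))))

          new-index : variables s 5 + 1ℤ ≡ + suc l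
          new-index = trans (cong (λ k → k + 1ℤ) (index inv)) (cong +_ (ℕ.+-comm l 1))

          vertex-small : ∀ {x} (v : Fin n) → x ≡ + toℕ v → ℤ.∣ x ∣ ℕ.≤ W
          vertex-small v refl = ℕ.≤-trans (ℕ.<⇒≤ (Fin.toℕ<n v)) n≤W

          degree-small : ∀ {x} v → x ≡ degree L v → ℤ.∣ x + 1ℤ ∣ ℕ.≤ W
          degree-small v refl = small (within-mono (ℕ.+-mono-≤ (ℕ.*-mono-≤ (s≤s (s≤s (z≤n {6}))) l≤e²) (s≤s (z≤n {7})))
            (within-+ (degree-within L v) (+≤+ z≤n , ℤ.≤-refl {1ℤ})))

          adjacency-small : ∀ {x} → x ≡ adjacent-pairs ((i , j) ∷ L) → ℤ.∣ x ∣ ℕ.≤ W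
          adjacency-small refl = small (within-mono (ℕ.≤-trans (ℕ.*-mono-≤ (ℕ.m≤m+n 4 4) (ℕ.*-mono-≤ L<es L<es)) (ℕ.m≤m+n _ 8))
            (adjacent-pairs-within ((i , j) ∷ L)))

          index-small : ∀ {x} → x ≡ + suc l → ℤ.∣ x ∣ ℕ.≤ W
          index-small refl = ℕ.≤-trans (ℕ.+-mono-≤ (s≤s (z≤n {7})) (ℕ.≤-trans l≤e² (ℕ.m≤n*m _ 8))) (ℕ.≤-trans (ℕ.≤-reflexive (ℕ.+-comm 8 _)) values≤W)

        step-exec : Exec I W step s 48 s₄
        step-exec = seq (assign (adjacency-small new-adjacency))
          (seq (store (vertex-small i tail≡) (degree-small i degree-i))
          (seq (store (vertex-small j head≡) (degree-small j degree-j′))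
          (assign (index-small new-index))))

        step-invariant : Invariant ((i , j) ∷ L) s₄
        step-invariant = record
          { order = order inv ; size-m = size-m inv ; subsize = subsize inv ; upper = upper inv
          ; index = new-index ; adjacency = new-adjacency ; degrees = new-degrees }

      -- Induction on the unread edges `rest`. The read part `ds` of the input agrees in length with
      -- `L`, which locates the next edge in the input array.
      loop-exec : length es ≡ m → ∀ ds rest {L s} → es ≡ ds ++ rest → length ds ≡ length L → All Increasing rest → Invariant L s →
        ∃ λ s′ → Exec I W loop s (length rest ℕ.* 52 ℕ.+ 4) s′ × Invariant (rest ʳ++ L) s′
      loop-exec es≡m ds [] {L} {s} es≡ ds≡L [] inv = s , while-false done , inv
        where
        L≡m : length L ≡ m
        L≡m = trans (sym ds≡L) (trans (cong length (sym (trans es≡ (List.++-identityʳ ds)))) es≡m)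
        done : ¬ (0ℤ ℤ.< variables s 1 - variables s 5)
        done = ℤ.≤⇒≯ (ℤ.≤-reflexive (trans (cong₂ _-_ (size-m inv) (trans (index inv) (cong +_ L≡m))) (ℤ.+-inverseʳ (+ m))))
      loop-exec es≡m ds (e@(i , j) ∷ rest) {L} {s} es≡ ds≡L (i<j ∷ increasing) inv =
        let s′ , run , inv′ = loop-exec es≡m (ds ++ e ∷ []) rest {e ∷ L} {s₄ {rest = rest} inv i≢j tail-at head-at L<es}
              (trans es≡ (sym (List.++-assoc ds (e ∷ []) rest)))
              (trans (List.length-++ ds) (trans (ℕ.+-comm (length ds) 1) (cong suc ds≡L))) increasing
              (step-invariant {rest = rest} inv i≢j tail-at head-at L<es)
        in s′ , while-true continue (step-exec {rest = rest} inv i≢j tail-at head-at L<es) run , inv′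
        where
        i≢j : i ≢ j
        i≢j refl = Fin.<-irrefl refl i<j
        length-es : length es ≡ length L ℕ.+ suc (length rest)
        length-es = trans (cong length es≡) (trans (List.length-++ ds) (cong (ℕ._+ suc (length rest)) ds≡L))
        L<es : length L ℕ.< length es
        L<es = ℕ.≤-trans (ℕ.m≤m+n (suc (length L)) (length rest)) (ℕ.≤-reflexive (trans (sym (ℕ.+-suc (length L) (length rest))) (sym length-es)))
        read : ∀ t → I at (+ (2 ℕ.* length L ℕ.+ t)) ≡ encodeEdges (e ∷ rest) at (+ t)
        read t = trans (cong₂ (λ es l → encodeEdges es at (+ (2 ℕ.* l ℕ.+ t))) es≡ (sym ds≡L)) (encoded-at ds (e ∷ rest) t)
        tail-at : I at (+ 2 * + length L) ≡ + toℕ i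
        tail-at = trans (cong (I at_) (trans (sym (ℤ.pos-* 2 (length L))) (cong +_ (sym (ℕ.+-identityʳ (2 ℕ.* length L)))))) (read 0)
        head-at : I at (+ 2 * + length L + 1ℤ) ≡ + toℕ j
        head-at = trans (cong (λ k → I at (k + 1ℤ)) (sym (ℤ.pos-* 2 (length L)))) (read 1)
        continue : 0ℤ ℤ.< variables s 1 - variables s 5
        continue = subst (0ℤ ℤ.<_) (sym (cong₂ _-_ (size-m inv) (index inv)))
          (subst (ℤ._< + m - + length L) (ℤ.+-inverseʳ (+ length L)) (ℤ.+-monoˡ-< (ℤ.- + length L) (+<+ (subst (length L ℕ.<_) es≡m L<es))))

-- Correctness, running time and word size.

module Correctness where
  open Moments
  open ClosedForms
  open Algorithm
  open Extremes using (u-attained)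
  open Bounds
  open import Data.Integer using (_+_; _*_; _-_; _≤_; ∣_∣)
  open import Data.List using ([]; _∷_; map)
  open Rationals using (fromℤ-cancel-<)

  private
    cong₄ : ∀ {A B C D E : Set} (f : A → B → C → D → E) {a a′ b b′ c c′ d d′} →
      a ≡ a′ → b ≡ b′ → c ≡ c′ → d ≡ d′ → f a b c d ≡ f a′ b′ c′ d′
    cong₄ f refl refl refl refl = refl

  lowerFormula : (n m c A : ℤ) → ℤ
  lowerFormula n m c A = 0ℤ - quotient (0ℤ - lowerNumerator n m c A) (lowerDenominator n m c A)

  upperFormula : (u n m c A : ℤ) → ℤ
  upperFormula u n m c A = quotient (upperNumerator n m c A u) (upperDenominator n m c A u)

  A₇ A₅ A₁ : Expr
  A₇ = lit (+ 2) ⊗ var 6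
  A₅ = lit 0ℤ ⊖ (lit 0ℤ ⊖ lowerNumeratorₑ) ⊘ lowerDenominatorₑ
  A₁ = upperNumeratorₑ ⊘ upperDenominatorₑ

  -- A number independent of the input; the final 2 is the cost of `0 ≔ var 5`.
  finish-cost : ℕ
  finish-cost = (1 ℕ.+ cost A₇) ℕ.+ ((1 ℕ.+ cost A₅) ℕ.+ ((1 ℕ.+ cost A₁) ℕ.+ 2))

  module _ {n} {m c : ℕ} {ℓ⋆ u⋆ : ℤ} {L : List (Pair n)} {s : State} (inv : Invariant m c ℓ⋆ u⋆ L s) (I : List ℤ) (W : ℕ) where

    open Invariant inv

    private
      A : ℤ
      A = + 2 * adjacent-pairs L

      after-A after-lower after-upper final : State
      after-A = setVar s 7 (eval I s A₇)
      after-lower = setVar after-A 5 (eval I after-A A₅)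
      after-upper = setVar after-lower 1 (eval I after-lower A₁)
      final = setVar after-upper 0 (variables after-upper 5)

      A≡ : eval I s A₇ ≡ A
      A≡ = cong (+ 2 *_) adjacency

      lower≡ : eval I after-A A₅ ≡ lowerFormula (+ n) (+ m) (+ c) A
      lower≡ = cong₄ lowerFormula order size-m subsize A≡

      upper≡ : eval I after-lower A₁ ≡ upperFormula u⋆ (+ n) (+ m) (+ c) A
      upper≡ = trans (cong (λ u → upperFormula u (variables s 0) (variables s 1) (variables s 2) (eval I s A₇)) upper)
        (cong₄ (upperFormula u⋆) order size-m subsize A≡)

    finish-exec : ∣ A ∣ ℕ.≤ W → ∣ lowerFormula (+ n) (+ m) (+ c) A ∣ ℕ.≤ W → ∣ upperFormula u⋆ (+ n) (+ m) (+ c) A ∣ ℕ.≤ W →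
      ∃ λ s′ → Exec I W finish s finish-cost s′ ×
        variables s′ 0 ≡ lowerFormula (+ n) (+ m) (+ c) A × variables s′ 1 ≡ upperFormula u⋆ (+ n) (+ m) (+ c) A
    finish-exec A≤W lower≤W upper≤W = final , seq (assign (subst (λ x → ∣ x ∣ ℕ.≤ W) (sym A≡) A≤W))
      (seq (assign (subst (λ x → ∣ x ∣ ℕ.≤ W) (sym lower≡) lower≤W))
      (seq (assign (subst (λ x → ∣ x ∣ ℕ.≤ W) (sym upper≡) upper≤W))
      (assign (subst (λ x → ∣ x ∣ ℕ.≤ W) (sym lower≡) lower≤W)))) , lower≡ , upper≡

  -- One constant serves as exponent and as factor. The 6 suffices for the words: for n ≥ 8 and m ≤
  -- n², 8 m² + 8 ≤ 2 n⁵ ≤ n⁶. The 56 consists of 52 steps per round and 4 for the last test; as m ≥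
  -- 1, constant costs can be charged to m.
  K : ℕ
  K = 6 ℕ.+ (56 ℕ.+ finish-cost)

  private
    power-bound : ∀ {n e} x k → 8 ℕ.≤ n → e ℕ.≤ n ℕ.* n → 8 ℕ.* (e ℕ.* e) ℕ.+ 8 ℕ.≤ (n ℕ.+ x) ℕ.^ (6 ℕ.+ k)
    power-bound {n} {e} x k 8≤n e≤n² = begin
      8 ℕ.* (e ℕ.* e) ℕ.+ 8
        ≤⟨ ℕ.+-mono-≤ (ℕ.*-mono-≤ 8≤n (ℕ.*-mono-≤ e≤n² e≤n²)) (ℕ.≤-trans 8≤n (ℕ.m≤m*n n (n ℕ.* n ℕ.* (n ℕ.* n)) {{ℕ.>-nonZero 0<n⁴}})) ⟩
      n ℕ.* (n ℕ.* n ℕ.* (n ℕ.* n)) ℕ.+ n ℕ.* (n ℕ.* n ℕ.* (n ℕ.* n))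
        ≡⟨ double (n ℕ.* (n ℕ.* n ℕ.* (n ℕ.* n))) ⟩
      2 ℕ.* (n ℕ.* (n ℕ.* n ℕ.* (n ℕ.* n)))
        ≤⟨ ℕ.*-monoˡ-≤ (n ℕ.* (n ℕ.* n ℕ.* (n ℕ.* n))) (ℕ.≤-trans (s≤s (s≤s z≤n)) 8≤n) ⟩
      n ℕ.* (n ℕ.* (n ℕ.* n ℕ.* (n ℕ.* n)))
        ≡⟨ sixth n ⟩
      n ℕ.^ 6
        ≤⟨ ℕ.^-monoˡ-≤ 6 (ℕ.m≤m+n n x) ⟩
      (n ℕ.+ x) ℕ.^ 6
        ≤⟨ ℕ.^-monoʳ-≤ (n ℕ.+ x) {{ℕ.>-nonZero (ℕ.≤-trans 0<n (ℕ.m≤m+n n x))}} (ℕ.m≤m+n 6 k) ⟩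
      (n ℕ.+ x) ℕ.^ (6 ℕ.+ k)
        ∎
      where
      open ℕ.≤-Reasoning
      0<n : 0 ℕ.< n
      0<n = ℕ.≤-trans (s≤s z≤n) 8≤n
      0<n⁴ : 0 ℕ.< n ℕ.* n ℕ.* (n ℕ.* n)
      0<n⁴ = ℕ.*-mono-≤ (ℕ.*-mono-≤ 0<n 0<n) (ℕ.*-mono-≤ 0<n 0<n)
      double : ∀ x → x ℕ.+ x ≡ 2 ℕ.* x
      double = solveℕ-∀
      sixth : ∀ n → n ℕ.* (n ℕ.* (n ℕ.* n ℕ.* (n ℕ.* n))) ≡ n ℕ.* (n ℕ.* (n ℕ.* (n ℕ.* (n ℕ.* (n ℕ.* 1)))))
      sixth = solveℕ-∀

    linear-bound : ∀ {m} f k → 1 ℕ.≤ m → m ℕ.* 52 ℕ.+ 4 ℕ.+ f ℕ.≤ (k ℕ.+ (56 ℕ.+ f)) ℕ.* m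
    linear-bound {m} f k 1≤m = begin
      m ℕ.* 52 ℕ.+ 4 ℕ.+ f                  ≡⟨ regroup m f ⟩
      52 ℕ.* m ℕ.+ (4 ℕ.+ f) ℕ.* 1          ≤⟨ ℕ.+-monoʳ-≤ (52 ℕ.* m) (ℕ.*-monoʳ-≤ (4 ℕ.+ f) 1≤m) ⟩
      52 ℕ.* m ℕ.+ (4 ℕ.+ f) ℕ.* m          ≤⟨ ℕ.m≤n+m (52 ℕ.* m ℕ.+ (4 ℕ.+ f) ℕ.* m) (k ℕ.* m) ⟩
      k ℕ.* m ℕ.+ (52 ℕ.* m ℕ.+ (4 ℕ.+ f) ℕ.* m) ≡⟨ factor m f k ⟩
      (k ℕ.+ (56 ℕ.+ f)) ℕ.* m              ∎
      where
      open ℕ.≤-Reasoning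
      regroup : ∀ m f → m ℕ.* 52 ℕ.+ 4 ℕ.+ f ≡ 52 ℕ.* m ℕ.+ (4 ℕ.+ f) ℕ.* 1
      regroup = solveℕ-∀
      factor : ∀ m f k → k ℕ.* m ℕ.+ (52 ℕ.* m ℕ.+ (4 ℕ.+ f) ℕ.* m) ≡ (k ℕ.+ (56 ℕ.+ f)) ℕ.* m
      factor = solveℕ-∀

  length-cartesianProduct : ∀ {A B : Set} (xs : List A) (ys : List B) → length (cartesianProduct xs ys) ≡ length xs ℕ.* length ys
  length-cartesianProduct []       ys = refl
  length-cartesianProduct (x ∷ xs) ys = trans (List.length-++ (map (x ,_) ys))
    (cong₂ ℕ._+_ (List.length-map (x ,_) ys) (length-cartesianProduct xs ys))

  size-≤-square : ∀ {n} (G : Graph n) → size G ℕ.≤ n ℕ.* n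
  size-≤-square {n} G = ℕ.≤-trans (List.length-filter _ (cartesianProduct (allFin n) (allFin n)))
    (ℕ.≤-reflexive (trans (length-cartesianProduct (allFin n) (allFin n)) (cong₂ ℕ._*_ (List.length-tabulate {n = n} (λ i → i)) (List.length-tabulate {n = n} (λ i → i)))))

  module _ {n} (G : Graph n) {r} (r+8≤n : r ℕ.+ 8 ℕ.≤ n) (¬complete : ¬ Complete G) (¬cocomplete : ¬ CoComplete G)
           (ℓ⋆ u⋆ : ℤ) (0≤ℓ⋆ : 0ℤ ≤ ℓ⋆) (ℓ⋆≤ℓ : ℓ⋆ ≤ + ℓ G (4 ℕ.+ r)) (u≤u⋆ : + u G (4 ℕ.+ r) ≤ u⋆)
           {es : List (Pair n)} (es↭ : es ↭ edges G) where

    private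
      c m : ℕ
      c = 4 ℕ.+ r
      m = size G

      -- The loop puts each edge in front of those already read, so it ends with the input reversed.
      L : List (Pair n)
      L = reverse es

      L↭ : L ↭ edges G
      L↭ = ↭-trans (↭.↭-reverse es) es↭

      es≡m : length es ≡ m
      es≡m = ↭.↭-length es↭

      L≡m : length L ≡ m
      L≡m = ↭.↭-length L↭

      A : ℤ
      A = + 2 * adjacent-pairs L

      8≤n : 8 ℕ.≤ n
      8≤n = ℕ.≤-trans (ℕ.m≤n+m 8 r) r+8≤n

      u≤m : u G c ℕ.≤ m
      u≤m = let S , _ , u≡X = u-attained G (ℕ.≤-trans (ℕ.≤-trans (ℕ.≤-reflexive (ℕ.+-comm 4 r)) (ℕ.+-monoʳ-≤ r (ℕ.m≤m+n 4 4))) r+8≤n) in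
        ℕ.≤-trans (ℕ.≤-reflexive u≡X) (List.length-filter _ (edges G))

      1≤m : 1 ℕ.≤ m
      1≤m = ℕ.≤-trans (ℤ.drop‿+<+ (fromℤ-cancel-< {+ 0} {+ u G c} (ℚ.<-trans (0<S₁ G r+8≤n ¬complete ¬cocomplete) (S₁<u G r+8≤n ¬complete ¬cocomplete)))) u≤m

      lower≡ : ceiling (lowerBound G c ℓ⋆) ≡ lowerFormula (+ n) (+ m) (+ c) A
      lower≡ = trans (ceiling-lowerBound≡ G r+8≤n ¬complete ¬cocomplete L↭ ℓ⋆ 0≤ℓ⋆ ℓ⋆≤ℓ)
        (cong (λ m → lowerFormula (+ n) (+ m) (+ c) A) L≡m)

      upper≡ : floor (upperBound G c u⋆) ≡ upperFormula u⋆ (+ n) (+ m) (+ c) A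
      upper≡ = trans (floor-upperBound≡ G r+8≤n ¬complete ¬cocomplete L↭ u⋆ u≤u⋆)
        (cong (λ m → upperFormula u⋆ (+ n) (+ m) (+ c) A) L≡m)

    run : ∀ W → n ℕ.≤ W → 8 ℕ.* (m ℕ.* m) ℕ.+ 8 ℕ.≤ W →
      ∃ λ s → Exec (encodeEdges es) W program (initial n m c ℓ⋆ u⋆) (m ℕ.* 52 ℕ.+ 4 ℕ.+ finish-cost) s ×
        variables s 0 ≡ ceiling (lowerBound G c ℓ⋆) × variables s 1 ≡ floor (upperBound G c u⋆)
    run W n≤W values≤W =
      let s , looped , inv = loop-exec m c ℓ⋆ u⋆ W es n≤W (subst (λ e → 8 ℕ.* (e ℕ.* e) ℕ.+ 8 ℕ.≤ W) (sym es≡m) values≤W)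
            es≡m [] es refl refl (edges-increasing G es↭) (initial-invariant m c ℓ⋆ u⋆)
          s′ , finished , out₀ , out₁ = finish-exec inv (encodeEdges es) W
            (ℕ.≤-trans (within-abs A-within) values≤W)
            (subst (λ x → ∣ x ∣ ℕ.≤ W) lower≡ (bound-small (ceiling-lowerBound-nonneg G r+8≤n ¬complete ¬cocomplete ℓ⋆ 0≤ℓ⋆ ℓ⋆≤ℓ) (ceiling-lowerBound G r+8≤n ¬complete ¬cocomplete ℓ⋆ ℓ⋆≤ℓ)))
            (subst (λ x → ∣ x ∣ ℕ.≤ W) upper≡ (bound-small (ℤ.≤-trans (+≤+ z≤n) (floor-upperBound G r+8≤n ¬complete ¬cocomplete u⋆ u≤u⋆)) (floor-upperBound-≤ G r+8≤n ¬complete ¬cocomplete u⋆ u≤u⋆)))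
      in s′ , seq (subst (λ e → Exec (encodeEdges es) W loop (initial n m c ℓ⋆ u⋆) (e ℕ.* 52 ℕ.+ 4) s) es≡m looped) finished
        , trans out₀ (sym lower≡) , trans out₁ (sym upper≡)
      where
      -- Both results lie between 0 and u ≤ m, so the words stored stay small although the
      -- numerators are larger polynomials.
      bound-small : ∀ {x} → 0ℤ ≤ x → x ≤ + u G c → ∣ x ∣ ℕ.≤ W
      bound-small 0≤x x≤u = ℕ.≤-trans (within-abs (0≤x , x≤u)) (ℕ.≤-trans u≤m (ℕ.≤-trans
        (ℕ.≤-trans (ℕ.m≤m*n m m {{ℕ.>-nonZero 1≤m}}) (ℕ.≤-trans (ℕ.m≤n*m (m ℕ.* m) 8) (ℕ.m≤m+n (8 ℕ.* (m ℕ.* m)) 8))) values≤W))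
      A-within : Within (8 ℕ.* (m ℕ.* m) ℕ.+ 8) A
      A-within = within-mono (ℕ.≤-trans (ℕ.≤-reflexive (trans (regroup (length L)) (cong (λ l → 8 ℕ.* (l ℕ.* l)) L≡m))) (ℕ.m≤m+n (8 ℕ.* (m ℕ.* m)) 8))
        (subst (Within _) (double (adjacent-pairs L)) (within-+ (adjacent-pairs-within L) (adjacent-pairs-within L)))
        where
        open import Data.Integer.Tactic.RingSolver using (solve-∀)
        double : ∀ x → x + x ≡ + 2 * x
        double = solve-∀
        regroup : ∀ l → 4 ℕ.* (l ℕ.* l) ℕ.+ 4 ℕ.* (l ℕ.* l) ≡ 8 ℕ.* (l ℕ.* l)
        regroup = solveℕ-∀

    correct : ∃[ t ] ∃[ s ]
      Exec (encodeEdges es) ((n ℕ.+ ∣ u⋆ ∣) ℕ.^ K) program (initial n (size G) c ℓ⋆ u⋆) t s ×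
      t ℕ.≤ K ℕ.* size G × variables s 0 ≡ ceiling (lowerBound G c ℓ⋆) × variables s 1 ≡ floor (upperBound G c u⋆)
    correct =
      let s , exec , out₀ , out₁ = run ((n ℕ.+ ∣ u⋆ ∣) ℕ.^ K) n≤W (power-bound (∣ u⋆ ∣) (56 ℕ.+ finish-cost) 8≤n (size-≤-square G))
      in _ , s , exec , linear-bound finish-cost 6 1≤m , out₀ , out₁
      where
      n≤W : n ℕ.≤ (n ℕ.+ ∣ u⋆ ∣) ℕ.^ K
      n≤W = ℕ.≤-trans (ℕ.m≤m+n n (∣ u⋆ ∣)) (ℕ.≤-trans (ℕ.≤-reflexive (sym (ℕ.^-identityʳ (n ℕ.+ ∣ u⋆ ∣))))
        (ℕ.^-monoʳ-≤ (n ℕ.+ ∣ u⋆ ∣) {{ℕ.>-nonZero (ℕ.≤-trans (s≤s z≤n) (ℕ.≤-trans 8≤n (ℕ.m≤m+n n (∣ u⋆ ∣))))}} (s≤s (z≤n {5 ℕ.+ (56 ℕ.+ finish-cost)}))))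

-- Assembly of the theorem.

open import Data.Integer using (∣_∣)
open import Data.Nat.Tactic.RingSolver using (solve-∀)
open import Data.Rational using (_-_; _*_)
open Algorithm using (program)
open Bounds
open Correctness using (K; correct)
open SizeBounds using (u≤γ; c-α≤ℓ)

private
  r+8≤ : ∀ r {n} → 4 ℕ.+ r ℕ.+ 4 ℕ.≤ n → r ℕ.+ 8 ℕ.≤ n
  r+8≤ r {n} = subst (ℕ._≤ n) (regroup r)
    where
    regroup : ∀ r → 4 ℕ.+ r ℕ.+ 4 ≡ r ℕ.+ 8
    regroup = solve-∀

theorem7 : (∀ {n} (G : Graph n) → ¬ Complete G → ¬ CoComplete G →
    ∀ c → 4 ℕ.≤ c → c ℕ.+ 4 ℕ.≤ n →
    (fromℕ (ℓ G c) ℚ.< S₁ G c × S₁ G c ℚ.< fromℕ (u G c)) ×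
    (σ² G c ≡ fromℕ 2 * S₂ G c - S₁ G c * (S₁ G c - 1ℚ)) ×
    (∀ ℓ⋆ u⋆ → + 0 ℤ.≤ ℓ⋆ → ℓ⋆ ℤ.≤ + ℓ G c → + ℓ G c ℤ.≤ + u G c → + u G c ℤ.≤ u⋆ →
    HasSubgraphOfSizeAtLeast G c (ceiling (lowerBound G c ℓ⋆)) ×
    HasSubgraphOfSizeAtMost G c (floor (upperBound G c u⋆))) ×
    (fromℕ (u G c) ≡ lowerBound G c (+ ℓ G c) ⇔ (IsStar G ⊎ IsSingleEdge G)) ×
    (fromℕ (u G c) ≡ lowerTerm G c (+ ℓ G c) ⇔
    (IsStar G ⊎ IsSingleEdge G ⊎ IsStar (complement G) ⊎ IsSingleEdge (complement G))) ×
    (fromℕ (ℓ G c) ≡ upperBound G c (+ u G c) ⇔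
    (IsStar G ⊎ IsSingleEdge G ⊎ IsStar (complement G) ⊎ IsSingleEdge (complement G))) ×
    (u G c ℕ.≤ γ G c ×
    HasSubgraphOfSizeAtMost G c (floor (upperBound G c (+ γ G c)))) ×
    (∀ α⋆ → independenceNumber G ℕ.≤ α⋆ →
    + c ℤ.- + α⋆ ℤ.≤ + ℓ G c ×
    HasSubgraphOfSizeAtLeast G c (ceiling (lowerBound G c (+ c ℤ.- + α⋆))))) ×
    (∃[ P ] ∃[ K ]
    ∀ {n} (G : Graph n) → ¬ Complete G → ¬ CoComplete G →
    ∀ c → 4 ℕ.≤ c → c ℕ.+ 4 ℕ.≤ n →
    ∀ ℓ⋆ u⋆ → + 0 ℤ.≤ ℓ⋆ → ℓ⋆ ℤ.≤ + ℓ G c → + ℓ G c ℤ.≤ + u G c → + u G c ℤ.≤ u⋆ →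
    ∀ es → es ↭ edges G →
    ∃[ t ] ∃[ s ]
    Exec (encodeEdges es) ((n ℕ.+ ∣ u⋆ ∣) ℕ.^ K) P (initial n (size G) c ℓ⋆ u⋆) t s ×
    t ℕ.≤ K ℕ.* size G ×
    variables s 0 ≡ ceiling (lowerBound G c ℓ⋆) ×
    variables s 1 ≡ floor (upperBound G c u⋆))
theorem7 =
    -- Matching on 4 ≤ c replaces c by 4 + r, the form in which the bounds are proved.
    (λ { G ¬complete ¬cocomplete _ (s≤s (s≤s (s≤s (s≤s {n = r} z≤n)))) c+4≤n →
      let bound = r+8≤ r c+4≤n
          c≤n = ℕ.m+n≤o⇒m≤o (4 ℕ.+ r) c+4≤n
      in (ℓ<S₁ G bound ¬complete ¬cocomplete , S₁<u G bound ¬complete ¬cocomplete)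
       , σ²-formula G bound ¬complete ¬cocomplete
       , (λ ℓ⋆ u⋆ _ ℓ⋆≤ℓ _ u≤u⋆ →
           at-least G bound ¬complete ¬cocomplete ℓ⋆ ℓ⋆≤ℓ , at-most G bound ¬complete ¬cocomplete u⋆ u≤u⋆)
       , lowerBound-tight G bound ¬complete ¬cocomplete
       , lowerTerm-tight G bound ¬complete ¬cocomplete
       , upperBound-tight G bound ¬complete ¬cocomplete
       , (u≤γ G c≤n , at-most G bound ¬complete ¬cocomplete (+ γ G (4 ℕ.+ r)) (ℤ.+≤+ (u≤γ G c≤n)))
       , (λ α⋆ α≤α⋆ → c-α≤ℓ G c≤n α≤α⋆ ,
           at-least G bound ¬complete ¬cocomplete (+ (4 ℕ.+ r) ℤ.- + α⋆) (c-α≤ℓ G c≤n α≤α⋆)) })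
  , program , K
  , (λ { G ¬complete ¬cocomplete _ (s≤s (s≤s (s≤s (s≤s {n = r} z≤n)))) c+4≤n ℓ⋆ u⋆ 0≤ℓ⋆ ℓ⋆≤ℓ _ u≤u⋆ es es↭ →
      correct G (r+8≤ r c+4≤n) ¬complete ¬cocomplete ℓ⋆ u⋆ 0≤ℓ⋆ ℓ⋆≤ℓ u≤u⋆ es↭ })
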